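{- Let $R$ be one of the chain rings $\mathbb{G}_4=\mathbb{Z}_4[X]/(X^2+X+1)$, $\mathbb{S}_4=\mathbb{F}_4[X]/(X^2)$, $\mathbb{T}_4=\mathbb{F}_4[X;a\mapsto a^2]/(X^2)$. Then $\mathrm{m}_7(R)\le 101$.
   Context: $\mathbb{F}_4[X;a\mapsto a^2]$ denotes the skew polynomial ring with commutation rule $Xa=a^2X$. For a finite chain ring $R$ of length $2$ with residue field $\mathbb{F}_q$, the projective Hjelmslev plane $\mathrm{PHG}(2,R)$ is the incidence structure whose points are the free rank-$1$ submodules of the right module $R_R^3$, whose lines are the free rank-$2$ submodules of $R_R^3$, with incidence given by inclusion. A projective $(k,n)$-arc is a set of $k$ points meeting every line in at most $n$ points. For $0\le n\le q^2+q$, $\mathrm{m}_n(R)$ denotes the largest $k$ such that a projective $(k,n)$-arc exists in $\mathrm{PHG}(2,R)$. -}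

module Defs where

open import Level using (0ℓ)
open import Algebra.Bundles using (CommutativeMonoid; Ring)
open import Algebra.Module.Bundles using (RightModule)
open import Algebra.Structures using (IsRing)
open import Data.Fin.Base using (Fin; zero; suc; toℕ)
open import Data.Fin.Properties using (*↔×; injective⇒≤) renaming (any? to anyFin?; all? to allFin?; _≟_ to _≟ᶠ_)
open import Data.Fin.Subset using (Subset; _∈_; ∣_∣)
open import Data.Fin.Subset.Properties using (anySubset?; _∈?_)
open import Data.Nat.Base using (ℕ; zero; suc; _≤_; z≤n; NonZero)
import Data.Nat.Base as ℕ
open import Data.Nat.DivMod using (_mod_)
open import Data.Nat.Properties using (_≤?_; ≤∧≢⇒<; ≤-pred)
open import Data.Product.Base using (Σ; ∃; _×_; _,_; proj₁; proj₂)
open import Data.Product.Function.NonDependent.Propositional using (_×-↔_)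
open import Data.Vec.Base using (Vec; []; _∷_; lookup; tabulate; replicate; zipWith; map)
open import Data.Vec.Properties using (lookup∘tabulate)
open import Data.Vec.Relation.Unary.All as All using (All; []; _∷_)
open import Function.Base using (id; _∘_)
open import Function.Bundles using (_↔_; Inverse)
open import Function.Properties.Inverse using (↔-sym; ↔-trans; ↔-refl)
open import Relation.Binary.Definitions using (DecidableEquality)
open import Relation.Binary.PropositionalEquality using (_≡_; refl; sym; trans; cong; cong₂; subst; isEquivalence; module ≡-Reasoning)
open import Relation.Nullary using (Dec; yes; no; ¬?)
open import Relation.Nullary.Decidable using (map′; _×-dec_; _→-dec_; toWitness; decidable-stable)
open import Relation.Unary using (Decidable)

module _ {R : Ring 0ℓ 0ℓ} (M : RightModule R 0ℓ 0ℓ) where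
  open Ring R using (Carrier; _≈_; 0#)
  open RightModule M using (Carrierᴹ; _≈ᴹ_; _+ᴹ_; _*ᵣ_; 0ᴹ)

  -- Closure under negation is the case a = - 1# of *ᵣ-closed.
  record Submodule : Set₁ where
    field
      Member    : Carrierᴹ → Set
      resp      : ∀ {x y} → x ≈ᴹ y → Member x → Member y
      0-member  : Member 0ᴹ
      +-closed  : ∀ {x y} → Member x → Member y → Member (x +ᴹ y)
      *ᵣ-closed : ∀ {x} a → Member x → Member (x *ᵣ a)

  open Submodule

  infix 4 _⊆_ _≐_

  _⊆_ : Submodule → Submodule → Set
  N ⊆ N′ = ∀ x → Member N x → Member N′ x

  _≐_ : Submodule → Submodule → Set
  N ≐ N′ = N ⊆ N′ × N′ ⊆ N

  combination : ∀ {k} → Vec Carrierᴹ k → Vec Carrier k → Carrierᴹ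
  combination []       []       = 0ᴹ
  combination (v ∷ vs) (a ∷ as) = v *ᵣ a +ᴹ combination vs as

  Independent : ∀ {k} → Vec Carrierᴹ k → Set
  Independent vs = ∀ as → combination vs as ≈ᴹ 0ᴹ → All (_≈ 0#) as

  Spans : ∀ {k} → Vec Carrierᴹ k → Submodule → Set
  Spans vs N = ∀ x → Member N x → ∃ λ as → x ≈ᴹ combination vs as

  record IsBasis {k} (vs : Vec Carrierᴹ k) (N : Submodule) : Set where
    field
      members     : All (Member N) vs
      spans       : Spans vs N
      independent : Independent vs

  FreeOfRank : ℕ → Submodule → Set
  FreeOfRank k N = ∃ λ (vs : Vec Carrierᴹ k) → IsBasis vs N

record FiniteRing : Set₁ where
  field
    Carrier     : Set
    _+_ _*_     : Carrier → Carrier → Carrier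
    -_          : Carrier → Carrier
    0# 1#       : Carrier
    isRing      : IsRing _≡_ _+_ _*_ -_ 0# 1#
    size        : ℕ
    enumeration : Fin size ↔ Carrier

  ring : Ring 0ℓ 0ℓ
  ring = record { isRing = isRing }

open FiniteRing using (ring)

open import Algebra.Module.Construct.DirectProduct using () renaming (rightModule to _⊕_)
open import Algebra.Module.Construct.TensorUnit using () renaming (rightModule to regular)

R³ : (R : FiniteRing) → RightModule (ring R) 0ℓ 0ℓ
R³ R = regular ⊕ (regular ⊕ regular)

Point : FiniteRing → Set₁
Point R = Σ (Submodule (R³ R)) (FreeOfRank (R³ R) 1)

Line : FiniteRing → Set₁
Line R = Σ (Submodule (R³ R)) (FreeOfRank (R³ R) 2)

SamePoint : (R : FiniteRing) → Point R → Point R → Set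
SamePoint R p q = _≐_ (R³ R) (proj₁ p) (proj₁ q)

Incident : (R : FiniteRing) → Point R → Line R → Set
Incident R p l = _⊆_ (R³ R) (proj₁ p) (proj₁ l)

-- A set of k points is an enumeration without repetition; a line meets it in
-- at most n points when every set of indices of points on it has size ≤ n.
record Arc (R : FiniteRing) (k n : ℕ) : Set₁ where
  field
    points   : Fin k → Point R
    distinct : ∀ {i j} → SamePoint R (points i) (points j) → i ≡ j
    meets    : (l : Line R) (S : Subset k) →
               (∀ {i} → i ∈ S → Incident R (points i) l) → ∣ S ∣ ≤ n

IsLargest : (ℕ → Set₁) → ℕ → Set₁
IsLargest P m = P m × (∀ k → P k → k ≤ m)

Omniscient : Set → Set₁
Omniscient A = ∀ {P : A → Set} → Decidable P → Dec (Σ A P)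

forall? : ∀ {A} → Omniscient A → {P : A → Set} → Decidable P → Dec (∀ x → P x)
forall? any? P? = map′ (λ ¬∃ x → decidable-stable (P? x) λ ¬p → ¬∃ (x , ¬p))
                    (λ ∀p (x , ¬p) → ¬p (∀p x))
                    (¬? (any? (¬? ∘ P?)))

omni-× : ∀ {A B} → Omniscient A → Omniscient B → Omniscient (A × B)
omni-× any₁ any₂ P? = map′ (λ (x , y , p) → (x , y) , p) (λ ((x , y) , p) → x , y , p)
                           (any₁ λ x → any₂ λ y → P? (x , y))

omni-Vec : ∀ {A} → Omniscient A → ∀ k → Omniscient (Vec A k)
omni-Vec any? zero    P? = map′ (λ p → [] , p) (λ { ([] , p) → p }) (P? [])
omni-Vec any? (suc k) P? =
  map′ (λ (x , xs , p) → x ∷ xs , p) (λ { (x ∷ xs , p) → x , xs , p })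
       (any? λ x → omni-Vec any? k λ xs → P? (x ∷ xs))

omni-↔ : ∀ {A n} → Fin n ↔ A → Omniscient A
omni-↔ e {P = P} P? = map′ (λ (i , p) → to i , p)
                       (λ (x , p) → from x , subst P (sym (strictlyInverseˡ x)) p)
                       (anyFin? (P? ∘ to))
  where open Inverse e

≟-↔ : ∀ {A : Set} {n} → Fin n ↔ A → DecidableEquality A
≟-↔ e x y = map′ (λ eq → trans (sym (strictlyInverseˡ x)) (trans (cong to eq) (strictlyInverseˡ y)))
                 (cong from) (from x ≟ᶠ from y)
  where open Inverse e

largest : (P : ℕ → Set₁) → (∀ k → Dec (P k)) → P 0 →
          ∀ b → (∀ k → P k → k ≤ b) → ∃ (IsLargest P)
largest P P? p₀ zero    bound = 0 , p₀ , bound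
largest P P? p₀ (suc b) bound with P? (suc b)
... | yes p = suc b , p , bound
... | no ¬p = largest P P? p₀ b λ k pk →
  ≤-pred (≤∧≢⇒< (bound k pk) λ { refl → ¬p pk })

module Span {R : Ring 0ℓ 0ℓ} (M : RightModule R 0ℓ 0ℓ) where
  open Ring R using (Carrier; 0#; 1#; _+_; _*_)
  open RightModule M
  open Submodule
  open import Algebra.Properties.CommutativeSemigroup (CommutativeMonoid.commutativeSemigroup +ᴹ-commutativeMonoid)
    using (interchange)

  comb-0 : ∀ {k} (vs : Vec Carrierᴹ k) → combination M vs (replicate k 0#) ≈ᴹ 0ᴹ
  comb-0 []       = ≈ᴹ-refl
  comb-0 (v ∷ vs) = ≈ᴹ-trans (+ᴹ-cong (*ᵣ-zeroʳ v) (comb-0 vs)) (+ᴹ-identityˡ 0ᴹ)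

  comb-+ : ∀ {k} (vs : Vec Carrierᴹ k) as bs →
           combination M vs (zipWith _+_ as bs) ≈ᴹ combination M vs as +ᴹ combination M vs bs
  comb-+ []       []       []       = ≈ᴹ-sym (+ᴹ-identityˡ 0ᴹ)
  comb-+ (v ∷ vs) (a ∷ as) (b ∷ bs) =
    ≈ᴹ-trans (+ᴹ-cong (*ᵣ-distribˡ v a b) (comb-+ vs as bs)) (interchange _ _ _ _)

  comb-* : ∀ {k} (vs : Vec Carrierᴹ k) as c →
           combination M vs (map (_* c) as) ≈ᴹ combination M vs as *ᵣ c
  comb-* []       []       c = ≈ᴹ-sym (*ᵣ-zeroˡ c)
  comb-* (v ∷ vs) (a ∷ as) c =
    ≈ᴹ-trans (+ᴹ-cong (≈ᴹ-sym (*ᵣ-assoc v a c)) (comb-* vs as c)) (≈ᴹ-sym (*ᵣ-distribʳ c _ _))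

  span : ∀ {k} → Vec Carrierᴹ k → Submodule M
  span vs = record
    { Member    = λ x → ∃ λ as → x ≈ᴹ combination M vs as
    ; resp      = λ x≈y (as , e) → as , ≈ᴹ-trans (≈ᴹ-sym x≈y) e
    ; 0-member  = _ , ≈ᴹ-sym (comb-0 vs)
    ; +-closed  = λ (as , e) (bs , f) → _ , ≈ᴹ-trans (+ᴹ-cong e f) (≈ᴹ-sym (comb-+ vs as bs))
    ; *ᵣ-closed = λ c (as , e) → _ , ≈ᴹ-trans (*ᵣ-cong e (Ring.refl R)) (≈ᴹ-sym (comb-* vs as c))
    }

  comb-member : ∀ {k} {vs : Vec Carrierᴹ k} (N : Submodule M) → All (Member N) vs → ∀ as →
                Member N (combination M vs as)
  comb-member N []       []       = 0-member N
  comb-member N (p ∷ ps) (a ∷ as) = +-closed N (*ᵣ-closed N a p) (comb-member N ps as)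

  span-members : ∀ {k} (vs : Vec Carrierᴹ k) → All (Member (span vs)) vs
  span-members []       = []
  span-members (v ∷ vs) =
    (1# ∷ replicate _ 0# , ≈ᴹ-sym (≈ᴹ-trans (+ᴹ-cong (*ᵣ-identityʳ v) (comb-0 vs)) (+ᴹ-identityʳ v)))
    ∷ All.map weaken (span-members vs)
    where
    weaken : ∀ {x} → Member (span vs) x → Member (span (v ∷ vs)) x
    weaken (as , e) = 0# ∷ as , ≈ᴹ-trans e
      (≈ᴹ-sym (≈ᴹ-trans (+ᴹ-cong (*ᵣ-zeroʳ v) ≈ᴹ-refl) (+ᴹ-identityˡ _)))

  span-basis : ∀ {k} {vs : Vec Carrierᴹ k} → Independent M vs → IsBasis M vs (span vs)
  span-basis ind = record { members = span-members _ ; spans = λ _ → id ; independent = ind }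

  basis⇒≐ : ∀ {k} {vs : Vec Carrierᴹ k} {N : Submodule M} → IsBasis M vs N → _≐_ M N (span vs)
  basis⇒≐ {N = N} b = IsBasis.spans b , λ x (as , e) →
    resp N (≈ᴹ-sym e) (comb-member N (IsBasis.members b) as)

module Search (R : FiniteRing) where
  open FiniteRing R
  open RightModule (R³ R) using (Carrierᴹ; _≈ᴹ_; 0ᴹ)
  open Span (R³ R)
  open Submodule

  _⊑_ = _⊆_ (R³ R)

  anyC : Omniscient Carrier
  anyC = omni-↔ enumeration

  _≟C_ : DecidableEquality Carrier
  _≟C_ = ≟-↔ enumeration

  anyV : Omniscient Carrierᴹ
  anyV = omni-× anyC (omni-× anyC anyC)

  _≈?_ : (x y : Carrierᴹ) → Dec (x ≈ᴹ y)
  (a , b , c) ≈? (d , e , f) = (a ≟C d) ×-dec ((b ≟C e) ×-dec (c ≟C f))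

  independent? : ∀ {k} (vs : Vec Carrierᴹ k) → Dec (Independent (R³ R) vs)
  independent? vs = forall? (omni-Vec anyC _) λ as →
    (combination (R³ R) vs as ≈? 0ᴹ) →-dec All.all? (_≟C 0#) as

  span-⊆? : ∀ {k l} (us : Vec Carrierᴹ k) (vs : Vec Carrierᴹ l) → Dec (span us ⊑ span vs)
  span-⊆? us vs = forall? anyV λ x → member? us x →-dec member? vs x
    where
    member? : ∀ {k} (vs : Vec Carrierᴹ k) x → Dec (Member (span vs) x)
    member? vs x = omni-Vec anyC _ λ as → x ≈? combination (R³ R) vs as

  ⟨_⟩ : Carrierᴹ → Submodule (R³ R)
  ⟨ v ⟩ = span (v ∷ [])

  Good : ∀ {k} → ℕ → Vec Carrierᴹ k → Set
  Good {k} n vs =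
    (∀ i → Independent (R³ R) (lookup vs i ∷ [])) ×
    (∀ i j → _≐_ (R³ R) ⟨ lookup vs i ⟩ ⟨ lookup vs j ⟩ → i ≡ j) ×
    (∀ (us : Vec Carrierᴹ 2) → Independent (R³ R) us → ∀ (S : Subset k) →
       (∀ i → i ∈ S → ⟨ lookup vs i ⟩ ⊑ span us) → ∣ S ∣ ≤ n)

  good? : ∀ {k} n (vs : Vec Carrierᴹ k) → Dec (Good n vs)
  good? n vs =
    allFin? (λ i → independent? (lookup vs i ∷ [])) ×-dec
    (allFin? (λ i → allFin? λ j →
       (span-⊆? (p i) (p j) ×-dec span-⊆? (p j) (p i)) →-dec (i ≟ᶠ j)) ×-dec
     forall? (omni-Vec anyV 2) λ us → independent? us →-dec
       forall? anySubset? λ S →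
         allFin? (λ i → (i ∈? S) →-dec span-⊆? (p i) us) →-dec (∣ S ∣ ≤? n))
    where
    p : Fin _ → Vec Carrierᴹ 1
    p i = lookup vs i ∷ []

  good⇒arc : ∀ {k n} → ∃ (Good {k} n) → Arc R k n
  good⇒arc (vs , ind , dist , meet) = record
    { points   = λ i → ⟨ lookup vs i ⟩ , lookup vs i ∷ [] , span-basis (ind i)
    ; distinct = dist _ _
    ; meets    = λ (N , us , b) S inc → meet us (IsBasis.independent b) S
                   λ i i∈S x p → proj₁ (basis⇒≐ {N = N} b) x (inc i∈S x p)
    }

  module _ {k n} (K : Arc R k n) where
    open Arc K

    generator : Fin k → Carrierᴹ
    generator i with points i
    ... | _ , v ∷ [] , _ = v

    isBasis : ∀ i → IsBasis (R³ R) (generator i ∷ []) (proj₁ (points i))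
    isBasis i with points i
    ... | _ , v ∷ [] , b = b

    same : ∀ i {v} → v ≡ generator i → _≐_ (R³ R) (proj₁ (points i)) ⟨ v ⟩
    same i refl = basis⇒≐ {N = proj₁ (points i)} (isBasis i)

    generators-distinct : ∀ {i j u v} → u ≡ generator i → v ≡ generator j →
                          _≐_ (R³ R) ⟨ u ⟩ ⟨ v ⟩ → i ≡ j
    generators-distinct {i} {j} p q (f , g) = distinct
      ( (λ x → proj₂ (same j q) x ∘ f x ∘ proj₁ (same i p) x)
      , (λ x → proj₂ (same i p) x ∘ g x ∘ proj₁ (same j q) x))

    arc⇒good : ∃ (Good {k} n)
    arc⇒good = vs
      , (λ i → subst (λ v → Independent (R³ R) (v ∷ [])) (sym (eq i)) (IsBasis.independent (isBasis i)))
      , (λ i j → generators-distinct (eq i) (eq j))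
      , (λ us ind S inc → meets (span us , us , span-basis ind) S
           λ {i} i∈S x p → inc i i∈S x (proj₁ (same i (eq i)) x p))
      where
      vs = tabulate generator
      eq : ∀ i → lookup vs i ≡ generator i
      eq = lookup∘tabulate generator

    arc-bounded : k ≤ size ℕ.* (size ℕ.* size)
    arc-bounded = injective⇒≤ {f = from ∘ generator} λ {i} {j} eq →
      generators-distinct refl
        (trans (sym (strictlyInverseˡ _)) (trans (cong to eq) (strictlyInverseˡ _)))
        ((λ _ → id) , (λ _ → id))
      where
      e : Fin (size ℕ.* (size ℕ.* size)) ↔ Carrierᴹ
      e = ↔-trans *↔× (enumeration ×-↔ ↔-trans *↔× (enumeration ×-↔ enumeration))
      open Inverse e

  arc? : ∀ n k → Dec (Arc R k n)
  arc? n k = map′ good⇒arc arc⇒good (omni-Vec anyV k (good? n))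

  empty : ∀ n → Arc R 0 n
  empty n = record { points = λ () ; distinct = λ { {()} } ; meets = λ { _ [] _ → z≤n } }

-- Abstract: unfolding would start an exhaustive search over all point sets.
abstract
  largestArc : ∀ n R → ∃ (IsLargest λ k → Arc R k n)
  largestArc n R = largest _ (arc? n) (empty n) _ (λ _ → arc-bounded)
    where open Search R

m : ℕ → FiniteRing → ℕ
m n R = proj₁ (largestArc n R)

m-isLargest : ∀ n R → IsLargest (λ k → Arc R k n) (m n R)
m-isLargest n R = proj₂ (largestArc n R)

record FiniteRawRing : Set₁ where
  field
    Carrier     : Set
    _+_ _*_     : Carrier → Carrier → Carrier
    -_          : Carrier → Carrier
    0# 1#       : Carrier
    size        : ℕ
    enumeration : Fin size ↔ Carrier

  omni : Omniscient Carrier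
  omni = omni-↔ enumeration

  _≟_ : DecidableEquality Carrier
  _≟_ = ≟-↔ enumeration

  Laws : Set
  Laws = (∀ x y z → ((x + y) + z ≡ x + (y + z)) × ((x * y) * z ≡ x * (y * z)) ×
                    (x * (y + z) ≡ (x * y) + (x * z)) × ((y + z) * x ≡ (y * x) + (z * x))) ×
         (∀ x y → x + y ≡ y + x) ×
         (∀ x → (0# + x ≡ x) × ((- x) + x ≡ 0#) × (1# * x ≡ x) × (x * 1# ≡ x))

  laws? : Dec Laws
  laws? = forall? omni (λ x → forall? omni λ y → forall? omni λ z →
                      (_ ≟ _) ×-dec ((_ ≟ _) ×-dec ((_ ≟ _) ×-dec (_ ≟ _)))) ×-dec
          (forall? omni (λ x → forall? omni λ y → _ ≟ _) ×-dec
           forall? omni (λ x → (_ ≟ _) ×-dec ((_ ≟ _) ×-dec ((_ ≟ _) ×-dec (_ ≟ _)))))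

  isRing : Laws → IsRing _≡_ _+_ _*_ -_ 0# 1#
  isRing (l₃ , +-comm , l₁) = record
    { +-isAbelianGroup = record
      { isGroup = record
        { isMonoid = record
          { isSemigroup = record
            { isMagma = record { isEquivalence = isEquivalence ; ∙-cong = cong₂ _+_ }
            ; assoc   = λ x y z → proj₁ (l₃ x y z) }
          ; identity = +-idˡ , λ x → trans (+-comm x 0#) (+-idˡ x) }
        ; inverse = -‿invˡ , λ x → trans (+-comm x (- x)) (-‿invˡ x)
        ; ⁻¹-cong = cong -_ }
      ; comm = +-comm }
    ; *-cong = cong₂ _*_
    ; *-assoc = λ x y z → proj₁ (proj₂ (l₃ x y z))
    ; *-identity = (λ x → proj₁ (proj₂ (proj₂ (l₁ x)))) , (λ x → proj₂ (proj₂ (proj₂ (l₁ x))))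
    ; distrib = (λ x y z → proj₁ (proj₂ (proj₂ (l₃ x y z)))) , (λ x y z → proj₂ (proj₂ (proj₂ (l₃ x y z))))
    }
    where
    +-idˡ : ∀ x → 0# + x ≡ x
    +-idˡ x = proj₁ (l₁ x)
    -‿invˡ : ∀ x → (- x) + x ≡ 0#
    -‿invˡ x = proj₁ (proj₂ (l₁ x))

  finiteRing : Laws → FiniteRing
  finiteRing laws = record { isRing = isRing laws ; enumeration = enumeration }

ℤ/ : (n : ℕ) .{{_ : NonZero n}} → FiniteRawRing
ℤ/ n = record
  { Carrier     = Fin n
  ; _+_         = λ x y → (toℕ x ℕ.+ toℕ y) mod n
  ; _*_         = λ x y → (toℕ x ℕ.* toℕ y) mod n
  ; -_          = λ x → (n ℕ.∸ toℕ x) mod n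
  ; 0#          = 0 mod n
  ; 1#          = 1 mod n
  ; enumeration = ↔-refl
  }

module _ (A : FiniteRawRing) where
  open FiniteRawRing A

  -- A[X]/(X² + pX + r) for commutative A. Every class has a unique
  -- representative a + bX, stored as (a , b), and
  --   (a + bX)(c + dX) = ac + (ad + bc)X + bdX²,  X² = -(pX + r).
  quadraticQuotient : (p r : Carrier) → FiniteRawRing
  quadraticQuotient p r = record
    { Carrier     = Carrier × Carrier
    ; _+_         = λ (a , b) (c , d) → a + c , b + d
    ; _*_         = λ (a , b) (c , d) →
        (a * c) + (- ((b * d) * r)) , ((a * d) + (b * c)) + (- ((b * d) * p))
    ; -_          = λ (a , b) → - a , - b
    ; 0#          = 0# , 0#
    ; 1#          = 1# , 0#
    ; enumeration = ↔-trans *↔× (enumeration ×-↔ enumeration)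
    }

  -- A[X; σ]/(X²), where Xa = σ(a)X; σ = id gives A[X]/(X²). Again (a , b)
  -- stands for a + bX, and
  --   (a + bX)(c + dX) = ac + (ad + bσ(c))X + bσ(d)X²,  X² = 0.
  skewTruncation : (σ : Carrier → Carrier) → FiniteRawRing
  skewTruncation σ = record
    { Carrier     = Carrier × Carrier
    ; _+_         = λ (a , b) (c , d) → a + c , b + d
    ; _*_         = λ (a , b) (c , d) → a * c , (a * d) + (b * σ c)
    ; -_          = λ (a , b) → - a , - b
    ; 0#          = 0# , 0#
    ; 1#          = 1# , 0#
    ; enumeration = ↔-trans *↔× (enumeration ×-↔ enumeration)
    }

  IsEndomorphism : (Carrier → Carrier) → Set
  IsEndomorphism σ = (∀ x y → (σ (x + y) ≡ σ x + σ y) × (σ (x * y) ≡ σ x * σ y)) × (σ 1# ≡ 1#)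

  endomorphism? : ∀ σ → Dec (IsEndomorphism σ)
  endomorphism? σ = forall? omni (λ x → forall? omni λ y → (_ ≟ _) ×-dec (_ ≟ _)) ×-dec (_ ≟ _)

  skewTruncation-laws : Laws → ∀ {σ} → IsEndomorphism σ → FiniteRawRing.Laws (skewTruncation σ)
  skewTruncation-laws laws {σ} (σ-hom , σ-1) =
      (λ (a , b) (c , d) (e , f) →
          cong₂ _,_ (+-assoc a c e) (+-assoc b d f)
        , cong₂ _,_ (*-assoc a c e) (assoc a b c d e f)
        , cong₂ _,_ (distribˡ a c e)
            (trans (cong₂ _+_ (distribˡ a d f) (trans (cong (b *_) (proj₁ (σ-hom c e))) (distribˡ b (σ c) (σ e))))
                   (interchange (a * d) (a * f) (b * σ c) (b * σ e)))
        , cong₂ _,_ (distribʳ a c e)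
            (trans (cong₂ _+_ (distribʳ b c e) (distribʳ (σ a) d f))
                   (interchange (c * b) (e * b) (d * σ a) (f * σ a))))
    , (λ (a , b) (c , d) → cong₂ _,_ (+-comm a c) (+-comm b d))
    , (λ (a , b) →
          cong₂ _,_ (+-identityˡ a) (+-identityˡ b)
        , cong₂ _,_ (-‿inverseˡ a) (-‿inverseˡ b)
        , cong₂ _,_ (*-identityˡ a) (trans (cong₂ _+_ (*-identityˡ b) (zeroˡ (σ a))) (+-identityʳ b))
        , cong₂ _,_ (*-identityʳ a)
            (trans (cong₂ _+_ (zeroʳ a) (trans (cong (b *_) σ-1) (*-identityʳ b))) (+-identityˡ b)))
    where
    A-ring : Ring 0ℓ 0ℓ
    A-ring = record { isRing = isRing laws }
    open Ring A-ring using
      ( +-assoc; +-comm; +-identityˡ; +-identityʳ; -‿inverseˡ; *-assoc; *-identityˡ; *-identityʳ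
      ; distribˡ; distribʳ; zeroˡ; zeroʳ; +-commutativeSemigroup)
    open import Algebra.Properties.CommutativeSemigroup +-commutativeSemigroup using (interchange)
    open ≡-Reasoning
    assoc : ∀ a b c d e f →
            ((a * c) * f) + (((a * d) + (b * σ c)) * σ e) ≡ (a * ((c * f) + (d * σ e))) + (b * σ (c * e))
    assoc a b c d e f = begin
      ((a * c) * f) + (((a * d) + (b * σ c)) * σ e)
        ≡⟨ cong₂ _+_ (*-assoc a c f) (distribʳ (σ e) (a * d) (b * σ c)) ⟩
      (a * (c * f)) + (((a * d) * σ e) + ((b * σ c) * σ e))
        ≡⟨ cong (_ +_) (cong₂ _+_ (*-assoc a d (σ e)) (*-assoc b (σ c) (σ e))) ⟩
      (a * (c * f)) + ((a * (d * σ e)) + (b * (σ c * σ e)))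
        ≡⟨ sym (+-assoc _ _ _) ⟩
      ((a * (c * f)) + (a * (d * σ e))) + (b * (σ c * σ e))
        ≡⟨ cong₂ _+_ (sym (distribˡ a (c * f) (d * σ e))) (cong (b *_) (sym (proj₂ (σ-hom c e)))) ⟩
      (a * ((c * f) + (d * σ e))) + (b * σ (c * e)) ∎

𝔽₄ : FiniteRawRing
𝔽₄ = quadraticQuotient (ℤ/ 2) (1 mod 2) (1 mod 2)

module 𝔽₄ = FiniteRawRing 𝔽₄

G₄ S₄ T₄ : FiniteRawRing
G₄ = quadraticQuotient (ℤ/ 4) (1 mod 4) (1 mod 4)
S₄ = skewTruncation 𝔽₄ id
T₄ = skewTruncation 𝔽₄ (λ a → a 𝔽₄.* a)

abstract
  𝔽₄-laws : 𝔽₄.Laws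
  𝔽₄-laws = toWitness {a? = 𝔽₄.laws?} _
  G₄-laws : FiniteRawRing.Laws G₄
  G₄-laws = toWitness {a? = FiniteRawRing.laws? G₄} _
  S₄-laws : FiniteRawRing.Laws S₄
  S₄-laws = skewTruncation-laws 𝔽₄ 𝔽₄-laws ((λ _ _ → refl , refl) , refl)
  T₄-laws : FiniteRawRing.Laws T₄
  T₄-laws = skewTruncation-laws 𝔽₄ 𝔽₄-laws (toWitness {a? = endomorphism? 𝔽₄ (λ a → a 𝔽₄.* a)} _)

𝔾₄ 𝕊₄ 𝕋₄ : FiniteRing
𝔾₄ = FiniteRawRing.finiteRing G₄ G₄-laws
𝕊₄ = FiniteRawRing.finiteRing S₄ S₄-laws
𝕋₄ = FiniteRawRing.finiteRing T₄ T₄-laws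

{-# OPTIONS --safe #-}

-- Let n X be the number of arc points in the neighbour class X, a point of PG(2,4), and let
-- N L be the sum of n over the five classes on a line class L. A class is an affine plane
-- AG(2,4); w X L s counts the arc points on the line s of its parallel class given by L.
-- Dually the 16 lines in L are the points of an AG(2,4) whose five parallel classes are the
-- classes X on L, and the deficiencies d = 7 − |line ∩ arc| are nonnegative weights on it
-- whose sum over the line (X , s) is 28 + n X − N L − 4 w X L s.
--
-- Suppose there are at least 102 points. As Σ N L over the lines through X is at least
-- 102 + 4 n X, nonnegativity of these sums together with Σ w² = n² + 4 n gives n ≤ 6, splits a
-- class with n = 5 as 2,2,1,0 in every direction, and leaves two types with n = 6: either
-- 2,2,2,0 in every direction, or N L = 22 in one direction and N L = 26 in the other four.
-- Looking at the weights d one sees that N L = 25 is impossible. Hence N L ≤ 24 or N L = 26,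
-- so no class has n = 5, and classes with n = 6 exist. A class with n = 6 splits along a line
-- with N L = 26 as 2,2,2,0 (type α) or 2,2,1,1 (type β). Since an α on such a line forces
-- exactly three β's there, and there are at most three β's per α through each class, equality
-- holds throughout. Then through each class with n = 6 pass four lines whose values are
-- 6,6,6,6,2 and an axis with N L = 22 split as 3,3,0,0. All values off an axis are 2 or 6, and
-- comparing two axes one finds 6,6,6,2,2 on an axis, which the weights d exclude.
module Submission where

open import Defs
open import Data.Nat.Base using (_≤_)
open import Data.Sum.Base using (_⊎_)
open import Relation.Binary.PropositionalEquality using (_≡_)

open import Algebra.Bundles using (Ring)
open import Algebra.Module.Bundles using (RightModule)
import Algebra.Properties.Group
import Algebra.Properties.Ring
open import Data.Bool.Base using (if_then_else_)
open import Data.Empty using (⊥)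
open import Data.Fin.Base using (Fin; zero; suc)
open import Data.Fin.Patterns using (0F; 1F; 2F; 3F)
open import Data.Fin.Properties using (all?) renaming (any? to anyF?; _≟_ to _≟Fin_; suc-injective to Fin-suc-injective)
open import Data.Fin.Subset using (∣_∣) renaming (_∈_ to _∈ˢ_)
open import Data.List.Base using (List; []; _∷_; _++_; map; filter; length; allFin; cartesianProduct)
open import Data.List.Properties using (map-tabulate; length-tabulate)
open import Data.List.Membership.Propositional using (_∈_; find; lose)
open import Data.List.Membership.Propositional.Properties using (∈-filter⁺; ∈-filter⁻)
open import Data.List.Relation.Unary.Any as Any using (here; there)
open import Data.Nat.Base using (ℕ; zero; suc; _+_; _*_; _∸_; _⊔_; _<_; z≤n; s≤s)
open import Data.Nat.DivMod using (_%_; [m+kn]%n≡m%n)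
open import Data.Nat.Properties renaming (_≟_ to _≟ℕ_)
open import Data.Nat.Tactic.RingSolver using (solve-∀)
open import Data.Product.Base using (∃; Σ; _×_; _,_; proj₁; proj₂; map₂)
open import Data.Product.Properties using (≡-dec)
open import Data.Sum.Base using (inj₁; inj₂)
open import Data.Vec.Base as Vec using (Vec; []; _∷_; lookup)
open import Data.Vec.Properties using (lookup∘tabulate; []=⇒lookup)
open import Data.Vec.Relation.Unary.All using ([]; _∷_)
open import Function.Base using (_∘_; id; _∋_)
open import Relation.Binary.Definitions using (DecidableEquality)
open import Relation.Binary.PropositionalEquality using (_≢_; refl; sym; trans; cong; cong₂; subst; subst₂; module ≡-Reasoning)
open import Relation.Nullary using (Dec; yes; no; does; ¬_; contradiction; ¬?)
open import Relation.Nullary.Decidable using (_×-dec_; _⊎-dec_; _→-dec_; map′; True; toWitness; from-yes; from-no; decidable-stable)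
open import Relation.Unary using (Decidable)

private variable
  I J K Φ Ψ : Set

-- Finite sums

⟦_⟧ : Dec Φ → ℕ
⟦ p? ⟧ = if does p? then 1 else 0

⟦⟧-yes : (p? : Dec Φ) → Φ → ⟦ p? ⟧ ≡ 1
⟦⟧-yes (yes _) _ = refl
⟦⟧-yes (no ¬p) p = contradiction p ¬p

⟦⟧-no : (p? : Dec Φ) → ¬ Φ → ⟦ p? ⟧ ≡ 0
⟦⟧-no (yes p) ¬p = contradiction p ¬p
⟦⟧-no (no _)  _  = refl

⟦⟧-⇔ : (p? : Dec Φ) (q? : Dec Ψ) → (Φ → Ψ) → (Ψ → Φ) → ⟦ p? ⟧ ≡ ⟦ q? ⟧
⟦⟧-⇔ p? (yes q) _ g = ⟦⟧-yes p? (g q)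
⟦⟧-⇔ p? (no ¬q) f _ = ⟦⟧-no p? (¬q ∘ f)

⟦⟧≤1 : (p? : Dec Φ) → ⟦ p? ⟧ ≤ 1
⟦⟧≤1 (yes _) = ≤-refl
⟦⟧≤1 (no _)  = z≤n

⟦×⟧ : (p? : Dec Φ) (q? : Dec Ψ) → ⟦ p? ⟧ * ⟦ q? ⟧ ≡ ⟦ p? ×-dec q? ⟧
⟦×⟧ (yes _) (yes _) = refl
⟦×⟧ (yes _) (no _)  = refl
⟦×⟧ (no _)  _       = refl

⟦⟧-*-cong : (p? : Dec Φ) {a b : ℕ} → (Φ → a ≡ b) → ⟦ p? ⟧ * a ≡ ⟦ p? ⟧ * b
⟦⟧-*-cong (yes p) eq = cong (1 *_) (eq p)
⟦⟧-*-cong (no _)  _  = refl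

∑ : List I → (I → ℕ) → ℕ
∑ []       f = 0
∑ (x ∷ xs) f = f x + ∑ xs f

infixr 8 ∑
syntax ∑ xs (λ x → e) = ∑[ x ← xs ] e

∑-cong : (xs : List I) {f g : I → ℕ} → (∀ {x} → x ∈ xs → f x ≡ g x) → ∑ xs f ≡ ∑ xs g
∑-cong []       eq = refl
∑-cong (x ∷ xs) eq = cong₂ _+_ (eq (here refl)) (∑-cong xs (eq ∘ there))

∑-mono : (xs : List I) {f g : I → ℕ} → (∀ {x} → x ∈ xs → f x ≤ g x) → ∑ xs f ≤ ∑ xs g
∑-mono []       le = z≤n
∑-mono (x ∷ xs) le = +-mono-≤ (le (here refl)) (∑-mono xs (le ∘ there))

∑-term : (xs : List I) (f : I → ℕ) {x : I} → x ∈ xs → f x ≤ ∑ xs f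
∑-term (x ∷ xs) f (here refl) = m≤m+n (f x) _
∑-term (x ∷ xs) f (there i)   = ≤-trans (∑-term xs f i) (m≤n+m _ (f x))

-- Source of nearly all exact values: once the total of the upper bounds is reached, no term has
-- slack.
∑-tight : (xs : List I) {f g : I → ℕ} → (∀ {x} → x ∈ xs → f x ≤ g x) → ∑ xs g ≤ ∑ xs f →
          ∀ {x} → x ∈ xs → f x ≡ g x
∑-tight (x ∷ xs) {f} {g} le ge (here refl) = ≤-antisym (le (here refl))
  (+-cancelʳ-≤ (∑ xs g) _ _ (≤-trans ge (+-monoʳ-≤ (f x) (∑-mono xs (le ∘ there)))))
∑-tight (x ∷ xs) {f} {g} le ge (there i) = ∑-tight xs (le ∘ there)
  (+-cancelˡ-≤ (g x) _ _ (≤-trans ge (+-monoˡ-≤ (∑ xs f) (le (here refl))))) i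

∑-+ : (xs : List I) (f g : I → ℕ) → ∑[ x ← xs ] (f x + g x) ≡ ∑ xs f + ∑ xs g
∑-+ []       f g = refl
∑-+ (x ∷ xs) f g = trans (cong (f x + g x +_) (∑-+ xs f g)) (interchange (f x) (g x) _ _)
  where open import Algebra.Properties.CommutativeSemigroup +-commutativeSemigroup using (interchange)

∑-*ˡ : (xs : List I) (c : ℕ) (f : I → ℕ) → ∑[ x ← xs ] (c * f x) ≡ c * ∑ xs f
∑-*ˡ []       c f = sym (*-zeroʳ c)
∑-*ˡ (x ∷ xs) c f = trans (cong (c * f x +_) (∑-*ˡ xs c f)) (sym (*-distribˡ-+ c (f x) _))

∑-*ʳ : (xs : List I) (f : I → ℕ) (c : ℕ) → ∑[ x ← xs ] (f x * c) ≡ ∑ xs f * c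
∑-*ʳ []       f c = refl
∑-*ʳ (x ∷ xs) f c = trans (cong (f x * c +_) (∑-*ʳ xs f c)) (sym (*-distribʳ-+ c (f x) _))

∑-const : (xs : List I) (c : ℕ) → ∑[ _ ← xs ] c ≡ length xs * c
∑-const []       c = refl
∑-const (x ∷ xs) c = cong (c +_) (∑-const xs c)

∑-zero : (xs : List I) → ∑[ _ ← xs ] 0 ≡ 0
∑-zero xs = trans (∑-const xs 0) (*-zeroʳ (length xs))

∑-zeros : (xs : List I) {f : I → ℕ} → (∀ {x} → x ∈ xs → f x ≡ 0) → ∑ xs f ≡ 0
∑-zeros xs eq = trans (∑-cong xs eq) (∑-zero xs)

∑-swap : (xs : List I) (ys : List J) (f : I → J → ℕ) →
         ∑[ x ← xs ] (∑[ y ← ys ] f x y) ≡ ∑[ y ← ys ] (∑[ x ← xs ] f x y)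
∑-swap []       ys f = sym (∑-zero ys)
∑-swap (x ∷ xs) ys f = trans (cong (∑ ys (f x) +_) (∑-swap xs ys f))
                             (sym (∑-+ ys (f x) (λ y → ∑[ x ← xs ] f x y)))

∑-filter : {Φ : I → Set} (P? : Decidable Φ) (xs : List I) (f : I → ℕ) →
           ∑ (filter P? xs) f ≡ ∑[ x ← xs ] (⟦ P? x ⟧ * f x)
∑-filter P? []       f = refl
∑-filter P? (x ∷ xs) f with P? x
... | yes _ = cong₂ _+_ (sym (*-identityˡ (f x))) (∑-filter P? xs f)
... | no  _ = ∑-filter P? xs f

∑-map : (xs : List I) (h : I → J) (f : J → ℕ) → ∑ (map h xs) f ≡ ∑ xs (f ∘ h)
∑-map []       h f = refl
∑-map (x ∷ xs) h f = cong (f (h x) +_) (∑-map xs h f)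

module Multiplicity (_≟_ : DecidableEquality I) where

  -- `multiplicity xs y ≡ 1` for all `y` expresses an enumeration without repetition in a form that
  -- evaluation decides and that collapses sums over indicators.
  multiplicity : List I → I → ℕ
  multiplicity xs y = ∑[ x ← xs ] ⟦ x ≟ y ⟧

  ∑-pick : (xs : List I) (y : I) (f : I → ℕ) →
           ∑[ x ← xs ] (⟦ x ≟ y ⟧ * f x) ≡ multiplicity xs y * f y
  ∑-pick xs y f = trans (∑-cong xs λ {x} _ → ⟦⟧-*-cong (x ≟ y) (cong f)) (∑-*ʳ xs _ (f y))

  ∑-pick₁ : (xs : List I) {y : I} (f : I → ℕ) → multiplicity xs y ≡ 1 →
            ∑[ x ← xs ] (⟦ x ≟ y ⟧ * f x) ≡ f y
  ∑-pick₁ xs {y} f once = trans (∑-pick xs y f) (trans (cong (_* f y) once) (*-identityˡ (f y)))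

  multiplicity-pos : (xs : List I) {y : I} → 1 ≤ multiplicity xs y → y ∈ xs
  multiplicity-pos (x ∷ xs) {y} le with x ≟ y
  ... | yes refl = here refl
  ... | no  _    = there (multiplicity-pos xs le)

  ∑-support₂ : (xs : List I) {y z : I} (f : I → ℕ) → multiplicity xs y ≡ 1 → multiplicity xs z ≡ 1 → y ≢ z →
               (∀ x → x ≢ y → x ≢ z → f x ≡ 0) → ∑ xs f ≡ f y + f z
  ∑-support₂ xs {y} {z} f once-y once-z y≢z vanish = begin
    ∑ xs f
      ≡⟨ ∑-cong xs (λ {x} _ → split x) ⟩
    ∑[ x ← xs ] (⟦ x ≟ y ⟧ * f x + ⟦ x ≟ z ⟧ * f x)
      ≡⟨ ∑-+ xs _ _ ⟩
    ∑[ x ← xs ] (⟦ x ≟ y ⟧ * f x) + ∑[ x ← xs ] (⟦ x ≟ z ⟧ * f x)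
      ≡⟨ cong₂ _+_ (∑-pick₁ xs f once-y) (∑-pick₁ xs f once-z) ⟩
    f y + f z ∎
    where
    open ≡-Reasoning
    split : ∀ x → f x ≡ ⟦ x ≟ y ⟧ * f x + ⟦ x ≟ z ⟧ * f x
    split x with x ≟ y | x ≟ z
    ... | yes refl | yes refl = contradiction refl y≢z
    ... | yes refl | no _     = sym (trans (+-identityʳ _) (+-identityʳ _))
    ... | no _     | yes refl = sym (+-identityʳ _)
    ... | no x≢y   | no x≢z   = vanish x x≢y x≢z

  ∑-support₁ : (xs : List I) {y : I} (f : I → ℕ) → multiplicity xs y ≡ 1 →
               (∀ x → x ≢ y → f x ≡ 0) → ∑ xs f ≡ f y
  ∑-support₁ xs {y} f once-y vanish = trans (∑-cong xs λ {x} _ → split x) (∑-pick₁ xs f once-y)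
    where
    split : ∀ x → f x ≡ ⟦ x ≟ y ⟧ * f x
    split x with x ≟ y
    ... | yes refl = sym (+-identityʳ _)
    ... | no x≢y   = vanish x x≢y

module Reindexing (_≟ᴬ_ : DecidableEquality I) (_≟ᴮ_ : DecidableEquality J) where
  open Multiplicity _≟ᴬ_ renaming (multiplicity to multiplicityᴬ; ∑-pick₁ to ∑-pickᴬ) using ()
  open Multiplicity _≟ᴮ_ renaming (multiplicity to multiplicityᴮ; ∑-pick₁ to ∑-pickᴮ) using ()

  -- Insert the indicators of `y ≟ᴮ e x`, which add up to 1 over `ys`, and exchange the summations.
  ∑-fibres : (xs : List I) (ys : List J) → (∀ y → multiplicityᴮ ys y ≡ 1) → (e : I → J) (f : I → ℕ) →
             ∑ xs f ≡ ∑[ y ← ys ] (∑[ x ← xs ] (⟦ e x ≟ᴮ y ⟧ * f x))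
  ∑-fibres xs ys once e f = begin
    ∑ xs f
      ≡⟨ ∑-cong xs (λ {x} _ → sym (∑-pickᴮ ys (λ _ → f x) (once (e x)))) ⟩
    ∑[ x ← xs ] (∑[ y ← ys ] (⟦ y ≟ᴮ e x ⟧ * f x))
      ≡⟨ ∑-swap xs ys _ ⟩
    ∑[ y ← ys ] (∑[ x ← xs ] (⟦ y ≟ᴮ e x ⟧ * f x))
      ≡⟨ ∑-cong ys (λ {y} _ → ∑-cong xs λ {x} _ → cong (_* f x) (⟦⟧-⇔ (y ≟ᴮ e x) (e x ≟ᴮ y) sym sym)) ⟩
    ∑[ y ← ys ] (∑[ x ← xs ] (⟦ e x ≟ᴮ y ⟧ * f x)) ∎
    where open ≡-Reasoning

  -- `m` parametrises the elements satisfying `P?`, with inverse `e`, so only the term at `m y`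
  -- survives in the fibre over `y`.
  ∑-reindex : (xs : List I) (ys : List J) → (∀ x → multiplicityᴬ xs x ≡ 1) → (∀ y → multiplicityᴮ ys y ≡ 1) →
              {Φ : I → Set} (P? : Decidable Φ) (e : I → J) (m : J → I) →
              (∀ y → Φ (m y)) → (∀ y → e (m y) ≡ y) → (∀ x → Φ x → m (e x) ≡ x) →
              (f : I → ℕ) → ∑[ x ← xs ] (⟦ P? x ⟧ * f x) ≡ ∑[ y ← ys ] f (m y)
  ∑-reindex xs ys onceᴬ onceᴮ P? e m Φ-m e-m m-e f =
    trans (∑-fibres xs ys onceᴮ e _)
          (∑-cong ys λ {y} _ → trans (∑-cong xs λ {x} _ → indicator x y) (∑-pickᴬ xs f (onceᴬ (m y))))
    where
    indicator : ∀ x y → ⟦ e x ≟ᴮ y ⟧ * (⟦ P? x ⟧ * f x) ≡ ⟦ x ≟ᴬ m y ⟧ * f x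
    indicator x y = trans (sym (*-assoc ⟦ e x ≟ᴮ y ⟧ _ _)) (cong (_* f x)
      (trans (⟦×⟧ (e x ≟ᴮ y) (P? x))
             (⟦⟧-⇔ ((e x ≟ᴮ y) ×-dec P? x) (x ≟ᴬ m y) (λ { (refl , p) → sym (m-e x p) }) (λ { refl → e-m y , Φ-m y }))))

module _ (_≟ᴬ_ : DecidableEquality I) (_≟ᴮ_ : DecidableEquality J) where
  open Reindexing _≟ᴬ_ _≟ᴮ_ using (∑-fibres)
  open Multiplicity _≟ᴬ_ renaming (multiplicity to multiplicityᴬ) using (∑-pick₁)
  open Multiplicity _≟ᴮ_ renaming (multiplicity to multiplicityᴮ) using ()

  fibre : List I → (I → J) → (I → ℕ) → J → ℕ
  fibre xs e f y = ∑[ x ← xs ] (⟦ e x ≟ᴮ y ⟧ * f x)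

  ∑-fibre² : (xs : List I) (ys : List J) → (∀ y → multiplicityᴮ ys y ≡ 1) → (e : I → J) (f : I → ℕ) →
             ∑[ y ← ys ] (fibre xs e f y * fibre xs e f y) ≡
             ∑[ x ← xs ] (f x * (∑[ x′ ← xs ] (⟦ e x′ ≟ᴮ e x ⟧ * f x′)))
  ∑-fibre² xs ys once e f = begin
    ∑[ y ← ys ] (g y * g y)
      ≡⟨ ∑-cong ys (λ {y} _ → sym (∑-*ʳ xs _ (g y))) ⟩
    ∑[ y ← ys ] (∑[ x ← xs ] (⟦ e x ≟ᴮ y ⟧ * f x * g y))
      ≡⟨ ∑-cong ys (λ {y} _ → ∑-cong xs λ {x} _ → trans (*-assoc ⟦ e x ≟ᴮ y ⟧ (f x) (g y))
           (⟦⟧-*-cong (e x ≟ᴮ y) λ { refl → refl })) ⟩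
    ∑[ y ← ys ] (∑[ x ← xs ] (⟦ e x ≟ᴮ y ⟧ * (f x * g (e x))))
      ≡⟨ ∑-fibres xs ys once e _ ⟨
    ∑[ x ← xs ] (f x * g (e x)) ∎
    where
    open ≡-Reasoning
    g = fibre xs e f

  -- Double counting of the pairs of elements of the multiset f in a common fibre of some e z.
  ∑-parallel² : (zs : List K) (xs : List I) (ys : List J) →
                (∀ x → multiplicityᴬ xs x ≡ 1) → (∀ y → multiplicityᴮ ys y ≡ 1) →
                (e : K → I → J) (c : ℕ) →
                (∀ x x′ → ∑[ z ← zs ] ⟦ e z x ≟ᴮ e z x′ ⟧ ≡ 1 + c * ⟦ x ≟ᴬ x′ ⟧) → (f : I → ℕ) →
                ∑[ z ← zs ] (∑[ y ← ys ] (fibre xs (e z) f y * fibre xs (e z) f y)) ≡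
                ∑ xs f * ∑ xs f + c * (∑[ x ← xs ] (f x * f x))
  ∑-parallel² zs xs ys onceᴬ onceᴮ e c parallel f = begin
    ∑[ z ← zs ] (∑[ y ← ys ] (fibre xs (e z) f y * fibre xs (e z) f y))
      ≡⟨ ∑-cong zs (λ {z} _ → ∑-fibre² xs ys onceᴮ (e z) f) ⟩
    ∑[ z ← zs ] (∑[ x ← xs ] (f x * (∑[ x′ ← xs ] (⟦ e z x′ ≟ᴮ e z x ⟧ * f x′))))
      ≡⟨ ∑-swap zs xs _ ⟩
    ∑[ x ← xs ] (∑[ z ← zs ] (f x * (∑[ x′ ← xs ] (⟦ e z x′ ≟ᴮ e z x ⟧ * f x′))))
      ≡⟨ ∑-cong xs (λ {x} _ → trans (∑-*ˡ zs (f x) _) (cong (f x *_) (row x))) ⟩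
    ∑[ x ← xs ] (f x * (∑ xs f + c * f x))
      ≡⟨ ∑-cong xs (λ {x} _ → trans (*-distribˡ-+ (f x) (∑ xs f) (c * f x)) (cong (f x * ∑ xs f +_) (x∙yz≈y∙xz (f x) c (f x)))) ⟩
    ∑[ x ← xs ] (f x * ∑ xs f + c * (f x * f x))
      ≡⟨ ∑-+ xs _ _ ⟩
    ∑[ x ← xs ] (f x * ∑ xs f) + ∑[ x ← xs ] (c * (f x * f x))
      ≡⟨ cong₂ _+_ (∑-*ʳ xs f (∑ xs f)) (∑-*ˡ xs c _) ⟩
    ∑ xs f * ∑ xs f + c * (∑[ x ← xs ] (f x * f x)) ∎
    where
    open ≡-Reasoning
    open import Algebra.Properties.CommutativeSemigroup *-commutativeSemigroup using (x∙yz≈y∙xz)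
    -- By `parallel`, `x′` shares a fibre with `x` for one `z` if `x′ ≢ x`, and for `1 + c` of them
    -- if `x′ ≡ x`.
    row : ∀ x → ∑[ z ← zs ] (∑[ x′ ← xs ] (⟦ e z x′ ≟ᴮ e z x ⟧ * f x′)) ≡ ∑ xs f + c * f x
    row x = begin
      ∑[ z ← zs ] (∑[ x′ ← xs ] (⟦ e z x′ ≟ᴮ e z x ⟧ * f x′))
        ≡⟨ ∑-swap zs xs _ ⟩
      ∑[ x′ ← xs ] (∑[ z ← zs ] (⟦ e z x′ ≟ᴮ e z x ⟧ * f x′))
        ≡⟨ ∑-cong xs (λ {x′} _ → trans (∑-*ʳ zs _ (f x′)) (trans (cong (_* f x′) (parallel x′ x))
             (cong (f x′ +_) (*-assoc c ⟦ x′ ≟ᴬ x ⟧ (f x′))))) ⟩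
      ∑[ x′ ← xs ] (f x′ + c * (⟦ x′ ≟ᴬ x ⟧ * f x′))
        ≡⟨ trans (∑-+ xs _ _) (cong (∑ xs f +_) (trans (∑-*ˡ xs c _) (cong (c *_) (∑-pick₁ xs f (onceᴬ x))))) ⟩
      ∑ xs f + c * f x ∎

∑-allFin-suc : ∀ {k} (f : Fin (suc k) → ℕ) → ∑ (allFin (suc k)) f ≡ f zero + ∑ (allFin k) (f ∘ suc)
∑-allFin-suc {k} f = cong (f zero +_) (trans (cong (λ xs → ∑ xs f) (sym (map-tabulate id suc))) (∑-map (allFin k) suc f))

∑-indicator≤1 : ∀ {k} {Φ : Fin k → Set} (P? : Decidable Φ) → (∀ {i j} → Φ i → Φ j → i ≡ j) →
                ∑[ i ← allFin k ] ⟦ P? i ⟧ ≤ 1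
∑-indicator≤1 {zero}  P? unique = z≤n
∑-indicator≤1 {suc k} P? unique rewrite ∑-allFin-suc (λ i → ⟦ P? i ⟧) with P? zero
... | no  _  = ∑-indicator≤1 (P? ∘ suc) (λ p q → Fin-suc-injective (unique p q))
... | yes p₀ = s≤s (≤-reflexive (trans (∑-cong (allFin k) λ {i} _ → ⟦⟧-no (P? (suc i)) λ p → contradiction (unique p₀ p) λ ())
                                       (∑-zero (allFin k))))

-- Links the subset cardinalities in the definition of an arc with indicator sums.
∣tabulate∣ : ∀ {k} {Φ : Fin k → Set} (P? : Decidable Φ) →
             ∣ Vec.tabulate (λ i → does (P? i)) ∣ ≡ ∑[ i ← allFin k ] ⟦ P? i ⟧
∣tabulate∣ {zero}  P? = refl
∣tabulate∣ {suc k} P? rewrite ∑-allFin-suc (λ i → ⟦ P? i ⟧) with P? zero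
... | yes _ = cong suc (∣tabulate∣ (P? ∘ suc))
... | no  _ = ∣tabulate∣ (P? ∘ suc)

∈-tabulate⁻ : ∀ {k} {Φ : Fin k → Set} (P? : Decidable Φ) i → i ∈ˢ Vec.tabulate (λ i → does (P? i)) → Φ i
∈-tabulate⁻ P? i i∈S with P? i | trans (sym (lookup∘tabulate (λ i → does (P? i)) i)) ([]=⇒lookup i∈S)
... | yes p | _ = p

search : {A : Set} {P : A → Set} (P? : Decidable P) (xs : List A) →
         (∃ λ x → x ∈ xs × P x) ⊎ (∀ {x} → x ∈ xs → ¬ P x)
search P? xs with Any.any? P? xs
... | yes any = inj₁ (find any)
... | no none = inj₂ λ i p → none (lose i p)

-- The projective plane over 𝔽₄

-- 2F is a primitive element.
F : Set
F = Fin 4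

infixl 6 _⊕_
infixl 7 _⊗_

_⊕_ _⊗_ : F → F → F
0F ⊕ b  = b
a  ⊕ 0F = a
1F ⊕ 1F = 0F
1F ⊕ 2F = 3F
1F ⊕ 3F = 2F
2F ⊕ 1F = 3F
2F ⊕ 2F = 0F
2F ⊕ 3F = 1F
3F ⊕ 1F = 2F
3F ⊕ 2F = 1F
3F ⊕ 3F = 0F
0F ⊗ b  = 0F
1F ⊗ b  = b
2F ⊗ 0F = 0F
2F ⊗ 1F = 2F
2F ⊗ 2F = 3F
2F ⊗ 3F = 1F
3F ⊗ 0F = 0F
3F ⊗ 1F = 3F
3F ⊗ 2F = 1F
3F ⊗ 3F = 2F

_≟F_ : DecidableEquality F
_≟F_ = _≟Fin_

U : Set
U = F × F

_≟U_ : DecidableEquality U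
_≟U_ = ≡-dec _≟F_ _≟F_

allF? : {P : F → Set} → Decidable P → Dec (∀ s → P s)
allF? = all?

allU? : {P : U → Set} → Decidable P → Dec (∀ u → P u)
allU? P? = map′ (λ f (x , y) → f x y) (λ f x y → f (x , y)) (allF? λ x → allF? λ y → P? (x , y))

-- The points of PG(2,4), and dually its lines, in homogeneous coordinates
-- whose first nonzero entry is 1.
data PG : Set where
  [1∶_∶_] : F → F → PG
  [0∶1∶_] : F → PG
  [0∶0∶1] : PG

allPG? : {P : PG → Set} → Decidable P → Dec (∀ X → P X)
allPG? {P} P? = map′ to from
  (allF? (λ a → allF? λ b → P? [1∶ a ∶ b ]) ×-dec (allF? (λ b → P? [0∶1∶ b ]) ×-dec P? [0∶0∶1]))
  where
  to : _ → ∀ X → P X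
  to (f , g , h) [1∶ a ∶ b ] = f a b
  to (f , g , h) [0∶1∶ b ]   = g b
  to (f , g , h) [0∶0∶1]     = h
  from : (∀ X → P X) → _
  from f = (λ a b → f [1∶ a ∶ b ]) , (λ b → f [0∶1∶ b ]) , f [0∶0∶1]

_≟P_ : DecidableEquality PG
[1∶ a ∶ b ] ≟P [1∶ c ∶ d ] = map′ (λ (p , q) → cong₂ [1∶_∶_] p q) (λ { refl → refl , refl }) ((a ≟F c) ×-dec (b ≟F d))
[1∶ _ ∶ _ ] ≟P [0∶1∶ _ ]   = no λ ()
[1∶ _ ∶ _ ] ≟P [0∶0∶1]     = no λ ()
[0∶1∶ _ ]   ≟P [1∶ _ ∶ _ ] = no λ ()
[0∶1∶ b ]   ≟P [0∶1∶ d ]   = map′ (cong [0∶1∶_]) (λ { refl → refl }) (b ≟F d)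
[0∶1∶ _ ]   ≟P [0∶0∶1]     = no λ ()
[0∶0∶1]     ≟P [1∶ _ ∶ _ ] = no λ ()
[0∶0∶1]     ≟P [0∶1∶ _ ]   = no λ ()
[0∶0∶1]     ≟P [0∶0∶1]     = yes refl

coordinates : PG → F × F × F
coordinates [1∶ a ∶ b ] = 1F , a , b
coordinates [0∶1∶ b ]   = 0F , 1F , b
coordinates [0∶0∶1]     = 0F , 0F , 1F

dot : PG → PG → F
dot X L = let (x , y , z) = coordinates X ; (l , m , n) = coordinates L in l ⊗ x ⊕ m ⊗ y ⊕ n ⊗ z

elements : List F
elements = allFin 4

abstract
  vectors : List U
  vectors = cartesianProduct elements elements

  classes : List PG
  classes = map (λ (a , b) → [1∶ a ∶ b ]) vectors ++ map [0∶1∶_] elements ++ [0∶0∶1] ∷ []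

  on : PG → List PG
  on L = filter (λ X → dot X L ≟F 0F) classes

-- The coordinates of Y at the positions other than that of the leading 1 of L.
coefficients : PG → PG → U
coefficients L Y with coordinates Y
coefficients [1∶ _ ∶ _ ] _ | _ , y , z = y , z
coefficients [0∶1∶ _ ]   _ | x , _ , z = x , z
coefficients [0∶0∶1]     _ | x , y , _ = x , y

form : U → U → F
form (a , b) (x , y) = a ⊗ x ⊕ b ⊗ y

-- For `Y` on `L`, the level sets of `lin L Y` are the four parallel lines of direction `Y` in the
-- affine plane attached to `L`. With the roles exchanged, `lin X L` does the same inside the class
-- `X`.
lin : PG → PG → U → F
lin L Y = form (coefficients L Y)

open Multiplicity _≟F_ public using () renaming (multiplicity to multiplicityF)
open Multiplicity _≟U_ public using () renaming (multiplicity to multiplicityU)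
open Multiplicity _≟P_ public using () renaming (multiplicity to multiplicityP)

abstract
  elements-once : ∀ s → multiplicityF elements s ≡ 1
  elements-once = from-yes (allF? λ s → multiplicityF elements s ≟ℕ 1)

  vectors-once : ∀ u → multiplicityU vectors u ≡ 1
  vectors-once = from-yes (allU? λ u → multiplicityU vectors u ≟ℕ 1)

  classes-once : ∀ X → multiplicityP classes X ≡ 1
  classes-once = from-yes (allPG? λ X → multiplicityP classes X ≟ℕ 1)

  dot-sym : ∀ X L → dot X L ≡ dot L X
  dot-sym = from-yes (allPG? λ X → allPG? λ L → dot X L ≟F dot L X)

abstract
  ∈-on⁺ : ∀ {X L} → dot X L ≡ 0F → X ∈ on L
  ∈-on⁺ {X} {L} = ∈-filter⁺ (λ X → dot X L ≟F 0F)
    (Multiplicity.multiplicity-pos _≟P_ classes (≤-reflexive (sym (classes-once X))))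

  ∈-on⁻ : ∀ {X L} → X ∈ on L → dot X L ≡ 0F
  ∈-on⁻ {X} {L} i = proj₂ (∈-filter⁻ (λ X → dot X L ≟F 0F) {xs = classes} i)

on-sym : ∀ {X L} → X ∈ on L → L ∈ on X
on-sym {X} {L} i = ∈-on⁺ (trans (dot-sym L X) (∈-on⁻ i))

abstract
  vectors-length : length vectors ≡ 16
  vectors-length = refl

  classes-length : length classes ≡ 21
  classes-length = refl

  on-filter : ∀ L (f : PG → ℕ) → ∑ (on L) f ≡ ∑[ X ← classes ] (⟦ dot X L ≟F 0F ⟧ * f X)
  on-filter L = ∑-filter (λ X → dot X L ≟F 0F) classes

  on-length : ∀ L → length (on L) ≡ 5
  on-length = from-yes (allPG? λ L → length (on L) ≟ℕ 5)

  dot⇒on-once : ∀ X L → dot X L ≡ 0F → multiplicityP (on L) X ≡ 1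
  dot⇒on-once = from-yes (allPG? λ X → allPG? λ L → (dot X L ≟F 0F) →-dec (multiplicityP (on L) X ≟ℕ 1))

  -- Distinct points have one line in common, and a point lies on five; one formula covers both
  -- cases.
  joining : ∀ X Y → ∑[ L ← on X ] multiplicityP (on L) Y ≡ 1 + 4 * ⟦ X ≟P Y ⟧
  joining = from-yes (allPG? λ X → allPG? λ Y → ∑[ L ← on X ] multiplicityP (on L) Y ≟ℕ 1 + 4 * ⟦ X ≟P Y ⟧)

  -- Distinct points of an affine plane of order 4 are collinear in exactly one of its five
  -- directions.
  lin-parallel : ∀ X u v → ∑[ L ← on X ] ⟦ lin X L u ≟F lin X L v ⟧ ≡ 1 + 4 * ⟦ u ≟U v ⟧
  lin-parallel = from-yes (allPG? λ X → allU? λ u → allU? λ v →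
    ∑[ L ← on X ] ⟦ lin X L u ≟F lin X L v ⟧ ≟ℕ 1 + 4 * ⟦ u ≟U v ⟧)

determinant : U → U → F
determinant (a , b) (a′ , b′) = a ⊗ b′ ⊕ b ⊗ a′

-- Cramer's rule; the inverse of a nonzero Δ is its square.
solve : U → U → F → F → U
solve (a , b) (a′ , b′) s t = Δ ⊗ Δ ⊗ (s ⊗ b′ ⊕ t ⊗ b) , Δ ⊗ Δ ⊗ (s ⊗ a′ ⊕ t ⊗ a)
  where Δ = determinant (a , b) (a′ , b′)

abstract
  solve-correct : ∀ p q → determinant p q ≢ 0F →
    (∀ s t → form p (solve p q s t) ≡ s × form q (solve p q s t) ≡ t) ×
    (∀ u → solve p q (form p u) (form q u) ≡ u)
  solve-correct = from-yes (allU? λ p → allU? λ q → ¬? (determinant p q ≟F 0F) →-dec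
    (allF? (λ s → allF? λ t → (form p (solve p q s t) ≟F s) ×-dec (form q (solve p q s t) ≟F t)) ×-dec
     allU? (λ u → solve p q (form p u) (form q u) ≟U u)))

  dot⇒line-size : ∀ L X → dot X L ≡ 0F → ∀ s → ∑[ u ← vectors ] ⟦ lin L X u ≟F s ⟧ ≡ 4
  dot⇒line-size = from-yes (allPG? λ L → allPG? λ X → (dot X L ≟F 0F) →-dec allF? λ s →
    ∑[ u ← vectors ] ⟦ lin L X u ≟F s ⟧ ≟ℕ 4)

  -- The equation of `L` expresses the dropped coordinate through the other two, so dependent
  -- coefficients would make `X` and `Y` proportional.
  dot⇒determinant≢0 : ∀ L X → dot X L ≡ 0F → ∀ Y → dot Y L ≡ 0F → X ≢ Y →
                      determinant (coefficients L X) (coefficients L Y) ≢ 0F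
  dot⇒determinant≢0 = from-yes (allPG? λ L → allPG? λ X → (dot X L ≟F 0F) →-dec allPG? λ Y → (dot Y L ≟F 0F) →-dec
    (¬? (X ≟P Y) →-dec ¬? (determinant (coefficients L X) (coefficients L Y) ≟F 0F)))

on-once : ∀ {X L} → X ∈ on L → multiplicityP (on L) X ≡ 1
on-once {X} {L} i = dot⇒on-once X L (∈-on⁻ i)

line-size : ∀ {X L} → X ∈ on L → ∀ s → ∑[ u ← vectors ] ⟦ lin L X u ≟F s ⟧ ≡ 4
line-size {X} {L} i = dot⇒line-size L X (∈-on⁻ i)

determinant≢0 : ∀ {L X Y} → X ∈ on L → Y ∈ on L → X ≢ Y →
                determinant (coefficients L X) (coefficients L Y) ≢ 0F
determinant≢0 {L} {X} {Y} i j = dot⇒determinant≢0 L X (∈-on⁻ i) Y (∈-on⁻ j)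

module _ {L X Y : PG} (i : X ∈ on L) (j : Y ∈ on L) (X≢Y : X ≢ Y) where

  abstract
    meet : F → F → U
    meet = solve (coefficients L X) (coefficients L Y)

    lin-meetˡ : ∀ s t → lin L X (meet s t) ≡ s
    lin-meetˡ s t = proj₁ (proj₁ (solve-correct (coefficients L X) (coefficients L Y) (determinant≢0 {L} {X} {Y} i j X≢Y)) s t)

    lin-meetʳ : ∀ s t → lin L Y (meet s t) ≡ t
    lin-meetʳ s t = proj₂ (proj₁ (solve-correct (coefficients L X) (coefficients L Y) (determinant≢0 {L} {X} {Y} i j X≢Y)) s t)

    meet-lin : ∀ u → meet (lin L X u) (lin L Y u) ≡ u
    meet-lin = proj₂ (solve-correct (coefficients L X) (coefficients L Y) (determinant≢0 {L} {X} {Y} i j X≢Y))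

  meet-unique : ∀ {s t} u → lin L X u ≡ s → lin L Y u ≡ t → u ≡ meet s t
  meet-unique u refl refl = sym (meet-lin u)

  -- The line is parametrised by its intersections with the four lines of direction `Y`.
  ∑-line : ∀ s (f : U → ℕ) → ∑[ u ← vectors ] (⟦ lin L X u ≟F s ⟧ * f u) ≡ ∑[ t ← elements ] f (meet s t)
  ∑-line s = Reindexing.∑-reindex _≟U_ _≟F_ vectors elements vectors-once elements-once
    (λ u → lin L X u ≟F s) (lin L Y) (meet s) (lin-meetˡ s) (lin-meetʳ s)
    (λ u p → sym (meet-unique u p refl))

  ∑-grid : ∀ (f : U → ℕ) → ∑ vectors f ≡ ∑[ s ← elements ] (∑[ t ← elements ] f (meet s t))
  ∑-grid f = trans (Reindexing.∑-fibres _≟U_ _≟F_ vectors elements elements-once (lin L X) f)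
                   (∑-cong elements λ {s} _ → ∑-line s f)

∑-flags : (f : PG → PG → ℕ) →
          ∑[ X ← classes ] (∑[ L ← on X ] f X L) ≡ ∑[ L ← classes ] (∑[ X ← on L ] f X L)
∑-flags f = begin
  ∑[ X ← classes ] (∑[ L ← on X ] f X L)
    ≡⟨ ∑-cong classes (λ {X} _ → on-filter X (f X)) ⟩
  ∑[ X ← classes ] (∑[ L ← classes ] (⟦ dot L X ≟F 0F ⟧ * f X L))
    ≡⟨ ∑-swap classes classes _ ⟩
  ∑[ L ← classes ] (∑[ X ← classes ] (⟦ dot L X ≟F 0F ⟧ * f X L))
    ≡⟨ ∑-cong classes (λ {L} _ → ∑-cong classes λ {X} _ → cong (_* f X L)
         (⟦⟧-⇔ (dot L X ≟F 0F) (dot X L ≟F 0F) (trans (dot-sym X L)) (trans (dot-sym L X)))) ⟩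
  ∑[ L ← classes ] (∑[ X ← classes ] (⟦ dot X L ≟F 0F ⟧ * f X L))
    ≡⟨ ∑-cong classes (λ {L} _ → sym (on-filter L (λ X → f X L))) ⟩
  ∑[ L ← classes ] (∑[ X ← on L ] f X L) ∎
  where open ≡-Reasoning

-- Small functions on 𝔽₄

tuple : ℕ → ℕ → ℕ → ℕ → F → ℕ
tuple a b c d 0F = a
tuple a b c d 1F = b
tuple a b c d 2F = c
tuple a b c d 3F = d

tuple-η : ∀ (g : F → ℕ) s → tuple (g 0F) (g 1F) (g 2F) (g 3F) s ≡ g s
tuple-η g 0F = refl
tuple-η g 1F = refl
tuple-η g 2F = refl
tuple-η g 3F = refl

private
  allTuples? : ∀ m {P : (F → ℕ) → Set} → (∀ g → Dec (P g)) →
               Dec (∀ {a} → a < m → ∀ {b} → b < m → ∀ {c} → c < m → ∀ {d} → d < m → P (tuple a b c d))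
  allTuples? m P? = allUpTo? (λ a → allUpTo? (λ b → allUpTo? (λ c → allUpTo? (λ d → P? (tuple a b c d)) m) m) m) m

-- There are finitely many quadruples of values up to `m`, so evaluation settles the claim. It is
-- stated for a `tuple`, the table of values of `g`, and `tuple-η` carries it back.
byCases : ∀ m {P : (F → ℕ) → Set} (P? : ∀ g → Dec (P g)) {_ : True (allTuples? (suc m) P?)} →
          (g : F → ℕ) → (∀ s → g s ≤ m) → P (tuple (g 0F) (g 1F) (g 2F) (g 3F))
byCases m P? {ok} g g≤m = toWitness ok (s≤s (g≤m 0F)) (s≤s (g≤m 1F)) (s≤s (g≤m 2F)) (s≤s (g≤m 3F))

square-sum : (F → ℕ) → ℕ
square-sum g = ∑[ s ← elements ] (g s * g s)

peak : (F → ℕ) → ℕ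
peak g = g 0F ⊔ (g 1F ⊔ (g 2F ⊔ g 3F))

≤-peak : ∀ g s → g s ≤ peak g
≤-peak g 0F = m≤m⊔n _ _
≤-peak g 1F = ≤-trans (m≤m⊔n _ _) (m≤n⊔m (g 0F) _)
≤-peak g 2F = ≤-trans (≤-trans (m≤m⊔n _ _) (m≤n⊔m (g 1F) _)) (m≤n⊔m (g 0F) _)
≤-peak g 3F = ≤-trans (≤-trans (m≤n⊔m (g 2F) _) (m≤n⊔m (g 1F) _)) (m≤n⊔m (g 0F) _)

peak-attained : ∀ g → ∃ λ s → peak g ≡ g s
peak-attained g = attained 0F (attained 1F (attained 2F (3F , refl)))
  where
  attained : ∀ s {k} → (∃ λ t → k ≡ g t) → ∃ λ t → g s ⊔ k ≡ g t
  attained s {k} (t , refl) with ⊔-sel (g s) k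
  ... | inj₁ eq = s , eq
  ... | inj₂ eq = t , eq

∑≤4peak : ∀ g → ∑ elements g ≤ 4 * peak g
∑≤4peak g = ≤-trans (∑-mono elements λ {s} _ → ≤-peak g s) (≤-reflexive (∑-const elements (peak g)))

-- Describes splittings such as 3,3,0,0 or 2,2,1,0 regardless of the order of the parallel lines.
TwoAndRest : (F → ℕ) → ℕ → ℕ → ℕ → Set
TwoAndRest g a b c = ∃ λ p → ∃ λ q → p ≢ q × g p ≡ a × g q ≡ b × (∀ s → s ≢ p → s ≢ q → g s ≡ c)

module Pattern (g : F → ℕ) where

  private
    transfer : ∀ {s k} → tuple (g 0F) (g 1F) (g 2F) (g 3F) s ≡ k → g s ≡ k
    transfer {s} eq = trans (sym (tuple-η g s)) eq

    transfer₃ : ∀ {a b c} → TwoAndRest (tuple (g 0F) (g 1F) (g 2F) (g 3F)) a b c → TwoAndRest g a b c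
    transfer₃ (p , q , p≢q , eq , eq′ , rest) =
      p , q , p≢q , transfer eq , transfer eq′ , λ s s≢p s≢q → transfer (rest s s≢p s≢q)

  abstract
    sum-6-zero : (∀ s → g s ≤ 2) → ∑ elements g ≡ 6 → ∀ {s₀} → g s₀ ≡ 0 → ∀ s → s ≢ s₀ → g s ≡ 2
    sum-6-zero g≤2 sum {s₀} z s s≢s₀ = transfer
      (byCases 2 (λ g → (∑ elements g ≟ℕ 6) →-dec allF? λ s₀ → (g s₀ ≟ℕ 0) →-dec
        allF? λ s → ¬? (s ≟F s₀) →-dec (g s ≟ℕ 2)) g g≤2 sum s₀ (trans (tuple-η g s₀) z) s s≢s₀)

    -- The maximum belongs to 2,2,2,0.
    sum-6-squares : (∀ s → g s ≤ 2) → ∑ elements g ≡ 6 → square-sum g ≤ 12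
    sum-6-squares = byCases 2 (λ g → (∑ elements g ≟ℕ 6) →-dec (square-sum g ≤? 12)) g

    sum-6-squares-max : (∀ s → g s ≤ 2) → ∑ elements g ≡ 6 → square-sum g ≡ 12 → ∃ λ s → g s ≡ 0
    sum-6-squares-max g≤2 sum eq = map₂ transfer
      (byCases 2 (λ g → (∑ elements g ≟ℕ 6) →-dec ((square-sum g ≟ℕ 12) →-dec anyF? λ s → g s ≟ℕ 0)) g g≤2 sum eq)

    -- Only 2,2,1,1 is possible.
    sum-6-squares-positive : (∀ s → g s ≤ 2) → ∑ elements g ≡ 6 → (∀ s → 1 ≤ g s) → square-sum g ≡ 10
    sum-6-squares-positive g≤2 sum pos = byCases 2 (λ g → (∑ elements g ≟ℕ 6) →-dec
      (allF? (λ s → 1 ≤? g s) →-dec (square-sum g ≟ℕ 10))) g g≤2 sum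
      λ s → subst (1 ≤_) (sym (tuple-η g s)) (pos s)

    sum-6-squares≤18 : (∀ s → g s ≤ 3) → ∑ elements g ≡ 6 → square-sum g ≤ 18
    sum-6-squares≤18 = byCases 3 (λ g → (∑ elements g ≟ℕ 6) →-dec (square-sum g ≤? 18)) g

    sum-6-3300 : (∀ s → g s ≤ 3) → ∑ elements g ≡ 6 → square-sum g ≡ 18 →
                 TwoAndRest g 0 0 3
    sum-6-3300 g≤3 sum eq = transfer₃ (byCases 3 (λ g → (∑ elements g ≟ℕ 6) →-dec ((square-sum g ≟ℕ 18) →-dec
      anyF? λ p → anyF? λ q → ¬? (p ≟F q) ×-dec ((g p ≟ℕ 0) ×-dec ((g q ≟ℕ 0) ×-dec
      allF? λ s → ¬? (s ≟F p) →-dec (¬? (s ≟F q) →-dec (g s ≟ℕ 3)))))) g g≤3 sum eq)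

    sum-7-squares : (∀ s → g s ≤ 2) → ∑ elements g ≡ 7 → square-sum g ≤ 13
    sum-7-squares = byCases 2 (λ g → (∑ elements g ≟ℕ 7) →-dec (square-sum g ≤? 13)) g

    -- The maximum is 19, at 3,3,1,0; the value 21 = 13 + 8 fits the linear bound used in `n≢7`.
    sum-7-squares≤21 : (∀ s → g s ≤ 3) → ∑ elements g ≡ 7 → square-sum g ≤ 21
    sum-7-squares≤21 = byCases 3 (λ g → (∑ elements g ≟ℕ 7) →-dec (square-sum g ≤? 21)) g

    sum-5-squares : (∀ s → g s ≤ 2) → ∑ elements g ≡ 5 → square-sum g ≤ 9
    sum-5-squares = byCases 2 (λ g → (∑ elements g ≟ℕ 5) →-dec (square-sum g ≤? 9)) g

    sum-5-0122 : (∀ s → g s ≤ 2) → ∑ elements g ≡ 5 → square-sum g ≡ 9 →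
                 TwoAndRest g 0 1 2
    sum-5-0122 g≤2 sum eq = transfer₃ (byCases 2 (λ g → (∑ elements g ≟ℕ 5) →-dec ((square-sum g ≟ℕ 9) →-dec
      anyF? λ p → anyF? λ q → ¬? (p ≟F q) ×-dec ((g p ≟ℕ 0) ×-dec ((g q ≟ℕ 1) ×-dec
      allF? λ s → ¬? (s ≟F p) →-dec (¬? (s ≟F q) →-dec (g s ≟ℕ 2)))))) g g≤2 sum eq)

∈-elements : ∀ s → s ∈ elements
∈-elements s = Multiplicity.multiplicity-pos _≟F_ elements (≤-reflexive (sym (elements-once s)))

opaque
  outside₃ : ∀ (p q r : F) → ∃ λ s → s ≢ p × s ≢ q × s ≢ r
  outside₃ = from-yes (allF? λ p → allF? λ q → allF? λ r → anyF? λ s → ¬? (s ≟F p) ×-dec (¬? (s ≟F q) ×-dec ¬? (s ≟F r)))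

opaque
  outside : ∀ (p q : F) → ∃ λ s → s ≢ p × s ≢ q
  outside p q with outside₃ p q q
  ... | s , s≢p , s≢q , _ = s , s≢p , s≢q

opaque
  -- The linear equations give a = 8 - b, c = b, e = 4 - b, and the squares then require b² - 6b + 4
  -- = 0, which has no integer solution.
  no-grid : ∀ {a b c e} → a ≤ 8 → b ≤ 8 → c ≤ 8 → e ≤ 4 → a + b ≡ 8 → c + e ≡ 4 → a + c ≡ 8 → b + e ≡ 4 →
            144 + 4 * (a * a + b * b + (c * c + e * e)) ≢ 400
  no-grid a≤8 b≤8 c≤8 e≤4 = from-yes (allUpTo? (λ a → allUpTo? (λ b → allUpTo? (λ c → allUpTo? (λ e →
    (a + b ≟ℕ 8) →-dec ((c + e ≟ℕ 4) →-dec ((a + c ≟ℕ 8) →-dec ((b + e ≟ℕ 4) →-dec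
    ¬? (144 + 4 * (a * a + b * b + (c * c + e * e)) ≟ℕ 400))))) 5) 9) 9) 9) (s≤s a≤8) (s≤s b≤8) (s≤s c≤8) (s≤s e≤4)

-- Point counts of the neighbour classes

record Distribution : Set where
  field
    n    : PG → ℕ
    w    : PG → PG → F → ℕ
    d    : PG → U → ℕ
    n≤16 : ∀ X → n X ≤ 16
    ∑w   : ∀ X L → ∑ elements (w X L) ≡ n X
    ∑w²  : ∀ X → ∑[ L ← on X ] square-sum (w X L) ≡ n X * n X + 4 * n X

  N : PG → ℕ
  N L = ∑ (on L) n

  D : PG → PG → F → ℕ
  D L Y = fibre _≟U_ _≟F_ vectors (lin L Y) (d L)

  field
    -- Written additively because subtraction on ℕ truncates.
    segment : ∀ {L Y} → Y ∈ on L → ∀ s → D L Y s + (N L + 4 * w Y L s) ≡ 28 + n Y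

module Counts (seg : PG → PG → U → F) (c : PG → U → ℕ) where

  n : PG → ℕ
  n X = ∑ vectors (c X)

  w : PG → PG → F → ℕ
  w X L = fibre _≟U_ _≟F_ vectors (seg X L) (c X)

  N : PG → ℕ
  N L = ∑ (on L) n

  -- The number of arc points on the line at position `u` of the line class `L`: within a neighbour
  -- class `Y` that line consists of the segment `lin L Y u`.
  S : PG → U → ℕ
  S L u = ∑[ Y ← on L ] w Y L (lin L Y u)

module Local
  (seg : PG → PG → U → F)
  (parallel : ∀ X u v → ∑[ L ← on X ] ⟦ seg X L u ≟F seg X L v ⟧ ≡ 1 + 4 * ⟦ u ≟U v ⟧)
  (c : PG → U → ℕ) (c≤1 : ∀ X u → c X u ≤ 1)
  (S≤7 : ∀ L u → Counts.S seg c L u ≤ 7)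
  where
  open Counts seg c public

  n≤16 : ∀ X → n X ≤ 16
  n≤16 X = ≤-trans (∑-mono vectors (λ {u} _ → c≤1 X u)) (≤-reflexive (trans (∑-const vectors 1) (trans (*-identityʳ _) vectors-length)))

  ∑w : ∀ X L → ∑ elements (w X L) ≡ n X
  ∑w X L = sym (Reindexing.∑-fibres _≟U_ _≟F_ vectors elements elements-once (seg X L) (c X))

  -- Two distinct points of a class are joined in one direction, a point to itself in all five. As
  -- `c` takes only the values 0 and 1, it equals its square.
  ∑w² : ∀ X → ∑[ L ← on X ] (∑[ s ← elements ] (w X L s * w X L s)) ≡ n X * n X + 4 * n X
  ∑w² X = trans (∑-parallel² _≟U_ _≟F_ (on X) vectors elements vectors-once elements-once (seg X) 4 (parallel X) (c X))
                (cong (λ k → n X * n X + 4 * k) (∑-cong vectors λ {u} _ → idem (c≤1 X u)))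
    where
    idem : ∀ {k} → k ≤ 1 → k * k ≡ k
    idem z≤n       = refl
    idem (s≤s z≤n) = refl

  d : PG → U → ℕ
  d L u = 7 ∸ S L u

  D : PG → PG → F → ℕ
  D L Y = fibre _≟U_ _≟F_ vectors (lin L Y) (d L)

  module _ {L Y : PG} (i : Y ∈ on L) (s : F) where

    private
      -- Arc points of the class `Y′`, counted along the four lines of `L` that pass through segment
      -- `s` of `Y`.
      T : PG → ℕ
      T Y′ = ∑[ u ← vectors ] (⟦ lin L Y u ≟F s ⟧ * w Y′ L (lin L Y′ u))

      -- In a class other than `Y` the four lines run through each of the four segments once. In `Y`
      -- itself they all contain the segment `s`, and the added `n Y` corrects for this without
      -- subtraction.
      T-value : ∀ {Y′} → Y′ ∈ on L → T Y′ + ⟦ Y′ ≟P Y ⟧ * n Y ≡ n Y′ + ⟦ Y′ ≟P Y ⟧ * (4 * w Y L s)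
      T-value {Y′} j with Y′ ≟P Y
      ... | yes refl = begin
        T Y + 1 * n Y
          ≡⟨ cong₂ _+_ (trans (∑-cong vectors λ {u} _ → ⟦⟧-*-cong (lin L Y u ≟F s) (cong (w Y L)))
               (trans (∑-*ʳ vectors _ (w Y L s)) (cong (_* w Y L s) (line-size i s)))) (*-identityˡ (n Y)) ⟩
        4 * w Y L s + n Y
          ≡⟨ trans (+-comm (4 * w Y L s) (n Y)) (cong (n Y +_) (sym (*-identityˡ (4 * w Y L s)))) ⟩
        n Y + 1 * (4 * w Y L s) ∎
        where open ≡-Reasoning
      ... | no Y′≢Y = cong (_+ 0) (begin
        T Y′
          ≡⟨ ∑-line i j (Y′≢Y ∘ sym) s (λ u → w Y′ L (lin L Y′ u)) ⟩
        ∑[ t ← elements ] w Y′ L (lin L Y′ (meet i j (Y′≢Y ∘ sym) s t))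
          ≡⟨ ∑-cong elements (λ {t} _ → cong (w Y′ L) (lin-meetʳ i j (Y′≢Y ∘ sym) s t)) ⟩
        ∑ elements (w Y′ L)
          ≡⟨ ∑w Y′ L ⟩
        n Y′ ∎)
        where open ≡-Reasoning

      ∑-once : ∀ k → ∑[ Y′ ← on L ] (⟦ Y′ ≟P Y ⟧ * k) ≡ k
      ∑-once k = Multiplicity.∑-pick₁ _≟P_ (on L) (λ _ → k) (on-once i)

      ∑T : ∑ (on L) T + n Y ≡ N L + 4 * w Y L s
      ∑T = begin
        ∑ (on L) T + n Y
          ≡⟨ cong (∑ (on L) T +_) (sym (∑-once (n Y))) ⟩
        ∑ (on L) T + ∑[ Y′ ← on L ] (⟦ Y′ ≟P Y ⟧ * n Y)
          ≡⟨ sym (∑-+ (on L) T _) ⟩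
        ∑[ Y′ ← on L ] (T Y′ + ⟦ Y′ ≟P Y ⟧ * n Y)
          ≡⟨ ∑-cong (on L) T-value ⟩
        ∑[ Y′ ← on L ] (n Y′ + ⟦ Y′ ≟P Y ⟧ * (4 * w Y L s))
          ≡⟨ ∑-+ (on L) n _ ⟩
        N L + ∑[ Y′ ← on L ] (⟦ Y′ ≟P Y ⟧ * (4 * w Y L s))
          ≡⟨ cong (N L +_) (∑-once (4 * w Y L s)) ⟩
        N L + 4 * w Y L s ∎
        where open ≡-Reasoning

      -- Arc points and deficiency make up 7 on each of the four lines.
      D+∑T : D L Y s + ∑ (on L) T ≡ 28
      D+∑T = begin
        D L Y s + ∑ (on L) T
          ≡⟨ cong (D L Y s +_) (trans (∑-swap (on L) vectors _) (∑-cong vectors λ {u} _ → ∑-*ˡ (on L) ⟦ lin L Y u ≟F s ⟧ _)) ⟩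
        D L Y s + ∑[ u ← vectors ] (⟦ lin L Y u ≟F s ⟧ * S L u)
          ≡⟨ sym (∑-+ vectors _ _) ⟩
        ∑[ u ← vectors ] (⟦ lin L Y u ≟F s ⟧ * d L u + ⟦ lin L Y u ≟F s ⟧ * S L u)
          ≡⟨ ∑-cong vectors (λ {u} _ → trans (sym (*-distribˡ-+ ⟦ lin L Y u ≟F s ⟧ (d L u) (S L u)))
               (cong (⟦ lin L Y u ≟F s ⟧ *_) (m∸n+n≡m (S≤7 L u)))) ⟩
        ∑[ u ← vectors ] (⟦ lin L Y u ≟F s ⟧ * 7)
          ≡⟨ trans (∑-*ʳ vectors _ 7) (cong (_* 7) (line-size i s)) ⟩
        28 ∎
        where open ≡-Reasoning

    segment : D L Y s + (N L + 4 * w Y L s) ≡ 28 + n Y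
    segment = begin
      D L Y s + (N L + 4 * w Y L s)   ≡⟨ cong (D L Y s +_) (sym ∑T) ⟩
      D L Y s + (∑ (on L) T + n Y)    ≡⟨ sym (+-assoc (D L Y s) _ _) ⟩
      D L Y s + ∑ (on L) T + n Y      ≡⟨ cong (_+ n Y) D+∑T ⟩
      28 + n Y                        ∎
      where open ≡-Reasoning

  distribution : Distribution
  distribution = record
    { n = n ; w = w ; d = d ; n≤16 = n≤16 ; ∑w = ∑w ; ∑w² = ∑w² ; segment = segment }

-- Class sizes and their splittings when there are at least 102 points

module Overfull (Δ : Distribution) (total : 102 ≤ ∑ classes (Distribution.n Δ)) where
  open Distribution Δ

  -- The five lines through `X` cover `X` five times and every other class once.
  ∑N : ∀ X → ∑ (on X) N ≡ ∑ classes n + 4 * n X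
  ∑N X = begin
    ∑[ L ← on X ] (∑[ Y ← on L ] n Y)
      ≡⟨ ∑-cong (on X) (λ {L} _ → trans (Reindexing.∑-fibres _≟P_ _≟P_ (on L) classes classes-once (λ Y → Y) n)
           (∑-cong classes λ {Y} _ → Multiplicity.∑-pick _≟P_ (on L) Y n)) ⟩
    ∑[ L ← on X ] (∑[ Y ← classes ] (multiplicityP (on L) Y * n Y))
      ≡⟨ ∑-swap (on X) classes _ ⟩
    ∑[ Y ← classes ] (∑[ L ← on X ] (multiplicityP (on L) Y * n Y))
      ≡⟨ ∑-cong classes (λ {Y} _ → trans (∑-*ʳ (on X) _ (n Y)) (trans (cong (_* n Y) (joining X Y))
           (cong (n Y +_) (trans (*-assoc 4 ⟦ X ≟P Y ⟧ (n Y)) (cong (λ k → 4 * (k * n Y)) (⟦⟧-⇔ (X ≟P Y) (Y ≟P X) sym sym)))))) ⟩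
    ∑[ Y ← classes ] (n Y + 4 * (⟦ Y ≟P X ⟧ * n Y))
      ≡⟨ trans (∑-+ classes n _) (cong (∑ classes n +_) (trans (∑-*ˡ classes 4 _)
           (cong (4 *_) (Multiplicity.∑-pick₁ _≟P_ classes n (classes-once X))))) ⟩
    ∑ classes n + 4 * n X ∎
    where open ≡-Reasoning

  opaque
    segment-≤ : ∀ {L Y} → Y ∈ on L → ∀ s → N L + 4 * w Y L s ≤ 28 + n Y
    segment-≤ {L} {Y} i s = ≤-trans (m≤n+m _ (D L Y s)) (≤-reflexive (segment i s))

  opaque
    ∑N-≥ : ∀ X → 102 + 4 * n X ≤ ∑ (on X) N
    ∑N-≥ X = ≤-trans (+-monoˡ-≤ (4 * n X) total) (≤-reflexive (sym (∑N X)))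

  Q : PG → PG → ℕ
  Q X L = square-sum (w X L)

  ∑-on-const : ∀ X k → ∑[ _ ← on X ] k ≡ 5 * k
  ∑-on-const X k = trans (∑-const (on X) k) (cong (_* k) (on-length X))

  -- Weighting the inequalities segment-≤ of one class by w and summing them up.
  opaque
    n≤7 : ∀ X → n X ≤ 7
    n≤7 X = check (s≤s (n≤16 X)) (begin
      (102 + 4 * n X) * n X + 4 * (n X * n X + 4 * n X)
        ≤⟨ +-monoˡ-≤ _ (*-monoˡ-≤ (n X) (∑N-≥ X)) ⟩
      ∑ (on X) N * n X + 4 * (n X * n X + 4 * n X)
        ≡⟨ cong₂ _+_ (sym (∑-*ʳ (on X) N (n X))) (trans (cong (4 *_) (sym (∑w² X))) (sym (∑-*ˡ (on X) 4 (Q X)))) ⟩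
      ∑[ L ← on X ] (N L * n X) + ∑[ L ← on X ] (4 * Q X L)
        ≡⟨ sym (∑-+ (on X) _ _) ⟩
      ∑[ L ← on X ] (N L * n X + 4 * Q X L)
        ≤⟨ ∑-mono (on X) (λ j → weighted (on-sym j)) ⟩
      ∑[ L ← on X ] ((28 + n X) * n X)
        ≡⟨ ∑-on-const X _ ⟩
      5 * ((28 + n X) * n X) ∎)
      where
      open ≤-Reasoning
      -- After division by a positive k this reads 3k ≤ 22.
      check : ∀ {k} → k < 17 → (102 + 4 * k) * k + 4 * (k * k + 4 * k) ≤ 5 * ((28 + k) * k) → k ≤ 7
      check = from-yes (allUpTo? (λ k → ((102 + 4 * k) * k + 4 * (k * k + 4 * k) ≤? 5 * ((28 + k) * k)) →-dec (k ≤? 7)) 17)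
      weighted : ∀ {L} → X ∈ on L → N L * n X + 4 * Q X L ≤ (28 + n X) * n X
      weighted {L} i = begin
        N L * n X + 4 * Q X L
          ≡⟨ cong₂ _+_ (trans (cong (N L *_) (sym (∑w X L))) (sym (∑-*ˡ elements (N L) (w X L)))) (sym (∑-*ˡ elements 4 (λ s → w X L s * w X L s))) ⟩
        ∑[ s ← elements ] (N L * w X L s) + ∑[ s ← elements ] (4 * (w X L s * w X L s))
          ≡⟨ sym (∑-+ elements (λ s → N L * w X L s) (λ s → 4 * (w X L s * w X L s))) ⟩
        ∑[ s ← elements ] (N L * w X L s + 4 * (w X L s * w X L s))
          ≤⟨ ∑-mono elements (λ {s} _ → ≤-trans (≤-reflexive (distrib (N L) (w X L s))) (*-monoˡ-≤ (w X L s) (segment-≤ i s))) ⟩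
        ∑[ s ← elements ] ((28 + n X) * w X L s)
          ≡⟨ trans (∑-*ˡ elements (28 + n X) (w X L)) (cong ((28 + n X) *_) (∑w X L)) ⟩
        (28 + n X) * n X ∎
        where
        distrib : ∀ a b → a * b + 4 * (b * b) ≡ (a + 4 * b) * b
        distrib = solve-∀

  -- Measured from 2, since four parts with at least five points in total have a part of size at
  -- least 2.
  excess : PG → PG → ℕ
  excess X L = peak (w X L) ∸ 2

  module _ {X : PG} (5≤n : 5 ≤ n X) where

    opaque
      peak-excess : ∀ L → peak (w X L) ≡ 2 + excess X L
      peak-excess L = sym (m+[n∸m]≡n (≰⇒> λ peak≤1 → contradiction
        (≤-trans 5≤n (≤-trans (≤-reflexive (sym (∑w X L))) (≤-trans (∑≤4peak (w X L)) (*-monoʳ-≤ 4 peak≤1))))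
        λ { (s≤s (s≤s (s≤s (s≤s ())))) }))

    opaque
      w≤2+excess : ∀ L s → w X L s ≤ 2 + excess X L
      w≤2+excess L s = ≤-trans (≤-peak (w X L) s) (≤-reflexive (peak-excess L))

    opaque
      N-excess : ∀ {L} → L ∈ on X → N L + (8 + 4 * excess X L) ≤ 28 + n X
      N-excess {L} j with peak-attained (w X L)
      ... | s , eq = ≤-trans (≤-reflexive (cong (N L +_) (trans (sym (*-distribˡ-+ 4 2 (excess X L)))
                       (cong (4 *_) (trans (sym (peak-excess L)) eq))))) (segment-≤ (on-sym j) s)

    opaque
      ∑-N-excess : ∑[ L ← on X ] (N L + (8 + 4 * excess X L)) ≡ ∑ (on X) N + (40 + 4 * ∑ (on X) (excess X))
      ∑-N-excess = trans (∑-+ (on X) N _) (cong (∑ (on X) N +_)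
        (trans (∑-+ (on X) _ _) (cong₂ _+_ (∑-on-const X 8) (∑-*ˡ (on X) 4 (excess X)))))

    opaque
      -- `N-excess` over all five lines meets the lower bound `∑N-≥`, and only n - 2 is left to be
      -- shared by the excesses.
      ∑-excess : 2 + 4 * ∑ (on X) (excess X) ≤ n X
      ∑-excess = +-cancelˡ-≤ (140 + 4 * n X) _ _ (begin
        (140 + 4 * n X) + (2 + 4 * E)   ≡⟨ left (n X) E ⟩
        (102 + 4 * n X) + (40 + 4 * E)  ≤⟨ +-monoˡ-≤ _ (∑N-≥ X) ⟩
        ∑ (on X) N + (40 + 4 * E)       ≡⟨ sym ∑-N-excess ⟩
        ∑[ L ← on X ] (N L + (8 + 4 * excess X L))  ≤⟨ ∑-mono (on X) N-excess ⟩
        ∑[ L ← on X ] (28 + n X)        ≡⟨ ∑-on-const X (28 + n X) ⟩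
        5 * (28 + n X)                  ≡⟨ right (n X) ⟩
        (140 + 4 * n X) + n X           ∎)
        where
        open ≤-Reasoning
        E : ℕ
        E = ∑ (on X) (excess X)
        left : ∀ n E → (140 + 4 * n) + (2 + 4 * E) ≡ (102 + 4 * n) + (40 + 4 * E)
        left = solve-∀
        right : ∀ n → 5 * (28 + n) ≡ (140 + 4 * n) + n
        right = solve-∀

  opaque
    -- The total excess is at most 1, so the squares add up to at most 5 · 13 + 8 = 73, while `∑w²`
    -- demands 49 + 28 = 77.
    n≢7 : ∀ X → n X ≢ 7
    n≢7 X n≡7 = contradiction (begin
      77                                          ≡⟨ cong (λ k → k * k + 4 * k) {7} (sym n≡7) ⟩
      n X * n X + 4 * n X                         ≡⟨ sym (∑w² X) ⟩
      ∑ (on X) (Q X)                              ≤⟨ ∑-mono (on X) (λ {L} j → bound L (≤-trans (∑-term (on X) (excess X) j) E≤1)) ⟩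
      ∑[ L ← on X ] (13 + 8 * excess X L)         ≡⟨ trans (∑-+ (on X) _ _) (cong₂ _+_ (∑-on-const X 13) (∑-*ˡ (on X) 8 (excess X))) ⟩
      65 + 8 * ∑ (on X) (excess X)                ≤⟨ +-monoʳ-≤ 65 (*-monoʳ-≤ 8 E≤1) ⟩
      73                                          ∎) (from-no (77 ≤? 73))
      where
      open ≤-Reasoning
      5≤n : 5 ≤ n X
      5≤n = ≤-trans (from-yes (5 ≤? 7)) (≤-reflexive (sym n≡7))
      E≤1 : ∑ (on X) (excess X) ≤ 1
      E≤1 = ≮⇒≥ λ 2≤E → contradiction
        (≤-trans (+-monoʳ-≤ 2 (*-monoʳ-≤ 4 2≤E)) (≤-trans (∑-excess 5≤n) (≤-reflexive n≡7))) (from-no (10 ≤? 7))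
      bound : ∀ L → excess X L ≤ 1 → Q X L ≤ 13 + 8 * excess X L
      bound L e≤1 with excess X L | w≤2+excess 5≤n L | e≤1
      ... | 0 | w≤ | _       = Pattern.sum-7-squares (w X L) w≤ (trans (∑w X L) n≡7)
      ... | 1 | w≤ | _       = Pattern.sum-7-squares≤21 (w X L) w≤ (trans (∑w X L) n≡7)
      ... | suc (suc _) | _ | s≤s ()

  opaque
    n≤6 : ∀ X → n X ≤ 6
    n≤6 X = ≤-pred (≤∧≢⇒< (n≤7 X) (n≢7 X))

  Light : PG → Set
  Light X = ∀ {L} → L ∈ on X → ∀ s → w X L s ≤ 2

  opaque
    light : ∀ {X} → 5 ≤ n X → ∑ (on X) (excess X) ≡ 0 → Light X
    light {X} 5≤n E≡0 {L} j s = ≤-trans (w≤2+excess 5≤n L s)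
      (+-monoʳ-≤ 2 (≤-trans (∑-term (on X) (excess X) j) (≤-reflexive E≡0)))

  module Five {X : PG} (n≡5 : n X ≡ 5) where

    opaque
      5≤n : 5 ≤ n X
      5≤n = ≤-reflexive (sym n≡5)

    opaque
      five-light : Light X
      five-light = light 5≤n (n≤0⇒n≡0 (≮⇒≥ λ 1≤E → contradiction
        (≤-trans (+-monoʳ-≤ 2 (*-monoʳ-≤ 4 1≤E)) (≤-trans (∑-excess 5≤n) (≤-reflexive n≡5))) (from-no (6 ≤? 5))))

    opaque
      -- The required sum 25 + 20 = 45 is five times the maximum 9, leaving no slack in any
      -- direction.
      five-squares : ∀ {L} → L ∈ on X → Q X L ≡ 9
      five-squares = ∑-tight (on X) (λ {L} j → Pattern.sum-5-squares (w X L) (five-light j) (trans (∑w X L) n≡5))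
        (≤-reflexive (trans (∑-on-const X 9) (sym (trans (∑w² X) (cong (λ k → k * k + 4 * k) {n X} n≡5)))))

    opaque
      five-pattern : ∀ {L} → L ∈ on X → TwoAndRest (w X L) 0 1 2
      five-pattern {L} j = Pattern.sum-5-0122 (w X L) (five-light j) (trans (∑w X L) n≡5) (five-squares j)

    opaque
      five-N : ∀ {L} → L ∈ on X → N L ≤ 25
      five-N {L} j = +-cancelʳ-≤ 8 (N L) 25 (≤-trans (+-monoʳ-≤ (N L) (m≤m+n 8 _))
        (≤-trans (N-excess 5≤n j) (≤-reflexive (cong (28 +_) n≡5))))

  module Six {X : PG} (n≡6 : n X ≡ 6) where

    opaque
      5≤n : 5 ≤ n X
      5≤n = ≤-trans (from-yes (5 ≤? 6)) (≤-reflexive (sym n≡6))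

    opaque
      sum : ∀ L → ∑ elements (w X L) ≡ 6
      sum L = trans (∑w X L) n≡6

    Heavy : Set
    Heavy = ∑ (on X) (excess X) ≡ 1

    opaque
      light-or-heavy : Light X ⊎ Heavy
      light-or-heavy = cases (∑ (on X) (excess X)) refl
        where
        cases : ∀ E → ∑ (on X) (excess X) ≡ E → Light X ⊎ Heavy
        cases 0 eq = inj₁ (light 5≤n eq)
        cases 1 eq = inj₂ eq
        cases (suc (suc E)) eq = contradiction
          (≤-trans (+-monoʳ-≤ 2 (*-monoʳ-≤ 4 (≤-trans (s≤s (s≤s (z≤n {E}))) (≤-reflexive (sym eq)))))
                   (≤-trans (∑-excess 5≤n) (≤-reflexive n≡6))) (from-no (10 ≤? 6))

    opaque
      -- The required sum 36 + 24 = 60 is five times the maximum 12, which forces 2,2,2,0 in every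
      -- direction.
      light-zero : Light X → ∀ {L} → L ∈ on X → ∃ λ s → w X L s ≡ 0
      light-zero lt {L} j = Pattern.sum-6-squares-max (w X L) (lt j) (sum L)
        (∑-tight (on X) (λ {L} j → Pattern.sum-6-squares (w X L) (lt j) (sum L))
          (≤-reflexive (trans (∑-on-const X 12) (sym (trans (∑w² X) (cong (λ k → k * k + 4 * k) {n X} n≡6))))) j)

    opaque
      six-N : ∀ {L} → L ∈ on X → N L ≤ 26
      six-N {L} j = +-cancelʳ-≤ 8 (N L) 26 (≤-trans (+-monoʳ-≤ (N L) (m≤m+n 8 _))
        (≤-trans (N-excess 5≤n j) (≤-reflexive (cong (28 +_) n≡6))))

    module _ (heavy : Heavy) where

      opaque
        -- For n = 6 and total excess 1 the estimate `∑-excess` is sharp, so `N-excess` is an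
        -- equality on each line.
        heavy-N : ∀ {L} → L ∈ on X → N L + 4 * excess X L ≡ 26
        heavy-N {L} j = +-cancelʳ-≡ 8 _ _ (trans (trans (+-assoc (N L) _ 8) (cong (N L +_) (+-comm _ 8)))
          (trans (∑-tight (on X) (N-excess 5≤n) (begin
            ∑[ L ← on X ] (28 + n X)                    ≡⟨ trans (∑-on-const X (28 + n X)) (cong (λ k → 5 * (28 + k)) n≡6) ⟩
            102 + 4 * 6 + (40 + 4 * 1)                  ≡⟨ cong₂ (λ k E → 102 + 4 * k + (40 + 4 * E)) {6} {n X} {1} (sym n≡6) (sym heavy) ⟩
            102 + 4 * n X + (40 + 4 * ∑ (on X) (excess X)) ≤⟨ +-monoˡ-≤ _ (∑N-≥ X) ⟩
            ∑ (on X) N + (40 + 4 * ∑ (on X) (excess X)) ≡⟨ sym (∑-N-excess 5≤n) ⟩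
            ∑[ L ← on X ] (N L + (8 + 4 * excess X L))  ∎) j) (cong (28 +_) n≡6)))
          where open ≤-Reasoning

      opaque
        excess≤1 : ∀ {L} → L ∈ on X → excess X L ≤ 1
        excess≤1 j = ≤-trans (∑-term (on X) (excess X) j) (≤-reflexive heavy)

      opaque
        heavy-squares : ∀ {L} → L ∈ on X → excess X L ≡ 1 → Q X L ≤ 18
        heavy-squares {L} j e≡1 = Pattern.sum-6-squares≤18 (w X L)
          (λ s → ≤-trans (w≤2+excess 5≤n L s) (+-monoʳ-≤ 2 (≤-reflexive e≡1))) (sum L)

  -- Deficiency weights on a line class

  opaque
    D-value : ∀ {Y L s a b m k} → Y ∈ on L → N L ≡ a → w Y L s ≡ b → n Y ≡ m → k + (a + 4 * b) ≡ 28 + m → D L Y s ≡ k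
    D-value {Y} {L} {s} {a} {b} {m} {k} i refl refl refl eq = +-cancelʳ-≡ (a + 4 * b) (D L Y s) k (trans (segment i s) (sym eq))

  opaque
    D-upper : ∀ {Y L s a m k} → Y ∈ on L → N L ≡ a → n Y ≡ m → 28 + m ≡ k + a → D L Y s ≤ k
    D-upper {Y} {L} {s} {a} {m} {k} i refl refl eq = +-cancelʳ-≤ a (D L Y s) k
      (≤-trans (+-monoʳ-≤ (D L Y s) (m≤m+n a _)) (≤-reflexive (trans (segment i s) eq)))

  opaque
    d≤D : ∀ L Y {s} u → lin L Y u ≡ s → d L u ≤ D L Y s
    d≤D L Y u refl = ≤-trans (≤-reflexive (sym (trans (cong (_* d L u) (⟦⟧-yes (lin L Y u ≟F lin L Y u) refl)) (*-identityˡ _))))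
      (∑-term vectors (λ v → ⟦ lin L Y v ≟F lin L Y u ⟧ * d L v)
        (Multiplicity.multiplicity-pos _≟U_ vectors (≤-reflexive (sym (vectors-once u)))))

  opaque
    d-zero : ∀ {L Y s} → D L Y s ≡ 0 → ∀ u → lin L Y u ≡ s → d L u ≡ 0
    d-zero {L} {Y} eq u p = n≤0⇒n≡0 (≤-trans (d≤D L Y u p) (≤-reflexive eq))

  opaque
    another : ∀ {Y L} → Y ∈ on L → ∃ λ Z → Z ∈ on L × Z ≢ Y
    another {Y} {L} i with search (λ Z → ¬? (Z ≟P Y)) (on L)
    ... | inj₁ found = found
    ... | inj₂ none  = contradiction
      (trans (sym (on-once i)) (trans (∑-cong (on L) λ {Z} j → ⟦⟧-yes (Z ≟P Y) (decidable-stable (Z ≟P Y) (none j))) (∑-on-const L 1)))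
      λ ()

  -- In each of two directions all weight lies on two parallel lines, so `d` lives on their four
  -- intersection points.
  module Grid {L Y₁ Y₂ : PG} (i₁ : Y₁ ∈ on L) (i₂ : Y₂ ∈ on L) (Y₁≢Y₂ : Y₁ ≢ Y₂)
    {p₁ q₁ p₂ q₂ : F} (p₁≢q₁ : p₁ ≢ q₁) (p₂≢q₂ : p₂ ≢ q₂)
    (D₁-zero : ∀ s → s ≢ p₁ → s ≢ q₁ → D L Y₁ s ≡ 0)
    (D₂-zero : ∀ s → s ≢ p₂ → s ≢ q₂ → D L Y₂ s ≡ 0)
    where

    g : F → F → U
    g = meet i₁ i₂ Y₁≢Y₂

    lin₁ : ∀ s t → lin L Y₁ (g s t) ≡ s
    lin₁ = lin-meetˡ i₁ i₂ Y₁≢Y₂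

    lin₂ : ∀ s t → lin L Y₂ (g s t) ≡ t
    lin₂ = lin-meetʳ i₁ i₂ Y₁≢Y₂

    private
      ∑-support : ∀ {p q} (f : F → ℕ) → p ≢ q → (∀ s → s ≢ p → s ≢ q → f s ≡ 0) → ∑ elements f ≡ f p + f q
      ∑-support {p} {q} f = Multiplicity.∑-support₂ _≟F_ elements f (elements-once p) (elements-once q)

    opaque
      ∑-corners : (f : U → ℕ) → (∀ u → d L u ≡ 0 → f u ≡ 0) →
                  ∑ vectors f ≡ f (g p₁ p₂) + f (g p₁ q₂) + (f (g q₁ p₂) + f (g q₁ q₂))
      ∑-corners f vanish = trans (∑-grid i₁ i₂ Y₁≢Y₂ f) (trans
        (∑-support (λ s → ∑[ t ← elements ] f (g s t)) p₁≢q₁ λ s s≢p s≢q →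
          trans (∑-cong elements λ {t} _ → vanish (g s t) (d-zero (D₁-zero s s≢p s≢q) (g s t) (lin₁ s t))) (∑-zero elements))
        (cong₂ _+_ (row p₁) (row q₁)))
        where
        row : ∀ s → ∑[ t ← elements ] f (g s t) ≡ f (g s p₂) + f (g s q₂)
        row s = ∑-support (λ t → f (g s t)) p₂≢q₂ λ t t≢p t≢q →
          vanish (g s t) (d-zero (D₂-zero t t≢p t≢q) (g s t) (lin₂ s t))

    A B C E : ℕ
    A = d L (g p₁ p₂)
    B = d L (g p₁ q₂)
    C = d L (g q₁ p₂)
    E = d L (g q₁ q₂)

    opaque
      D-corners : ∀ Y s → D L Y s ≡ ⟦ lin L Y (g p₁ p₂) ≟F s ⟧ * A + ⟦ lin L Y (g p₁ q₂) ≟F s ⟧ * B +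
                                    (⟦ lin L Y (g q₁ p₂) ≟F s ⟧ * C + ⟦ lin L Y (g q₁ q₂) ≟F s ⟧ * E)
      D-corners Y s = ∑-corners (λ u → ⟦ lin L Y u ≟F s ⟧ * d L u)
        λ u z → trans (cong (⟦ lin L Y u ≟F s ⟧ *_) z) (*-zeroʳ ⟦ lin L Y u ≟F s ⟧)

    private
      combine : ∀ {i j k l i′ j′ k′ l′ : ℕ} → i ≡ i′ → j ≡ j′ → k ≡ k′ → l ≡ l′ →
                i * A + j * B + (k * C + l * E) ≡ i′ * A + j′ * B + (k′ * C + l′ * E)
      combine refl refl refl refl = refl

    opaque
      row-p : D L Y₁ p₁ ≡ A + B
      row-p = trans (D-corners Y₁ p₁) (trans (combine {i′ = 1} {1} {0} {0}
        (⟦⟧-yes (_ ≟F _) (lin₁ p₁ p₂)) (⟦⟧-yes (_ ≟F _) (lin₁ p₁ q₂))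
        (⟦⟧-no (_ ≟F _) λ eq → p₁≢q₁ (trans (sym eq) (lin₁ q₁ p₂))) (⟦⟧-no (_ ≟F _) λ eq → p₁≢q₁ (trans (sym eq) (lin₁ q₁ q₂))))
        (simplify A B))
        where
        simplify : ∀ a b → 1 * a + 1 * b + 0 ≡ a + b
        simplify = solve-∀
    opaque
      row-q : D L Y₁ q₁ ≡ C + E
      row-q = trans (D-corners Y₁ q₁) (trans (combine {i′ = 0} {0} {1} {1}
        (⟦⟧-no (_ ≟F _) λ eq → p₁≢q₁ (trans (sym (lin₁ p₁ p₂)) eq)) (⟦⟧-no (_ ≟F _) λ eq → p₁≢q₁ (trans (sym (lin₁ p₁ q₂)) eq))
        (⟦⟧-yes (_ ≟F _) (lin₁ q₁ p₂)) (⟦⟧-yes (_ ≟F _) (lin₁ q₁ q₂)))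
        (simplify C E))
        where
        simplify : ∀ a b → 1 * a + 1 * b ≡ a + b
        simplify = solve-∀
    opaque
      column-p : D L Y₂ p₂ ≡ A + C
      column-p = trans (D-corners Y₂ p₂) (trans (combine {i′ = 1} {0} {1} {0}
        (⟦⟧-yes (_ ≟F _) (lin₂ p₁ p₂)) (⟦⟧-no (_ ≟F _) λ eq → p₂≢q₂ (trans (sym eq) (lin₂ p₁ q₂)))
        (⟦⟧-yes (_ ≟F _) (lin₂ q₁ p₂)) (⟦⟧-no (_ ≟F _) λ eq → p₂≢q₂ (trans (sym eq) (lin₂ q₁ q₂))))
        (simplify A C))
        where
        simplify : ∀ a b → 1 * a + 0 + (1 * b + 0) ≡ a + b
        simplify = solve-∀
    opaque
      column-q : D L Y₂ q₂ ≡ B + E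
      column-q = trans (D-corners Y₂ q₂) (trans (combine {i′ = 0} {1} {0} {1}
        (⟦⟧-no (_ ≟F _) λ eq → p₂≢q₂ (trans (sym (lin₂ p₁ p₂)) eq)) (⟦⟧-yes (_ ≟F _) (lin₂ p₁ q₂))
        (⟦⟧-no (_ ≟F _) λ eq → p₂≢q₂ (trans (sym (lin₂ q₁ p₂)) eq)) (⟦⟧-yes (_ ≟F _) (lin₂ q₁ q₂)))
        (simplify B E))
        where
        simplify : ∀ a b → 1 * a + (1 * b) ≡ a + b
        simplify = solve-∀

    opaque
      -- The corner at `p₁`, `p₂` is already joined to its two neighbours in the directions `Y₁` and
      -- `Y₂`, so a third direction can join it only to the opposite corner.
      third : ∀ {Y} → Y ∈ on L → Y ≢ Y₁ → Y ≢ Y₂ →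
              D L Y (lin L Y (g p₁ p₂)) ≡ A + ⟦ lin L Y (g q₁ q₂) ≟F lin L Y (g p₁ p₂) ⟧ * E
      third {Y} i Y≢Y₁ Y≢Y₂ = trans (D-corners Y _) (trans (combine {i′ = 1} {0} {0} {⟦ lin L Y (g q₁ q₂) ≟F lin L Y (g p₁ p₂) ⟧}
        (⟦⟧-yes (lin L Y (g p₁ p₂) ≟F lin L Y (g p₁ p₂)) refl)
        (⟦⟧-no (_ ≟F _) λ eq → p₂≢q₂ (trans (sym (lin₂ p₁ p₂)) (trans (cong (lin L Y₂)
          (injective i₁ Y≢Y₁ (trans (lin₁ p₁ p₂) (sym (lin₁ p₁ q₂))) (sym eq))) (lin₂ p₁ q₂))))
        (⟦⟧-no (_ ≟F _) λ eq → p₁≢q₁ (trans (sym (lin₁ p₁ p₂)) (trans (cong (lin L Y₁)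
          (injective i₂ Y≢Y₂ (trans (lin₂ p₁ p₂) (sym (lin₂ q₁ p₂))) (sym eq))) (lin₁ q₁ p₂))))
        refl) (simplify A _))
        where
        injective : ∀ {Z} → Z ∈ on L → Y ≢ Z → ∀ {u v} → lin L Z u ≡ lin L Z v → lin L Y u ≡ lin L Y v → u ≡ v
        injective j Y≢Z {u} {v} eq eq′ = trans (meet-unique i j Y≢Z u eq′ eq) (meet-lin i j Y≢Z v)
        simplify : ∀ a b → 1 * a + 0 + b ≡ a + b
        simplify = solve-∀

  -- Line classes with 25 points

  module Line25 {L : PG} (N≡25 : N L ≡ 25) where

    opaque
      -- A heavy class satisfies N + 4e = 26, which excludes 25. Hence the splitting is 2,2,2,0, and
      -- D is 9 - 4w.
      six-pattern : ∀ {Y} → Y ∈ on L → n Y ≡ 6 → ∃ λ s₀ → D L Y s₀ ≡ 9 × (∀ s → s ≢ s₀ → D L Y s ≡ 1)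
      six-pattern {Y} i n≡6 with Six.light-or-heavy n≡6
      ... | inj₂ heavy = contradiction (trans (cong (_+ 4 * excess Y L) (sym N≡25)) (Six.heavy-N n≡6 heavy (on-sym i)))
                           (25+4e≢26 (excess Y L))
        where
        25+4e≢26 : ∀ e → 25 + 4 * e ≢ 26
        25+4e≢26 zero    ()
        25+4e≢26 (suc e) eq = contradiction (trans (sym (+-suc e _)) (suc-injective (+-cancelˡ-≡ 25 _ _ eq))) λ ()
      ... | inj₁ lt with Six.light-zero n≡6 lt (on-sym i)
      ...   | s₀ , z = s₀ , D-value i N≡25 z n≡6 refl , λ s s≢s₀ →
              D-value i N≡25 (Pattern.sum-6-zero (w Y L) (lt (on-sym i)) (Six.sum n≡6 L) z s s≢s₀) n≡6 refl

    opaque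
      five-pattern : ∀ {Y} → Y ∈ on L → n Y ≡ 5 → TwoAndRest (D L Y) 8 4 0
      five-pattern i n≡5 with Five.five-pattern n≡5 (on-sym i)
      ... | p , q , p≢q , z , o , rest = p , q , p≢q , D-value i N≡25 z n≡5 refl , D-value i N≡25 o n≡5 refl ,
        λ s s≢p s≢q → D-value i N≡25 (rest s s≢p s≢q) n≡5 refl

    opaque
      -- Nonnegativity of 7 - 4w gives w ≤ 1, so all four parts are 1.
      four-pattern : ∀ {Y} → Y ∈ on L → n Y ≡ 4 → ∀ s → D L Y s ≡ 3
      four-pattern {Y} i n≡4 s = D-value i N≡25 (∑-tight elements (λ {s} _ → w≤1 s) (≤-reflexive (sym (trans (∑w Y L) n≡4))) (∈-elements s)) n≡4 refl
        where
        w≤1 : ∀ s → w Y L s ≤ 1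
        w≤1 s = ≮⇒≥ λ 2≤w → contradiction (≤-trans (+-monoʳ-≤ 25 (*-monoʳ-≤ 4 2≤w))
          (subst₂ (λ a m → a + 4 * w Y L s ≤ 28 + m) N≡25 n≡4 (segment-≤ i s))) (from-no (33 ≤? 32))

    -- Three points of the weight-9 line for `Y₁` lie on weight-1 lines for `Y₂`, so the fourth has
    -- weight at least 6. A class of size 3 makes this exactly 6 and the others 1, whereas a class
    -- of size 5 puts a point of weight 0 on the line.
    module TwoSixes {Y₁ Y₂} (i₁ : Y₁ ∈ on L) (i₂ : Y₂ ∈ on L) (Y₁≢Y₂ : Y₁ ≢ Y₂) (six₁ : n Y₁ ≡ 6) (six₂ : n Y₂ ≡ 6)
      {s₁ s₂ : F} (D₁≡9 : D L Y₁ s₁ ≡ 9) (D₂≡1 : ∀ s → s ≢ s₂ → D L Y₂ s ≡ 1) where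

      f : F → ℕ
      f t = d L (meet i₁ i₂ Y₁≢Y₂ s₁ t)

      f≤1 : ∀ t → t ≢ s₂ → f t ≤ 1
      f≤1 t t≢s₂ = ≤-trans (d≤D L Y₂ _ (lin-meetʳ i₁ i₂ Y₁≢Y₂ s₁ t)) (≤-reflexive (D₂≡1 t t≢s₂))

      ∑f : ∑ elements f ≡ 9
      ∑f = trans (sym (∑-line i₁ i₂ Y₁≢Y₂ s₁ (d L))) D₁≡9

      -- One inequality uniform in `t`: its sum yields `6≤f`, and its equality case yields `f≡1`.
      bound : ∀ t → f t + ⟦ t ≟F s₂ ⟧ ≤ 1 + ⟦ t ≟F s₂ ⟧ * f s₂
      bound t with t ≟F s₂
      ... | yes refl = ≤-reflexive (trans (+-comm (f t) 1) (cong suc (sym (*-identityˡ (f t)))))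
      ... | no t≢s₂  = ≤-trans (≤-reflexive (+-identityʳ (f t))) (f≤1 t t≢s₂)

      ∑-left : ∑[ t ← elements ] (f t + ⟦ t ≟F s₂ ⟧) ≡ 10
      ∑-left = trans (∑-+ elements f (λ t → ⟦ t ≟F s₂ ⟧)) (cong₂ _+_ ∑f (elements-once s₂))

      ∑-right : ∑[ t ← elements ] (1 + ⟦ t ≟F s₂ ⟧ * f s₂) ≡ 4 + f s₂
      ∑-right = trans (∑-+ elements (λ _ → 1) (λ t → ⟦ t ≟F s₂ ⟧ * f s₂))
        (cong (4 +_) (Multiplicity.∑-pick₁ _≟F_ elements {s₂} (λ _ → f s₂) (elements-once s₂)))

      opaque
        6≤f : 6 ≤ f s₂
        6≤f = +-cancelˡ-≤ 4 6 (f s₂) (≤-trans (≤-reflexive (sym ∑-left))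
          (≤-trans (∑-mono elements λ {t} _ → bound t) (≤-reflexive ∑-right)))

      opaque
        f≡1 : f s₂ ≤ 6 → ∀ t → t ≢ s₂ → f t ≡ 1
        f≡1 f≤6 t t≢s₂ = trans (sym (+-identityʳ (f t))) (trans (cong (f t +_) (sym (⟦⟧-no (t ≟F s₂) t≢s₂)))
          (trans (∑-tight elements (λ {t} _ → bound t) (≤-trans (≤-reflexive ∑-right) (≤-trans (+-monoʳ-≤ 4 f≤6) (≤-reflexive (sym ∑-left)))) (∈-elements t))
            (cong (λ k → 1 + k * f s₂) (⟦⟧-no (t ≟F s₂) t≢s₂))))

      opaque
        -- The point of weight at least 6 lies on a line of every direction, but D ≤ 3 + n, and n =
        -- 4 allows only D = 3.
        values : ∀ {Y} → Y ∈ on L → n Y ≡ 3 ⊎ 5 ≤ n Y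
        values {Y} i = cases (n Y) refl
          where
          P : U
          P = meet i₁ i₂ Y₁≢Y₂ s₁ s₂
          6≤D : 6 ≤ D L Y (lin L Y P)
          6≤D = ≤-trans 6≤f (d≤D L Y P refl)
          cases : ∀ k → n Y ≡ k → n Y ≡ 3 ⊎ 5 ≤ n Y
          cases 0 eq = contradiction (≤-trans 6≤D (D-upper i N≡25 eq refl)) (from-no (6 ≤? 3))
          cases 1 eq = contradiction (≤-trans 6≤D (D-upper i N≡25 eq refl)) (from-no (6 ≤? 4))
          cases 2 eq = contradiction (≤-trans 6≤D (D-upper i N≡25 eq refl)) (from-no (6 ≤? 5))
          cases 3 eq = inj₁ eq
          cases 4 eq = contradiction (≤-trans 6≤D (≤-reflexive (four-pattern i eq (lin L Y P)))) (from-no (6 ≤? 3))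
          cases (suc (suc (suc (suc (suc k))))) eq = inj₂ (≤-trans (m≤m+n 5 k) (≤-reflexive (sym eq)))

      opaque
        -- Otherwise N is at least 3 · 5 + 2 · 6 = 27.
        three : ∃ λ Y → Y ∈ on L × n Y ≡ 3
        three with search (λ Y → n Y ≟ℕ 3) (on L)
        ... | inj₁ found = found
        ... | inj₂ none  = contradiction (begin
          27                                                        ≡⟨ sym (trans (∑-+ (on L) _ _) (cong₂ _+_ (trans (∑-+ (on L) _ _)
                                                                         (cong₂ _+_ (∑-on-const L 5) (on-once i₁))) (on-once i₂))) ⟩
          ∑[ Y ← on L ] (5 + ⟦ Y ≟P Y₁ ⟧ + ⟦ Y ≟P Y₂ ⟧)             ≤⟨ ∑-mono (on L) (λ {Y} i → large Y i) ⟩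
          N L                                                       ≡⟨ N≡25 ⟩
          25                                                        ∎) (from-no (27 ≤? 25))
          where
          open ≤-Reasoning
          large : ∀ Y → Y ∈ on L → 5 + ⟦ Y ≟P Y₁ ⟧ + ⟦ Y ≟P Y₂ ⟧ ≤ n Y
          large Y i with Y ≟P Y₁ | Y ≟P Y₂ | values i
          ... | yes refl | yes refl | _       = contradiction refl Y₁≢Y₂
          ... | yes refl | no _     | _       = ≤-reflexive (sym six₁)
          ... | no _     | yes refl | _       = ≤-reflexive (sym six₂)
          ... | no _     | no _     | inj₂ le = le
          ... | no _     | no _     | inj₁ eq = contradiction eq (none i)

      opaque
        -- Otherwise all values are 3 or 6, and 25 would be divisible by 3.
        five : ∃ λ Y → Y ∈ on L × n Y ≡ 5
        five with search (λ Y → n Y ≟ℕ 5) (on L)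
        ... | inj₁ found = found
        ... | inj₂ none  = contradiction (trans (sym (trans (∑-+ (on L) _ _) (cong₂ _+_ (∑-on-const L 3) (∑-*ˡ (on L) 3 _))))
                             (trans (sym (∑-cong (on L) (λ {Y} i → multiple Y i))) N≡25))
                             (15+3k≢25 (∑[ Y ← on L ] ⟦ n Y ≟ℕ 6 ⟧)
                               (≤-trans (∑-mono (on L) (λ {Y} _ → ⟦⟧≤1 (n Y ≟ℕ 6))) (≤-reflexive (∑-on-const L 1))))
          where
          15+3k≢25 : ∀ k → k ≤ 5 → 15 + 3 * k ≢ 25
          15+3k≢25 k k≤5 = from-yes (allUpTo? (λ k → ¬? (15 + 3 * k ≟ℕ 25)) 6) (s≤s k≤5)
          multiple : ∀ Y → Y ∈ on L → n Y ≡ 3 + 3 * ⟦ n Y ≟ℕ 6 ⟧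
          multiple Y i with n Y ≟ℕ 6
          ... | yes eq = trans eq (cong (λ k → 3 + 3 * k) (sym (⟦⟧-yes (n Y ≟ℕ 6) eq)))
          ... | no ≢6 with values i
          ...   | inj₁ eq = trans eq (cong (λ k → 3 + 3 * k) (sym (⟦⟧-no (n Y ≟ℕ 6) ≢6)))
          ...   | inj₂ le = contradiction (≤-pred (≤∧≢⇒< (≤-pred (≤∧≢⇒< (n≤6 Y) ≢6)) (none i))) (<⇒≱ le)

      opaque
        impossible : ⊥
        impossible with three | five
        ... | Y₃ , i₃ , eq₃ | Y₅ , i₅ , eq₅ with five-pattern i₅ eq₅
        ...   | p , q , _ , _ , _ , rest with outside p q
        ...     | s , s≢p , s≢q = contradiction dP (λ dP≡0 → contradiction (≤-trans 6≤f (≤-reflexive dP≡0)) λ ())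
          where
          Y₁≢Y₅ : Y₁ ≢ Y₅
          Y₁≢Y₅ refl = contradiction (trans (sym six₁) eq₅) λ ()
          -- The point where the weight-9 line meets a line of weight 0 in direction `Y₅`.
          R : U
          R = meet i₁ i₅ Y₁≢Y₅ s₁ s
          dR : d L R ≡ 0
          dR = d-zero (rest s s≢p s≢q) R (lin-meetʳ i₁ i₅ Y₁≢Y₅ s₁ s)
          f≤6 : f s₂ ≤ 6
          f≤6 = ≤-trans (d≤D L Y₃ _ refl) (D-upper i₃ N≡25 eq₃ refl)
          R≡ : R ≡ meet i₁ i₂ Y₁≢Y₂ s₁ (lin L Y₂ R)
          R≡ = meet-unique i₁ i₂ Y₁≢Y₂ R (lin-meetˡ i₁ i₅ Y₁≢Y₅ s₁ s) refl
          dP : f s₂ ≡ 0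
          dP with lin L Y₂ R ≟F s₂
          ... | yes eq = trans (sym (cong (d L) (trans R≡ (cong (meet i₁ i₂ Y₁≢Y₂ s₁) eq)))) dR
          ... | no neq = contradiction (trans (sym (f≡1 f≤6 _ neq)) (trans (sym (cong (d L) R≡)) dR)) λ ()

    -- Classes of sizes 5 and 4 must occur. On the weight-9 line for `Y₁` the former puts weight 0
    -- on two points, and the latter allows at most 3 on each of the other two.
    module OneSix {Y₁} (i₁ : Y₁ ∈ on L) (six₁ : n Y₁ ≡ 6) (others : ∀ {Y} → Y ∈ on L → Y ≢ Y₁ → n Y ≤ 5) where

      private
        sum-with : ∀ k l → ∑[ Y ← on L ] (k + l * ⟦ Y ≟P Y₁ ⟧) ≡ 5 * k + l
        sum-with k l = trans (∑-+ (on L) _ _) (cong₂ _+_ (∑-on-const L k)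
          (trans (∑-*ˡ (on L) l _) (trans (cong (l *_) (on-once i₁)) (*-identityʳ l))))

      opaque
        five : ∃ λ Y → Y ∈ on L × n Y ≡ 5
        five with search (λ Y → n Y ≟ℕ 5) (on L)
        ... | inj₁ found = found
        ... | inj₂ none  = contradiction
          (≤-trans (≤-reflexive (sym N≡25)) (≤-trans (∑-mono (on L) (λ {Y} i → small Y i)) (≤-reflexive (sum-with 4 2)))) (from-no (25 ≤? 22))
          where
          small : ∀ Y → Y ∈ on L → n Y ≤ 4 + 2 * ⟦ Y ≟P Y₁ ⟧
          small Y i with Y ≟P Y₁
          ... | yes refl = ≤-reflexive six₁
          ... | no Y≢Y₁  = ≤-pred (≤∧≢⇒< (others i Y≢Y₁) (none i))

      opaque
        n≤5+ : ∀ Y → Y ∈ on L → n Y ≤ 5 + 1 * ⟦ Y ≟P Y₁ ⟧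
        n≤5+ Y i with Y ≟P Y₁
        ... | yes refl = ≤-reflexive six₁
        ... | no Y≢Y₁  = others i Y≢Y₁

      opaque
        four : ∃ λ Y → Y ∈ on L × n Y ≡ 4
        four with search (λ Y → n Y ≟ℕ 4) (on L) | search (λ Y → n Y ≤? 3) (on L)
        ... | inj₁ found | _ = found
        ... | inj₂ no4   | inj₂ no3 = contradiction
          (trans (sym N≡25) (trans (∑-cong (on L) (λ {Y} i → exact Y i)) (sum-with 5 1))) λ ()
          where
          exact : ∀ Y → Y ∈ on L → n Y ≡ 5 + 1 * ⟦ Y ≟P Y₁ ⟧
          exact Y i with Y ≟P Y₁
          ... | yes refl = six₁
          ... | no Y≢Y₁  = ≤-antisym (others i Y≢Y₁) (≤∧≢⇒< (≰⇒> (no3 i)) (no4 i ∘ sym))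
        -- `Z` stays at least 2 below the bound 5, so N could be at most 26 - 2.
        ... | inj₂ no4   | inj₁ (Z , j , n≤3) = contradiction (begin
          25 + 2                                     ≡⟨ cong₂ _+_ (sym N≡25) (sym (trans (∑-*ˡ (on L) 2 _) (cong (2 *_) (on-once j)))) ⟩
          N L + ∑[ Y ← on L ] (2 * ⟦ Y ≟P Z ⟧)       ≡⟨ sym (∑-+ (on L) n _) ⟩
          ∑[ Y ← on L ] (n Y + 2 * ⟦ Y ≟P Z ⟧)       ≤⟨ ∑-mono (on L) (λ {Y} i → bound Y i) ⟩
          ∑[ Y ← on L ] (5 + 1 * ⟦ Y ≟P Y₁ ⟧)        ≡⟨ sum-with 5 1 ⟩
          26                                         ∎) (from-no (27 ≤? 26))
          where
          open ≤-Reasoning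
          bound : ∀ Y → Y ∈ on L → n Y + 2 * ⟦ Y ≟P Z ⟧ ≤ 5 + 1 * ⟦ Y ≟P Y₁ ⟧
          bound Y i with Y ≟P Z
          ... | yes refl = ≤-trans (+-monoˡ-≤ 2 n≤3) (m≤m+n 5 _)
          ... | no _     = ≤-trans (≤-reflexive (+-identityʳ (n Y))) (n≤5+ Y i)

      opaque
        impossible : ⊥
        impossible with five | four | six-pattern i₁ six₁
        ... | Y₅ , i₅ , eq₅ | Y₄ , i₄ , eq₄ | s₁ , D≡9 , _ with five-pattern i₅ eq₅
        ...   | p , q , _ , _ , _ , rest with outside p q
        ...     | a , a≢p , a≢q with outside₃ p q a
        ...       | b , b≢p , b≢q , b≢a = contradiction (begin
          9 + 3 + 3
            ≡⟨ cong₂ _+_ (cong₂ _+_ (trans (sym D≡9) (∑-line i₁ i₅ Y₁≢Y₅ s₁ (d L)))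
                 (trans (cong (3 *_) (sym (elements-once a))) (sym (∑-*ˡ elements 3 (λ t → ⟦ t ≟F a ⟧)))))
                 (trans (cong (3 *_) (sym (elements-once b))) (sym (∑-*ˡ elements 3 (λ t → ⟦ t ≟F b ⟧)))) ⟩
          ∑ elements f + ∑[ t ← elements ] (3 * ⟦ t ≟F a ⟧) + ∑[ t ← elements ] (3 * ⟦ t ≟F b ⟧)
            ≡⟨ sym (trans (∑-+ elements (λ t → f t + 3 * ⟦ t ≟F a ⟧) (λ t → 3 * ⟦ t ≟F b ⟧))
                 (cong (_+ ∑[ t ← elements ] (3 * ⟦ t ≟F b ⟧)) (∑-+ elements f (λ t → 3 * ⟦ t ≟F a ⟧)))) ⟩
          ∑[ t ← elements ] (f t + 3 * ⟦ t ≟F a ⟧ + 3 * ⟦ t ≟F b ⟧)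
            ≤⟨ ∑-mono elements (λ {t} _ → bound t) ⟩
          ∑[ _ ← elements ] 3 ∎) (from-no (15 ≤? 12))
          where
          open ≤-Reasoning
          Y₁≢Y₅ : Y₁ ≢ Y₅
          Y₁≢Y₅ refl = contradiction (trans (sym six₁) eq₅) λ ()
          f : F → ℕ
          f t = d L (meet i₁ i₅ Y₁≢Y₅ s₁ t)
          f-zero : ∀ t → t ≢ p → t ≢ q → f t ≡ 0
          f-zero t t≢p t≢q = d-zero (rest t t≢p t≢q) _ (lin-meetʳ i₁ i₅ Y₁≢Y₅ s₁ t)
          bound : ∀ t → f t + 3 * ⟦ t ≟F a ⟧ + 3 * ⟦ t ≟F b ⟧ ≤ 3
          bound t with t ≟F a | t ≟F b
          ... | yes refl | yes refl = contradiction refl b≢a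
          ... | yes refl | no _     = ≤-reflexive (cong (λ k → k + 3 + 0) (f-zero t a≢p a≢q))
          ... | no _     | yes refl = ≤-reflexive (cong (λ k → k + 0 + 3) (f-zero t b≢p b≢q))
          ... | no _     | no _     = ≤-trans (≤-reflexive (trans (+-identityʳ _) (+-identityʳ _)))
            (≤-trans (d≤D L Y₄ _ refl) (≤-reflexive (four-pattern i₄ eq₄ _)))

    -- Counting pairs gives Σd² = 64, which no 2 × 2 grid with row and column sums 8 and 4 attains.
    module AllFive {Y₁ Y₂} (i₁ : Y₁ ∈ on L) (i₂ : Y₂ ∈ on L) (Y₂≢Y₁ : Y₂ ≢ Y₁) (fives : ∀ {Y} → Y ∈ on L → n Y ≡ 5) where

      opaque
        ∑D² : ∀ {Y} → Y ∈ on L → square-sum (D L Y) ≡ 80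
        ∑D² {Y} i with five-pattern i (fives i)
        ... | p , q , p≢q , D≡8 , D≡4 , rest = trans
          (Multiplicity.∑-support₂ _≟F_ elements {p} {q} (λ s → D L Y s * D L Y s) (elements-once p) (elements-once q) p≢q
            λ s s≢p s≢q → cong (λ k → k * k) (rest s s≢p s≢q))
          (cong₂ (λ a b → a * a + b * b) {D L Y p} {8} {D L Y q} {4} D≡8 D≡4)

      opaque
        ∑d : ∑ vectors (d L) ≡ 12
        ∑d with five-pattern i₁ (fives i₁)
        ... | p , q , p≢q , D≡8 , D≡4 , rest = trans
          (Reindexing.∑-fibres _≟U_ _≟F_ vectors elements elements-once (lin L Y₁) (d L))
          (trans (Multiplicity.∑-support₂ _≟F_ elements {p} {q} (D L Y₁) (elements-once p) (elements-once q) p≢q rest)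
            (cong₂ _+_ D≡8 D≡4))

      opaque
        ∑d² : 144 + 4 * ∑[ u ← vectors ] (d L u * d L u) ≡ 400
        ∑d² = trans (cong (λ k → k * k + 4 * ∑[ u ← vectors ] (d L u * d L u)) {12} (sym ∑d))
          (trans (sym (∑-parallel² _≟U_ _≟F_ (on L) vectors elements vectors-once elements-once (lin L) 4 (lin-parallel L) (d L)))
            (trans (∑-cong (on L) ∑D²) (∑-on-const L 80)))

      opaque
        impossible : ⊥
        impossible with five-pattern i₁ (fives i₁) | five-pattern i₂ (fives i₂)
        ... | p₁ , q₁ , p₁≢q₁ , p₁≡8 , q₁≡4 , rest₁ | p₂ , q₂ , p₂≢q₂ , p₂≡8 , q₂≡4 , rest₂ =
          no-grid A≤8 B≤8 C≤8 (≤-trans (m≤n+m E C) (≤-reflexive (trans (sym row-q) q₁≡4)))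
            (trans (sym row-p) p₁≡8) (trans (sym row-q) q₁≡4) (trans (sym column-p) p₂≡8) (trans (sym column-q) q₂≡4)
            (trans (cong (λ k → 144 + 4 * k) (sym (∑-corners (λ u → d L u * d L u) λ u z → cong (λ k → k * k) z))) ∑d²)
          where
          open Grid i₁ i₂ (Y₂≢Y₁ ∘ sym) p₁≢q₁ p₂≢q₂ rest₁ rest₂
          A≤8 : A ≤ 8
          A≤8 = ≤-trans (m≤m+n A B) (≤-reflexive (trans (sym row-p) p₁≡8))
          B≤8 : B ≤ 8
          B≤8 = ≤-trans (m≤n+m B A) (≤-reflexive (trans (sym row-p) p₁≡8))
          C≤8 : C ≤ 8
          C≤8 = ≤-trans (m≤n+m C A) (≤-reflexive (trans (sym column-p) p₂≡8))

    impossible : ⊥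
    impossible with search (λ Y → n Y ≟ℕ 6) (on L)
    impossible | inj₁ (Y₁ , i₁ , six₁) with search (λ Y → (n Y ≟ℕ 6) ×-dec ¬? (Y ≟P Y₁)) (on L)
    ... | inj₁ (Y₂ , i₂ , six₂ , Y₂≢Y₁) =
      TwoSixes.impossible i₁ i₂ (Y₂≢Y₁ ∘ sym) six₁ six₂ (proj₁ (proj₂ (six-pattern i₁ six₁))) (proj₂ (proj₂ (six-pattern i₂ six₂)))
    ... | inj₂ none = OneSix.impossible i₁ six₁ λ {Y} i Y≢Y₁ → ≤-pred (≤∧≢⇒< (n≤6 Y) λ eq → none i (eq , Y≢Y₁))
    impossible | inj₂ none with search (λ Y → n Y ≟ℕ 5) (on L)
    ... | inj₂ none′ = contradiction (≤-trans (≤-reflexive (sym N≡25)) (≤-trans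
      (∑-mono (on L) λ {Y} i → ≤-pred (≤∧≢⇒< (≤-pred (≤∧≢⇒< (n≤6 Y) (none i))) (none′ i))) (≤-reflexive (∑-on-const L 4)))) (from-no (25 ≤? 20))
    ... | inj₁ (Y₁ , i₁ , _) with another i₁
    ...   | Y₂ , i₂ , Y₂≢Y₁ = AllFive.impossible i₁ i₂ Y₂≢Y₁
      (∑-tight (on L) (λ {Y} i → ≤-pred (≤∧≢⇒< (n≤6 Y) (none i))) (≤-reflexive (trans (∑-on-const L 5) (sym N≡25))))

  -- Line classes with 26 points

  module Line26 {L : PG} (N≡26 : N L ≡ 26) where

    opaque
      not-five : ∀ {Y} → Y ∈ on L → n Y ≢ 5
      not-five i n≡5 = contradiction (≤-trans (≤-reflexive (sym N≡26)) (Five.five-N n≡5 (on-sym i))) (from-no (26 ≤? 25))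

    opaque
      w≤2 : ∀ {Y} → Y ∈ on L → n Y ≡ 6 → ∀ s → w Y L s ≤ 2
      w≤2 {Y} i n≡6 s = ≮⇒≥ λ 3≤w → contradiction (≤-trans (+-monoʳ-≤ 26 (*-monoʳ-≤ 4 3≤w))
        (subst₂ (λ a m → a + 4 * w Y L s ≤ 28 + m) N≡26 n≡6 (segment-≤ i s))) (from-no (38 ≤? 34))

    -- All the deficiency lies on one line, hence is read off in the other directions
    -- point by point; by segment, n ≡ D + 2 (mod 4) in every direction.
    module Concentrated {Y : PG} (i : Y ∈ on L) (n≡6 : n Y ≡ 6) {s₀ : F} (z : w Y L s₀ ≡ 0) where

      opaque
        D-zero : ∀ s → s ≢ s₀ → D L Y s ≡ 0
        D-zero s s≢s₀ = D-value i N≡26 (Pattern.sum-6-zero (w Y L) (w≤2 i n≡6) (Six.sum n≡6 L) z s s≢s₀) n≡6 refl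

      opaque
        -- A line of another direction meets the line carrying all the weight in a single point.
        D≡d : ∀ {Y′} → Y′ ∈ on L → Y′ ≢ Y → ∀ u → lin L Y u ≡ s₀ → D L Y′ (lin L Y′ u) ≡ d L u
        D≡d {Y′} i′ Y′≢Y u on-line = trans (∑-line i′ i Y′≢Y (lin L Y′ u) (d L)) (trans
          (Multiplicity.∑-support₁ _≟F_ elements {s₀} (λ t → d L (meet i′ i Y′≢Y (lin L Y′ u) t)) (elements-once s₀)
            λ t t≢s₀ → d-zero (D-zero t t≢s₀) _ (lin-meetʳ i′ i Y′≢Y _ t))
          (cong (d L) (sym (meet-unique i′ i Y′≢Y u refl on-line))))

      opaque
        -- For a fixed `u` on the weighted line, `segment` makes 2 + n congruent to `d L u` modulo 4
        -- for all classes other than `Y`. If this residue is not 0, the values 2, 5 and 6 are all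
        -- excluded, so these classes have at most 4 points and N ≤ 6 + 16.
        two-or-six : ∀ {Y′} → Y′ ∈ on L → Y′ ≢ Y → n Y′ ≡ 2 ⊎ n Y′ ≡ 6
        two-or-six {Y′} i′ Y′≢Y with another i
        ... | Z , j , Z≢Y = decide (d L u % 4 ≟ℕ 0)
          where
          u : U
          u = meet i j (Z≢Y ∘ sym) s₀ 0F
          residue : ∀ {Y′} → Y′ ∈ on L → Y′ ≢ Y → (2 + n Y′) % 4 ≡ d L u % 4
          residue {Y′} i′ Y′≢Y = trans (cong (_% 4) {2 + n Y′} (sym (trans
              (cong (d L u +_) (*-comm (w Y′ L (lin L Y′ u)) 4))
              (+-cancelʳ-≡ 26 _ _ (trans (trans (+-assoc (d L u) _ 26) (cong₂ _+_ (sym (D≡d i′ Y′≢Y u (lin-meetˡ i j (Z≢Y ∘ sym) s₀ 0F)))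
                (trans (+-comm _ 26) (cong (_+ 4 * w Y′ L (lin L Y′ u)) (sym N≡26)))))
                (trans (segment i′ (lin L Y′ u)) (+-comm 26 (2 + n Y′))))))))
            ([m+kn]%n≡m%n (d L u) (w Y′ L (lin L Y′ u)) 4)
          decide : Dec (d L u % 4 ≡ 0) → n Y′ ≡ 2 ⊎ n Y′ ≡ 6
          decide (yes r≡0) = check (s≤s (n≤6 Y′)) (trans (residue i′ Y′≢Y) r≡0)
            where
            check : ∀ {k} → k < 7 → (2 + k) % 4 ≡ 0 → k ≡ 2 ⊎ k ≡ 6
            check = from-yes (allUpTo? (λ k → ((2 + k) % 4 ≟ℕ 0) →-dec ((k ≟ℕ 2) ⊎-dec (k ≟ℕ 6))) 7)
          decide (no r≢0) = contradiction (≤-trans (≤-reflexive (sym N≡26)) (≤-trans (∑-mono (on L) λ {X} i′ → small X i′)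
            (≤-reflexive (trans (∑-+ (on L) (λ _ → 4) _) (cong₂ _+_ (∑-on-const L 4) (trans (∑-*ˡ (on L) 2 _) (cong (2 *_) (on-once i))))))))
            (from-no (26 ≤? 22))
            where
            check : ∀ {k} → k < 7 → k ≢ 5 → (2 + k) % 4 ≢ 0 → k ≤ 4
            check = from-yes (allUpTo? (λ k → ¬? (k ≟ℕ 5) →-dec (¬? ((2 + k) % 4 ≟ℕ 0) →-dec (k ≤? 4))) 7)
            small : ∀ X → X ∈ on L → n X ≤ 4 + 2 * ⟦ X ≟P Y ⟧
            small X i′ with X ≟P Y
            ... | yes refl = ≤-reflexive n≡6
            ... | no X≢Y   = check (s≤s (n≤6 X)) (not-five i′) λ eq → r≢0 (trans (sym (residue i′ X≢Y)) eq)

      opaque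
        two : ∃ λ Z → Z ∈ on L × n Z ≡ 2
        two with search (λ Z → n Z ≟ℕ 2) (on L)
        ... | inj₁ found = found
        ... | inj₂ none  = contradiction (trans (sym N≡26) (trans (∑-cong (on L) λ {X} i′ → all-six X i′) (∑-on-const L 6))) λ ()
          where
          all-six : ∀ X → X ∈ on L → n X ≡ 6
          all-six X i′ with X ≟P Y
          ... | yes refl = n≡6
          ... | no X≢Y with two-or-six i′ X≢Y
          ...   | inj₁ eq = contradiction eq (none i′)
          ...   | inj₂ eq = eq

      opaque
        -- An empty part would mean a line of weight 8, hence a point of weight 8, but a class with
        -- two points bounds the lines of its direction by 4.
        positive : ∀ {Y′} → Y′ ∈ on L → Y′ ≢ Y → n Y′ ≡ 6 → ∀ s → 1 ≤ w Y′ L s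
        positive {Y′} i′ Y′≢Y n′≡6 s with two
        ... | Z , j , n≡2 = n≢0⇒n>0 λ w≡0 → contradiction (begin
          8                                  ≡⟨ sym (D-value i′ N≡26 w≡0 n′≡6 refl) ⟩
          D L Y′ s                           ≡⟨ cong (D L Y′) (sym (lin-meetˡ i′ i Y′≢Y s s₀)) ⟩
          D L Y′ (lin L Y′ u)                ≡⟨ D≡d i′ Y′≢Y u (lin-meetʳ i′ i Y′≢Y s s₀) ⟩
          d L u                              ≤⟨ d≤D L Z u refl ⟩
          D L Z (lin L Z u)                  ≤⟨ D-upper j N≡26 n≡2 refl ⟩
          4                                  ∎) (from-no (8 ≤? 4))
          where
          open ≤-Reasoning
          u : U
          u = meet i′ i Y′≢Y s s₀

  -- Line classes with 22 points

  module Line22 {L : PG} (N≡22 : N L ≡ 22) where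

    opaque
      -- Here D = 6 + n - 4w, so a six has line weights 12, 12, 0, 0. The first two leave four
      -- corners with `A ≡ E`, and direction `Y₄` bounds each point by 8. Thus direction `Y₃` must
      -- join the opposite corners `a` and `e` to reach 12, and `A` is 6. In direction `Y₄` the
      -- corner `a` is then alone on a line of weight 6, which is not of the form 8 - 4w.
      three-sixes : ∀ {Y₁ Y₂ Y₃ Y₄} → Y₁ ∈ on L → Y₂ ∈ on L → Y₃ ∈ on L → Y₄ ∈ on L →
        Y₁ ≢ Y₂ → Y₁ ≢ Y₃ → Y₂ ≢ Y₃ → n Y₁ ≡ 6 → n Y₂ ≡ 6 → n Y₃ ≡ 6 → n Y₄ ≡ 2 →
        TwoAndRest (w Y₁ L) 0 0 3 → TwoAndRest (w Y₂ L) 0 0 3 → TwoAndRest (w Y₃ L) 0 0 3 → ⊥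
      three-sixes {Y₁} {Y₂} {Y₃} {Y₄} i₁ i₂ i₃ i₄ Y₁≢Y₂ Y₁≢Y₃ Y₂≢Y₃ six₁ six₂ six₃ two₄
        (p₁ , q₁ , p₁≢q₁ , zp₁ , zq₁ , rest₁) (p₂ , q₂ , p₂≢q₂ , zp₂ , zq₂ , rest₂) (p₃ , q₃ , p₃≢q₃ , zp₃ , zq₃ , rest₃) =
        contradiction (trans (sym (+-cancelʳ-≡ 22 _ _ (trans (shuffle (D L Y₄ (lin L Y₄ a)) (w Y₄ L (lin L Y₄ a))) (trans
            (cong (λ k → D L Y₄ (lin L Y₄ a) + (k + 4 * w Y₄ L (lin L Y₄ a))) (sym N≡22))
            (trans (segment i₄ (lin L Y₄ a)) (cong (28 +_) two₄)))))) (cong (_+ 4 * w Y₄ L (lin L Y₄ a)) D₄≡6))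
          (8≢6+4k (w Y₄ L (lin L Y₄ a)))
        where
        shuffle : ∀ a b → a + 4 * b + 22 ≡ a + (22 + 4 * b)
        shuffle = solve-∀
        8≢6+4k : ∀ k → 8 ≢ 6 + 4 * k
        8≢6+4k zero    ()
        8≢6+4k (suc k) eq = contradiction (≤-trans (+-monoʳ-≤ 6 (*-monoʳ-≤ 4 (s≤s (z≤n {k})))) (≤-reflexive (sym eq))) (from-no (10 ≤? 8))
        opaque
          D-zero : ∀ {Y p q} → Y ∈ on L → n Y ≡ 6 → (∀ s → s ≢ p → s ≢ q → w Y L s ≡ 3) → ∀ s → s ≢ p → s ≢ q → D L Y s ≡ 0
          D-zero i six rest s s≢p s≢q = D-value i N≡22 (rest s s≢p s≢q) six refl
        D≤8 : ∀ s → D L Y₄ s ≤ 8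
        D≤8 s = D-upper i₄ N≡22 two₄ refl
        D-12 : ∀ s → 1 ≤ D L Y₃ s → D L Y₃ s ≡ 12
        D-12 s pos with s ≟F p₃ | s ≟F q₃
        ... | yes refl | _        = D-value i₃ N≡22 zp₃ six₃ refl
        ... | no _     | yes refl = D-value i₃ N≡22 zq₃ six₃ refl
        ... | no s≢p   | no s≢q   = contradiction (≤-trans pos (≤-reflexive (D-zero i₃ six₃ rest₃ s s≢p s≢q))) λ ()
        Y₄≢ : ∀ {Y} → n Y ≡ 6 → Y₄ ≢ Y
        Y₄≢ six refl = contradiction (trans (sym two₄) six) λ ()
        open Grid i₁ i₂ Y₁≢Y₂ p₁≢q₁ p₂≢q₂ (D-zero i₁ six₁ rest₁) (D-zero i₂ six₂ rest₂)
        a e : U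
        a = g p₁ p₂
        e = g q₁ q₂
        A+B : A + B ≡ 12
        A+B = trans (sym row-p) (D-value i₁ N≡22 zp₁ six₁ refl)
        B+E : B + E ≡ 12
        B+E = trans (sym column-q) (D-value i₂ N≡22 zq₂ six₂ refl)
        A≤8 : A ≤ 8
        A≤8 = ≤-trans (d≤D L Y₄ a refl) (D≤8 (lin L Y₄ a))
        A≡E : A ≡ E
        A≡E = +-cancelʳ-≡ B A E (trans A+B (trans (sym B+E) (+-comm B E)))
        -- Otherwise the neighbouring corner would carry all 12.
        1≤A : 1 ≤ A
        1≤A = n≢0⇒n>0 λ A≡0 → contradiction
          (≤-trans (≤-reflexive (sym (trans (cong (_+ B) (sym A≡0)) A+B))) (≤-trans (d≤D L Y₄ (g p₁ q₂) refl) (D≤8 _))) (from-no (12 ≤? 8))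
        D₃≡12 : D L Y₃ (lin L Y₃ a) ≡ 12
        D₃≡12 = D-12 _ (≤-trans 1≤A (d≤D L Y₃ a refl))
        collinear : lin L Y₃ e ≡ lin L Y₃ a
        collinear with lin L Y₃ e ≟F lin L Y₃ a | third i₃ (Y₁≢Y₃ ∘ sym) (Y₂≢Y₃ ∘ sym)
        ... | yes eq | _  = eq
        ... | no _   | eq = contradiction (≤-trans (≤-reflexive (trans (sym D₃≡12) (trans eq (+-identityʳ A)))) A≤8) (from-no (12 ≤? 8))
        A≡6 : A ≡ 6
        A≡6 = *-cancelˡ-≡ A 6 2 (trans (cong (A +_) (trans (+-identityʳ A) (trans A≡E (sym (*-identityˡ E)))))
          (trans (cong (λ k → A + k * E) (sym (⟦⟧-yes (lin L Y₃ e ≟F lin L Y₃ a) collinear)))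
            (trans (sym (third i₃ (Y₁≢Y₃ ∘ sym) (Y₂≢Y₃ ∘ sym))) D₃≡12)))
        not-collinear : lin L Y₄ e ≢ lin L Y₄ a
        not-collinear eq = p₁≢q₁ (trans (sym (lin₁ p₁ p₂)) (trans (cong (lin L Y₁)
          (sym (trans (meet-unique i₃ i₄ (Y₄≢ six₃ ∘ sym) e collinear eq) (meet-lin i₃ i₄ (Y₄≢ six₃ ∘ sym) a)))) (lin₁ q₁ q₂)))
        D₄≡6 : D L Y₄ (lin L Y₄ a) ≡ 6
        D₄≡6 = trans (third i₄ (Y₄≢ six₁) (Y₄≢ six₂)) (trans
          (cong (λ k → A + k * E) (⟦⟧-no (lin L Y₄ e ≟F lin L Y₄ a) not-collinear)) (trans (+-identityʳ A) A≡6))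

  -- Existence of line classes with 26 points and of classes with six

  ∈-classes : ∀ X → X ∈ classes
  ∈-classes X = Multiplicity.multiplicity-pos _≟P_ classes (≤-reflexive (sym (classes-once X)))

  opaque
    ≤4-or : ∀ {k} → k ≤ 6 → k ≤ 4 ⊎ k ≡ 5 ⊎ k ≡ 6
    ≤4-or k≤6 = from-yes (allUpTo? (λ k → (k ≤? 4) ⊎-dec ((k ≟ℕ 5) ⊎-dec (k ≟ℕ 6))) 7) (s≤s k≤6)

  opaque
    N≤26 : ∀ L → N L ≤ 26
    N≤26 L with search (λ Y → 5 ≤? n Y) (on L)
    ... | inj₂ none = ≤-trans (∑-mono (on L) λ i → ≤-pred (≰⇒> (none i))) (≤-trans (≤-reflexive (∑-on-const L 4)) (from-yes (20 ≤? 26)))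
    ... | inj₁ (Y , i , 5≤n) with ≤4-or (n≤6 Y)
    ...   | inj₁ n≤4        = contradiction (≤-trans 5≤n n≤4) (from-no (5 ≤? 4))
    ...   | inj₂ (inj₁ n≡5) = ≤-trans (Five.five-N n≡5 (on-sym i)) (n≤1+n 25)
    ...   | inj₂ (inj₂ n≡6) = Six.six-N n≡6 (on-sym i)

  opaque
    N≤24 : ∀ {L} → N L ≢ 26 → N L ≤ 24
    N≤24 {L} N≢26 = ≤-pred (≤∧≢⇒< (≤-pred (≤∧≢⇒< (N≤26 L) N≢26)) λ N≡25 → Line25.impossible N≡25)

  opaque
    -- Five lines with N ≤ 24 reach only 120, short of 102 + 4 · 5.
    some-26 : ∀ {X} → 5 ≤ n X → ∃ λ L → L ∈ on X × N L ≡ 26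
    some-26 {X} 5≤n with search (λ L → N L ≟ℕ 26) (on X)
    ... | inj₁ found = found
    ... | inj₂ none  = contradiction (begin
      122                ≤⟨ +-monoʳ-≤ 102 (*-monoʳ-≤ 4 5≤n) ⟩
      102 + 4 * n X      ≤⟨ ∑N-≥ X ⟩
      ∑ (on X) N         ≤⟨ ∑-mono (on X) (λ j → N≤24 (none j)) ⟩
      ∑[ _ ← on X ] 24   ≡⟨ ∑-on-const X 24 ⟩
      120                ∎) (from-no (122 ≤? 120))
      where open ≤-Reasoning

  opaque
    no-five : ∀ X → n X ≢ 5
    no-five X n≡5 with some-26 (≤-reflexive (sym n≡5))
    ... | L , j , N≡26 = Line26.not-five N≡26 (on-sym j) n≡5

  opaque
    some-six : ∃ λ X → n X ≡ 6
    some-six with search (λ X → n X ≟ℕ 6) classes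
    ... | inj₁ (X , _ , n≡6) = X , n≡6
    ... | inj₂ none = contradiction (≤-trans total (≤-trans
      (∑-mono classes λ {X} i → ≤-pred (≤∧≢⇒< (≤-pred (≤∧≢⇒< (n≤6 X) (none i))) (no-five X)))
      (≤-reflexive (trans (∑-const classes 4) (cong (_* 4) classes-length))))) (from-no (102 ≤? 84))

  -- Double counting of the types α and β

  IsAlpha IsBeta : PG → PG → Set
  IsAlpha X L = n X ≡ 6 × N L ≡ 26 × ∃ λ s → w X L s ≡ 0
  IsBeta  X L = n X ≡ 6 × N L ≡ 26 × (∀ s → 1 ≤ w X L s)

  alpha? : ∀ X L → Dec (IsAlpha X L)
  alpha? X L = (n X ≟ℕ 6) ×-dec ((N L ≟ℕ 26) ×-dec anyF? λ s → w X L s ≟ℕ 0)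

  beta? : ∀ X L → Dec (IsBeta X L)
  beta? X L = (n X ≟ℕ 6) ×-dec ((N L ≟ℕ 26) ×-dec allF? λ s → 1 ≤? w X L s)

  opaque
    α β : PG → PG → ℕ
    α X L = ⟦ alpha? X L ⟧
    β X L = ⟦ beta? X L ⟧

  opaque
    unfolding α
    α-yes : ∀ {X L} → IsAlpha X L → α X L ≡ 1
    α-yes = ⟦⟧-yes (alpha? _ _)
    α-no : ∀ {X L} → ¬ IsAlpha X L → α X L ≡ 0
    α-no = ⟦⟧-no (alpha? _ _)
    β-yes : ∀ {X L} → IsBeta X L → β X L ≡ 1
    β-yes = ⟦⟧-yes (beta? _ _)
    β-no : ∀ {X L} → ¬ IsBeta X L → β X L ≡ 0
    β-no = ⟦⟧-no (beta? _ _)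

  zero⇒¬beta : ∀ {X L s} → w X L s ≡ 0 → ¬ IsBeta X L
  zero⇒¬beta {s = s} z (_ , _ , pos) = contradiction (≤-trans (pos s) (≤-reflexive z)) λ ()

  a-line b-line : PG → ℕ
  a-line L = ∑[ X ← on L ] α X L
  b-line L = ∑[ X ← on L ] β X L

  module AlphaLine {L Y} (i : Y ∈ on L) (n≡6 : n Y ≡ 6) (N≡26 : N L ≡ 26) {s₀} (z : w Y L s₀ ≡ 0) where
    open Line26.Concentrated N≡26 i n≡6 z public

    opaque
      α-other : ∀ {X} → X ∈ on L → α X L ≡ ⟦ X ≟P Y ⟧
      α-other {X} j = cases (X ≟P Y)
        where
        cases : (X≟Y : Dec (X ≡ Y)) → α X L ≡ ⟦ X≟Y ⟧
        cases (yes refl) = α-yes (n≡6 , N≡26 , _ , z)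
        cases (no X≢Y)   = α-no λ (n′≡6 , _ , s , w≡0) →
          contradiction (≤-trans (positive j X≢Y n′≡6 s) (≤-reflexive w≡0)) λ ()

    opaque
      n-other : ∀ {X} → X ∈ on L → n X ≡ 2 + 4 * β X L + 4 * ⟦ X ≟P Y ⟧
      n-other {X} j = cases (X ≟P Y)
        where
        cases : (X≟Y : Dec (X ≡ Y)) → n X ≡ 2 + 4 * β X L + 4 * ⟦ X≟Y ⟧
        cases (yes refl) = trans n≡6 (cong (λ b → 2 + 4 * b + 4) {0} (sym (β-no (zero⇒¬beta z))))
        cases (no X≢Y) with two-or-six j X≢Y
        ... | inj₁ n≡2 = trans n≡2 (cong (λ b → 2 + 4 * b + 0) {0} (sym (β-no λ (six , _) → contradiction (trans (sym n≡2) six) λ ())))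
        ... | inj₂ n′≡6 = trans n′≡6 (cong (λ b → 2 + 4 * b + 0) {1} (sym (β-yes (n′≡6 , N≡26 , positive j X≢Y n′≡6))))

    opaque
      a-line≡1 : a-line L ≡ 1
      a-line≡1 = trans (∑-cong (on L) α-other) (on-once i)

    opaque
      -- Five classes of size 2 or 6, one of the sixes being the α: 26 = 10 + 4(b + 1).
      b-line≡3 : b-line L ≡ 3
      b-line≡3 = *-cancelˡ-≡ (b-line L) 3 4 (+-cancelʳ-≡ 14 _ _ (trans (shuffle (b-line L)) (sym (begin
        26                                                      ≡⟨ sym N≡26 ⟩
        N L                                                     ≡⟨ ∑-cong (on L) n-other ⟩
        ∑[ X ← on L ] (2 + 4 * β X L + 4 * ⟦ X ≟P Y ⟧)          ≡⟨ trans (∑-+ (on L) (λ X → 2 + 4 * β X L) _)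
                                                                    (cong₂ _+_ (∑-+ (on L) (λ _ → 2) _) (∑-*ˡ (on L) 4 _)) ⟩
        ∑[ _ ← on L ] 2 + ∑[ X ← on L ] (4 * β X L) + 4 * multiplicityP (on L) Y
          ≡⟨ cong₂ _+_ (cong₂ _+_ (∑-on-const L 2) (∑-*ˡ (on L) 4 _)) (cong (4 *_) (on-once i)) ⟩
        10 + 4 * b-line L + 4                                   ∎))))
        where
        open ≡-Reasoning
        shuffle : ∀ b → 4 * b + 14 ≡ 10 + 4 * b + 4
        shuffle = solve-∀

    opaque
      values : ∀ {X} → X ∈ on L → n X ≡ 2 ⊎ n X ≡ 6
      values {X} j with X ≟P Y
      ... | yes refl = inj₂ n≡6
      ... | no X≢Y   = two-or-six j X≢Y

  opaque
    line-inequality : ∀ L → 3 * a-line L ≤ b-line L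
    line-inequality L with search (λ X → alpha? X L) (on L)
    ... | inj₂ none = ≤-trans (≤-reflexive (cong (3 *_) (∑-zeros (on L) λ i → α-no (none i)))) z≤n
    ... | inj₁ (Y , i , n≡6 , N≡26 , s , z) = ≤-reflexive (trans (cong (3 *_) (AlphaLine.a-line≡1 i n≡6 N≡26 z)) (sym (AlphaLine.b-line≡3 i n≡6 N≡26 z)))

  a-class b-class : PG → ℕ
  a-class X = ∑[ L ← on X ] α X L
  b-class X = ∑[ L ← on X ] β X L

  opaque
    light-b : ∀ {X} → n X ≡ 6 → Light X → b-class X ≡ 0
    light-b {X} n≡6 lt = ∑-zeros (on X) λ j → β-no (zero⇒¬beta (proj₂ (Six.light-zero n≡6 lt j)))

  module HeavyClass {X} (n≡6 : n X ≡ 6) (heavy : Six.Heavy n≡6) where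
    open Six n≡6

    opaque
      -- Excess 0 means N = 26, hence α with squares at most 12 or β with squares 10; excess 1 means
      -- N = 22 and squares at most 18. The form uniform in the excess can be summed over
      -- directions.
      direction : ∀ {L} → L ∈ on X → (α X L + β X L) + excess X L ≡ 1 × Q X L + 2 * β X L ≤ 12 + 6 * excess X L
      direction {L} j = cases (excess X L) refl (excess≤1 heavy j)
        where
        cases : ∀ e → excess X L ≡ e → e ≤ 1 → (α X L + β X L) + excess X L ≡ 1 × Q X L + 2 * β X L ≤ 12 + 6 * excess X L
        cases 0 e≡0 _ with anyF? (λ s → w X L s ≟ℕ 0)
        ... | yes (s , z) =
          cong₂ _+_ (cong₂ _+_ (α-yes (n≡6 , N≡26 , s , z)) β≡0) e≡0 ,
          ≤-trans (≤-reflexive (trans (cong (λ b → Q X L + 2 * b) β≡0) (+-identityʳ _)))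
            (≤-trans (Pattern.sum-6-squares (w X L) w≤2 (sum L)) (m≤m+n 12 _))
          where
          N≡26 : N L ≡ 26
          N≡26 = trans (sym (+-identityʳ _)) (trans (cong (λ e → N L + 4 * e) (sym e≡0)) (heavy-N heavy j))
          w≤2 : ∀ s → w X L s ≤ 2
          w≤2 = Line26.w≤2 N≡26 (on-sym j) n≡6
          β≡0 : β X L ≡ 0
          β≡0 = β-no (zero⇒¬beta z)
        ... | no none =
          cong₂ _+_ (cong₂ _+_ (α-no λ (_ , _ , z) → none z) β≡1) e≡0 ,
          ≤-trans (≤-reflexive (cong₂ (λ q b → q + 2 * b) (Pattern.sum-6-squares-positive (w X L) w≤2 (sum L) pos) β≡1)) (m≤m+n 12 _)
          where
          N≡26 : N L ≡ 26
          N≡26 = trans (sym (+-identityʳ _)) (trans (cong (λ e → N L + 4 * e) (sym e≡0)) (heavy-N heavy j))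
          w≤2 : ∀ s → w X L s ≤ 2
          w≤2 = Line26.w≤2 N≡26 (on-sym j) n≡6
          pos : ∀ s → 1 ≤ w X L s
          pos s = n≢0⇒n>0 λ z → none (s , z)
          β≡1 : β X L ≡ 1
          β≡1 = β-yes (n≡6 , N≡26 , pos)
        cases 1 e≡1 _ =
          cong₂ _+_ (cong₂ _+_ (α-no λ (_ , eq , _) → N≢26 eq) β≡0) e≡1 ,
          ≤-trans (≤-reflexive (trans (cong (λ b → Q X L + 2 * b) β≡0) (+-identityʳ _)))
            (≤-trans (heavy-squares heavy j e≡1) (≤-reflexive (cong (λ e → 12 + 6 * e) {1} (sym e≡1))))
          where
          N≢26 : N L ≢ 26
          N≢26 eq = contradiction (trans (sym (cong₂ (λ a e → a + 4 * e) {N L} {26} eq e≡1)) (heavy-N heavy j)) λ ()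
          β≡0 : β X L ≡ 0
          β≡0 = β-no λ (_ , eq , _) → N≢26 eq
        cases (suc (suc _)) _ (s≤s ())

    opaque
      a+b : a-class X + b-class X ≡ 4
      a+b = +-cancelʳ-≡ 1 _ _ (begin
        a-class X + b-class X + 1                         ≡⟨ cong₂ _+_ (sym (∑-+ (on X) _ _)) (sym heavy) ⟩
        ∑[ L ← on X ] (α X L + β X L) + ∑ (on X) (excess X)  ≡⟨ sym (∑-+ (on X) _ _) ⟩
        ∑[ L ← on X ] (α X L + β X L + excess X L)        ≡⟨ ∑-cong (on X) (λ j → proj₁ (direction j)) ⟩
        ∑[ _ ← on X ] 1                                   ≡⟨ ∑-on-const X 1 ⟩
        5                                                 ∎)
        where open ≡-Reasoning

    opaque
      ∑-left : ∑[ L ← on X ] (Q X L + 2 * β X L) ≡ 60 + 2 * b-class X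
      ∑-left = trans (∑-+ (on X) (Q X) _) (cong₂ _+_ (trans (∑w² X) (cong (λ k → k * k + 4 * k) {n X} n≡6)) (∑-*ˡ (on X) 2 _))

    opaque
      ∑-right : ∑[ L ← on X ] (12 + 6 * excess X L) ≡ 66
      ∑-right = trans (∑-+ (on X) (λ _ → 12) _) (cong₂ _+_ (∑-on-const X 12) (trans (∑-*ˡ (on X) 6 _) (cong (6 *_) heavy)))

    opaque
      -- Summing the square bounds gives 60 + 2b ≤ 66.
      b≤3 : b-class X ≤ 3
      b≤3 = *-cancelˡ-≤ 2 (+-cancelˡ-≤ 60 _ _ (≤-trans (≤-reflexive (sym ∑-left))
        (≤-trans (∑-mono (on X) λ j → proj₂ (direction j)) (≤-reflexive ∑-right))))

    opaque
      squares-tight : b-class X ≡ 3 → ∀ {L} → L ∈ on X → Q X L + 2 * β X L ≡ 12 + 6 * excess X L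
      squares-tight b≡3 = ∑-tight (on X) (λ j → proj₂ (direction j))
        (≤-reflexive (trans ∑-right (sym (trans ∑-left (cong (λ b → 60 + 2 * b) {b-class X} b≡3)))))

  opaque
    b≤3a : ∀ {a b} → a + b ≡ 4 → b ≤ 3 → b ≤ 3 * a
    b≤3a {zero}  refl (s≤s (s≤s (s≤s ())))
    b≤3a {suc a} _ b≤3 = ≤-trans b≤3 (*-monoʳ-≤ 3 (s≤s (z≤n {a})))

  opaque
    -- A light class has no β. In a heavy one a + b = 4 and b ≤ 3 leave room for at least one α.
    class-inequality : ∀ X → b-class X ≤ 3 * a-class X
    class-inequality X with n X ≟ℕ 6
    ... | no n≢6 = ≤-trans (≤-reflexive (∑-zeros (on X) λ _ → β-no λ (eq , _) → n≢6 eq)) z≤n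
    ... | yes n≡6 with Six.light-or-heavy n≡6
    ...   | inj₁ lt    = ≤-trans (≤-reflexive (light-b n≡6 lt)) z≤n
    ...   | inj₂ heavy = b≤3a (HeavyClass.a+b n≡6 heavy) (HeavyClass.b≤3 n≡6 heavy)

  opaque
    3∑a : ∑[ X ← classes ] (3 * a-class X) ≡ ∑[ L ← classes ] (3 * a-line L)
    3∑a = trans (∑-*ˡ classes 3 _) (trans (cong (3 *_) (∑-flags α)) (sym (∑-*ˡ classes 3 _)))

  opaque
    -- Counting flags by classes gives ∑b ≤ 3∑a, counting them by lines gives 3∑a ≤ ∑b; hence each
    -- single inequality is an equality.
    class-balanced : ∀ X → b-class X ≡ 3 * a-class X
    class-balanced X = ∑-tight classes (λ {X} _ → class-inequality X) (≤-trans (≤-reflexive 3∑a)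
      (≤-trans (∑-mono classes λ {L} _ → line-inequality L) (≤-reflexive (sym (∑-flags β))))) (∈-classes X)

  opaque
    line-balanced : ∀ L → 3 * a-line L ≡ b-line L
    line-balanced L = ∑-tight classes (λ {L} _ → line-inequality L) (≤-trans (≤-reflexive (sym (∑-flags β)))
      (≤-trans (∑-mono classes λ {X} _ → class-inequality X) (≤-reflexive 3∑a))) (∈-classes L)

  opaque
    -- If `L` had no α, then `X` would be a β on it, against `line-balanced`. So `L` carries an α,
    -- which fixes its values.
    values-26 : ∀ {X L} → X ∈ on L → n X ≡ 6 → N L ≡ 26 → ∀ {Y} → Y ∈ on L → n Y ≡ 2 ⊎ n Y ≡ 6
    values-26 {X} {L} i n≡6 N≡26 with search (λ Y → alpha? Y L) (on L)
    ... | inj₁ (Y , i′ , n′≡6 , _ , s , z) = AlphaLine.values i′ n′≡6 N≡26 z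
    ... | inj₂ none = contradiction (begin
      1             ≡⟨ sym (β-yes (n≡6 , N≡26 , λ s → n≢0⇒n>0 λ z → none i (n≡6 , N≡26 , s , z))) ⟩
      β X L         ≤⟨ ∑-term (on L) (λ X → β X L) i ⟩
      b-line L      ≡⟨ sym (line-balanced L) ⟩
      3 * a-line L  ≡⟨ cong (3 *_) (∑-zeros (on L) λ j → α-no (none j)) ⟩
      0             ∎) λ ()
      where open ≤-Reasoning

  -- Axes of the classes with six points

  record Hub (X : PG) : Set where
    field
      axis    : PG
      on-axis : axis ∈ on X
      N-axis  : N axis ≡ 22
      pattern-axis : TwoAndRest (w X axis) 0 0 3
      N-other : ∀ {L} → L ∈ on X → L ≢ axis → N L ≡ 26

  opaque
    -- A light class would be an α on some line with N = 26 but have no β, against `class-balanced`.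
    -- In a heavy class a + b = 4 and b = 3a give b = 3; the square bounds are then sharp, and 18 on
    -- the axis means 3,3,0,0.
    hub : ∀ {X} → n X ≡ 6 → Hub X
    hub {X} n≡6 with Six.light-or-heavy n≡6
    ... | inj₁ lt with some-26 (Six.5≤n n≡6)
    ...   | L , j , N≡26 = contradiction (begin
      1            ≡⟨ sym (α-yes (n≡6 , N≡26 , Six.light-zero n≡6 lt j)) ⟩
      α X L        ≤⟨ ∑-term (on X) (α X) j ⟩
      a-class X    ≤⟨ m≤m+n _ _ ⟩
      3 * a-class X ≡⟨ sym (class-balanced X) ⟩
      b-class X    ≡⟨ light-b n≡6 lt ⟩
      0            ∎) λ ()
      where open ≤-Reasoning
    hub {X} n≡6 | inj₂ heavy with search (λ L → 1 ≤? excess X L) (on X)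
    ... | inj₂ none = contradiction (trans (sym heavy) (∑-zeros (on X) λ j → n≤0⇒n≡0 (≤-pred (≰⇒> (none j))))) λ ()
    ... | inj₁ (M , j , 1≤e) = record
      { axis = M ; on-axis = j ; N-axis = N≡22
      ; pattern-axis = Pattern.sum-6-3300 (w X M)
          (λ s → ≤-trans (w≤2+excess (Six.5≤n n≡6) M s) (+-monoʳ-≤ 2 (Six.excess≤1 n≡6 heavy j))) (Six.sum n≡6 M) Q≡18
      ; N-other = λ {L} k L≢M → trans (sym (+-identityʳ (N L)))
          (trans (cong (λ e → N L + 4 * e) {0} (sym (trans (sym (indicator k)) (⟦⟧-no (L ≟P M) L≢M)))) (Six.heavy-N n≡6 heavy k)) }
      where
      e≡1 : excess X M ≡ 1
      e≡1 = ≤-antisym (Six.excess≤1 n≡6 heavy j) 1≤e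
      N≡22 : N M ≡ 22
      N≡22 = +-cancelʳ-≡ 4 _ _ (trans (cong (λ e → N M + 4 * e) {1} (sym e≡1)) (Six.heavy-N n≡6 heavy j))
      -- The total excess 1 is used up by `M`.
      indicator : ∀ {L} → L ∈ on X → ⟦ L ≟P M ⟧ ≡ excess X L
      indicator = ∑-tight (on X) (λ {L} k → bound L) (≤-reflexive (trans heavy (sym (on-once j))))
        where
        bound : ∀ L → ⟦ L ≟P M ⟧ ≤ excess X L
        bound L with L ≟P M
        ... | yes refl = 1≤e
        ... | no _     = z≤n
      b≡3 : b-class X ≡ 3
      b≡3 = solution (HeavyClass.a+b n≡6 heavy) (class-balanced X)
        where
        solution : ∀ {a b} → a + b ≡ 4 → b ≡ 3 * a → b ≡ 3
        solution {a} eq refl = cong (3 *_) {a} {1} (*-cancelˡ-≡ a 1 4 eq)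
      Q≡18 : Q X M ≡ 18
      Q≡18 = trans (sym (+-identityʳ (Q X M))) (trans
        (cong (λ b → Q X M + 2 * b) {0} (sym (β-no λ (_ , eq , _) → contradiction (trans (sym N≡22) eq) λ ())))
        (trans (HeavyClass.squares-tight n≡6 heavy b≡3 j) (cong (λ e → 12 + 6 * e) {excess X M} {1} e≡1)))

  opaque
    unique-line : ∀ {X Y L M} → X ∈ on L → Y ∈ on L → X ∈ on M → Y ∈ on M → X ≢ Y → L ≡ M
    unique-line {X} {Y} {L} {M} XL YL XM YM X≢Y with L ≟P M
    ... | yes eq = eq
    ... | no L≢M = contradiction (begin
      2
        ≡⟨ cong₂ _+_ (sym (on-once (on-sym XL))) (sym (on-once (on-sym XM))) ⟩
      ∑[ K ← on X ] ⟦ K ≟P L ⟧ + ∑[ K ← on X ] ⟦ K ≟P M ⟧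
        ≡⟨ sym (∑-+ (on X) _ _) ⟩
      ∑[ K ← on X ] (⟦ K ≟P L ⟧ + ⟦ K ≟P M ⟧)
        ≤⟨ ∑-mono (on X) (λ {K} _ → bound K) ⟩
      ∑[ K ← on X ] multiplicityP (on K) Y
        ≡⟨ trans (joining X Y) (cong (λ k → 1 + 4 * k) {⟦ X ≟P Y ⟧} (⟦⟧-no (X ≟P Y) X≢Y)) ⟩
      1 ∎) (from-no (2 ≤? 1))
      where
      open ≤-Reasoning
      bound : ∀ K → ⟦ K ≟P L ⟧ + ⟦ K ≟P M ⟧ ≤ multiplicityP (on K) Y
      bound K with K ≟P L | K ≟P M
      ... | yes refl | yes refl = contradiction refl L≢M
      ... | yes refl | no _     = ≤-reflexive (sym (on-once YL))
      ... | no _     | yes refl = ≤-reflexive (sym (on-once YM))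
      ... | no _     | no _     = z≤n

  opaque
    joined : ∀ X Y → ∃ λ L → L ∈ on X × Y ∈ on L
    joined X Y with search (λ L → 1 ≤? multiplicityP (on L) Y) (on X)
    ... | inj₁ (L , j , pos) = L , j , Multiplicity.multiplicity-pos _≟P_ (on L) pos
    ... | inj₂ none = contradiction (trans (sym (joining X Y)) (∑-zeros (on X) λ j → n≤0⇒n≡0 (≤-pred (≰⇒> (none j))))) λ ()

  opaque
    -- The line joining `X` to `Y` is not the axis, so it has N = 26.
    off-axis : ∀ {X} → n X ≡ 6 → (h : Hub X) → ∀ {Y} → ¬ Y ∈ on (Hub.axis h) → n Y ≡ 2 ⊎ n Y ≡ 6
    off-axis {X} n≡6 h {Y} Y∉axis with joined X Y
    ... | L , j , Y∈L = values-26 (on-sym j) n≡6 (Hub.N-other h j λ { refl → Y∉axis Y∈L }) Y∈L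

  opaque
    another-six : ∀ {X L} → X ∈ on L → n X ≡ 6 → N L ≡ 26 → ∃ λ Y → Y ∈ on L × n Y ≡ 6 × Y ≢ X
    another-six {X} {L} i n≡6 N≡26 with search (λ Y → (n Y ≟ℕ 6) ×-dec ¬? (Y ≟P X)) (on L)
    ... | inj₁ found = found
    ... | inj₂ none  = contradiction (≤-trans (≤-reflexive (sym N≡26)) (≤-trans (∑-mono (on L) λ {Y} j → small Y j)
      (≤-reflexive (trans (∑-+ (on L) (λ _ → 2) _) (cong₂ _+_ (∑-on-const L 2) (trans (∑-*ˡ (on L) 4 _) (cong (4 *_) (on-once i)))))))) (from-no (26 ≤? 14))
      where
      small : ∀ Y → Y ∈ on L → n Y ≤ 2 + 4 * ⟦ Y ≟P X ⟧
      small Y j with Y ≟P X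
      ... | yes refl = ≤-reflexive n≡6
      ... | no Y≢X with values-26 i n≡6 N≡26 j
      ...   | inj₁ n≡2  = ≤-reflexive n≡2
      ...   | inj₂ n′≡6 = contradiction (n′≡6 , Y≢X) (none j)

  opaque
    -- Take a second six on a line `L` through `X` other than the axis; an axis common to both would
    -- have to be `L`.
    two-hubs : ∃ λ X → ∃ λ X′ → n X ≡ 6 × n X′ ≡ 6 × Σ (Hub X) λ h → Σ (Hub X′) λ h′ → Hub.axis h ≢ Hub.axis h′
    two-hubs with some-six
    ... | X , n≡6 with hub n≡6
    ...   | h with another (Hub.on-axis h)
    ...     | L , j , L≢M with another-six (on-sym j) n≡6 (Hub.N-other h j L≢M)
    ...       | X′ , i , n′≡6 , X′≢X = X , X′ , n≡6 , n′≡6 , h , hub n′≡6 , λ eq →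
      L≢M (unique-line (on-sym j) i (on-sym (Hub.on-axis h))
        (subst (λ M → X′ ∈ on M) (sym eq) (on-sym (Hub.on-axis (hub n′≡6)))) (X′≢X ∘ sym))

  module Axis {M : PG} (N≡22 : N M ≡ 22) (values : ∀ {Y} → Y ∈ on M → n Y ≡ 2 ⊎ n Y ≡ 6)
    {X : PG} (i : X ∈ on M) (n≡6 : n X ≡ 6) where

    opaque
      -- 22 = 5 · 2 + 4 · 3.
      six-count : ∑[ Y ← on M ] ⟦ n Y ≟ℕ 6 ⟧ ≡ 3
      six-count = *-cancelˡ-≡ _ 3 4 (+-cancelˡ-≡ 10 _ _ (trans (sym (trans (∑-+ (on M) (λ _ → 2) _)
        (cong₂ _+_ (∑-on-const M 2) (∑-*ˡ (on M) 4 _)))) (trans (sym (∑-cong (on M) λ {Y} j → value Y (values j))) N≡22)))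
        where
        value : ∀ Y → n Y ≡ 2 ⊎ n Y ≡ 6 → n Y ≡ 2 + 4 * ⟦ n Y ≟ℕ 6 ⟧
        value Y (inj₁ eq) = trans eq (cong (λ k → 2 + 4 * k) {0} (sym (⟦⟧-no (n Y ≟ℕ 6) λ six → contradiction (trans (sym eq) six) λ ())))
        value Y (inj₂ eq) = trans eq (cong (λ k → 2 + 4 * k) {1} (sym (⟦⟧-yes (n Y ≟ℕ 6) eq)))

    opaque
      second : ∃ λ Y → Y ∈ on M × n Y ≡ 6 × Y ≢ X
      second with search (λ Y → (n Y ≟ℕ 6) ×-dec ¬? (Y ≟P X)) (on M)
      ... | inj₁ found = found
      ... | inj₂ none  = contradiction (≤-trans (≤-reflexive (sym six-count))
        (≤-trans (∑-mono (on M) λ {Y} j → bound Y j) (≤-reflexive (on-once i)))) (from-no (3 ≤? 1))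
        where
        bound : ∀ Y → Y ∈ on M → ⟦ n Y ≟ℕ 6 ⟧ ≤ ⟦ Y ≟P X ⟧
        bound Y j with Y ≟P X
        ... | yes refl = ⟦⟧≤1 (n Y ≟ℕ 6)
        ... | no Y≢X   = ≤-reflexive (⟦⟧-no (n Y ≟ℕ 6) λ six → none j (six , Y≢X))

    opaque
      third : ∀ {Z} → Z ∈ on M → ∃ λ Y → Y ∈ on M × n Y ≡ 6 × Y ≢ X × Y ≢ Z
      third {Z} k with search (λ Y → (n Y ≟ℕ 6) ×-dec (¬? (Y ≟P X) ×-dec ¬? (Y ≟P Z))) (on M)
      ... | inj₁ found = found
      ... | inj₂ none  = contradiction (≤-trans (≤-reflexive (sym six-count)) (≤-trans (∑-mono (on M) λ {Y} j → bound Y j)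
        (≤-reflexive (trans (∑-+ (on M) _ _) (cong₂ _+_ (on-once i) (on-once k)))))) (from-no (3 ≤? 2))
        where
        bound : ∀ Y → Y ∈ on M → ⟦ n Y ≟ℕ 6 ⟧ ≤ ⟦ Y ≟P X ⟧ + ⟦ Y ≟P Z ⟧
        bound Y j with Y ≟P X | Y ≟P Z
        ... | yes _  | _      = ≤-trans (⟦⟧≤1 (n Y ≟ℕ 6)) (s≤s z≤n)
        ... | no _   | yes _  = ⟦⟧≤1 (n Y ≟ℕ 6)
        ... | no Y≢X | no Y≢Z = ≤-reflexive (⟦⟧-no (n Y ≟ℕ 6) λ six → none j (six , Y≢X , Y≢Z))

    opaque
      two : ∃ λ Y → Y ∈ on M × n Y ≡ 2
      two with search (λ Y → n Y ≟ℕ 2) (on M)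
      ... | inj₁ found = found
      ... | inj₂ none  = contradiction (trans (sym N≡22) (trans (∑-cong (on M) λ j → six (none j) (values j)) (∑-on-const M 6))) λ ()
        where
        six : ∀ {k} → k ≢ 2 → k ≡ 2 ⊎ k ≡ 6 → k ≡ 6
        six k≢2 (inj₁ eq) = contradiction eq k≢2
        six _   (inj₂ eq) = eq

    opaque
      -- `M` is the axis of every six on it, since the other lines through that class have N = 26.
      pattern-at : ∀ {Y} → Y ∈ on M → n Y ≡ 6 → TwoAndRest (w Y M) 0 0 3
      pattern-at {Y} j six with hub six
      ... | h with M ≟P Hub.axis h
      ...   | yes refl = Hub.pattern-axis h
      ...   | no M≢    = contradiction (trans (sym N≡22) (Hub.N-other h (on-sym j) M≢)) λ ()

    opaque
      impossible : ⊥
      impossible with second | two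
      ... | Y , j , six , Y≢X | T , l , n≡2 with third j
      ...   | Z , k , six′ , Z≢X , Z≢Y =
        Line22.three-sixes N≡22 i j k l (Y≢X ∘ sym) (Z≢X ∘ sym) (Z≢Y ∘ sym) n≡6 six six′ n≡2
          (pattern-at i n≡6) (pattern-at j six) (pattern-at k six′)

  -- If all values on the axis but one are ≡ 2 (mod 4), then so is the last, as their sum is 22.
  opaque
    last-value : ∀ {M Z} → N M ≡ 22 → Z ∈ on M → (∀ {Y} → Y ∈ on M → Y ≢ Z → n Y ≡ 2 ⊎ n Y ≡ 6) → n Z ≡ 2 ⊎ n Z ≡ 6
    last-value {M} {Z} N≡22 k others = check (s≤s (n≤6 Z)) (begin
      n Z % 4                          ≡⟨ sym ([m+kn]%n≡m%n (n Z) (2 + δ) 4) ⟩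
      (n Z + (2 + δ) * 4) % 4          ≡⟨ cong (_% 4) {n Z + (2 + δ) * 4} {22} (trans (cong (λ k → n Z + k) (*-comm (2 + δ) 4)) (trans (shuffle (n Z) δ) count)) ⟩
      2                                ∎)
      where
      open ≡-Reasoning
      check : ∀ {k} → k < 7 → k % 4 ≡ 2 → k ≡ 2 ⊎ k ≡ 6
      check = from-yes (allUpTo? (λ k → (k % 4 ≟ℕ 2) →-dec ((k ≟ℕ 2) ⊎-dec (k ≟ℕ 6))) 7)
      δ : ℕ
      δ = ∑[ Y ← on M ] (⟦ ¬? (Y ≟P Z) ⟧ * ⟦ n Y ≟ℕ 6 ⟧)
      shuffle : ∀ a δ → a + 4 * (2 + δ) ≡ 8 + 4 * δ + a
      shuffle = solve-∀
      -- The extra 2 at `Z` gives all five terms the same constant 2, so that 10 + 4δ + n Z = 24.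
      value : ∀ Y → Y ∈ on M → n Y + 2 * ⟦ Y ≟P Z ⟧ ≡ 2 + 4 * (⟦ ¬? (Y ≟P Z) ⟧ * ⟦ n Y ≟ℕ 6 ⟧) + ⟦ Y ≟P Z ⟧ * n Z
      value Y j with Y ≟P Z
      ... | yes refl = trans (+-comm (n Z) 2) (cong (2 +_) (sym (*-identityˡ (n Z))))
      ... | no Y≢Z   = cong (_+ 0) (by (others j Y≢Z))
        where
        by : n Y ≡ 2 ⊎ n Y ≡ 6 → n Y ≡ 2 + 4 * (1 * ⟦ n Y ≟ℕ 6 ⟧)
        by (inj₁ eq) = trans eq (cong (λ k → 2 + 4 * (1 * k)) {0} (sym (⟦⟧-no (n Y ≟ℕ 6) λ six → contradiction (trans (sym eq) six) λ ())))
        by (inj₂ eq) = trans eq (cong (λ k → 2 + 4 * (1 * k)) {1} (sym (⟦⟧-yes (n Y ≟ℕ 6) eq)))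
      once : ∀ k′ → ∑[ Y ← on M ] (⟦ Y ≟P Z ⟧ * k′) ≡ k′
      once k′ = Multiplicity.∑-pick₁ _≟P_ (on M) (λ _ → k′) (on-once k)
      count : 8 + 4 * δ + n Z ≡ 22
      count = +-cancelʳ-≡ 2 _ _ (trans (shuffle′ δ (n Z)) (sym (begin
        24
          ≡⟨ cong₂ _+_ (sym N≡22) (cong (2 *_) {1} (sym (on-once k))) ⟩
        N M + 2 * multiplicityP (on M) Z
          ≡⟨ cong (N M +_) (sym (∑-*ˡ (on M) 2 _)) ⟩
        N M + ∑[ Y ← on M ] (2 * ⟦ Y ≟P Z ⟧)
          ≡⟨ sym (∑-+ (on M) n _) ⟩
        ∑[ Y ← on M ] (n Y + 2 * ⟦ Y ≟P Z ⟧)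
          ≡⟨ ∑-cong (on M) (λ {Y} j → value Y j) ⟩
        ∑[ Y ← on M ] (2 + 4 * (⟦ ¬? (Y ≟P Z) ⟧ * ⟦ n Y ≟ℕ 6 ⟧) + ⟦ Y ≟P Z ⟧ * n Z)
          ≡⟨ trans (∑-+ (on M) (λ Y → 2 + 4 * (⟦ ¬? (Y ≟P Z) ⟧ * ⟦ n Y ≟ℕ 6 ⟧)) _)
               (cong₂ _+_ (trans (∑-+ (on M) (λ _ → 2) _) (cong₂ _+_ (∑-on-const M 2) (∑-*ˡ (on M) 4 _))) (once (n Z))) ⟩
        10 + 4 * δ + n Z ∎)))
        where
        shuffle′ : ∀ δ a → 8 + 4 * δ + a + 2 ≡ 10 + 4 * δ + a
        shuffle′ = solve-∀

  opaque
    -- Classes on `M` off the other axis `M′` have size 2 or 6 by `off-axis`; two axes share only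
    -- one class, and `last-value` settles it.
    contradictory : ⊥
    contradictory with two-hubs
    ... | X , X′ , n≡6 , n′≡6 , h , h′ , M≢M′ =
      Axis.impossible (Hub.N-axis h) axis-values (on-sym (Hub.on-axis h)) n≡6
      where
      M M′ : PG
      M  = Hub.axis h
      M′ = Hub.axis h′
      off : ∀ {Y} → ¬ Y ∈ on M′ → n Y ≡ 2 ⊎ n Y ≡ 6
      off = off-axis n′≡6 h′
      axis-values : ∀ {Y} → Y ∈ on M → n Y ≡ 2 ⊎ n Y ≡ 6
      axis-values {Z} k with dot Z M′ ≟F 0F
      ... | no ≢0 = off (≢0 ∘ ∈-on⁻)
      ... | yes ≡0 = last-value (Hub.N-axis h) k λ {Y} j Y≢Z → off λ Y∈M′ → M≢M′ (unique-line j k Y∈M′ (∈-on⁺ ≡0) Y≢Z)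

-- Coordinates over chain rings

place : PG → U → F × F × F
place [1∶ _ ∶ _ ] (x , y) = 0F , x , y
place [0∶1∶ _ ]   (x , y) = x , 0F , y
place [0∶0∶1]     (x , y) = x , y , 0F

⊕-cancelʳ : ∀ a b c → a ⊕ c ≡ b ⊕ c → a ≡ b
⊕-cancelʳ = from-yes (allF? λ a → allF? λ b → allF? λ c → ((a ⊕ c) ≟F (b ⊕ c)) →-dec (a ≟F b))

module Vectors (R : FiniteRing) where
  open FiniteRing R using (Carrier) renaming (_+_ to _⊞_; _*_ to _⊠_)
  open RightModule (R³ R) using (Carrierᴹ)

  -- The coefficients of the line stand on the left, so that the solutions in the second argument
  -- form a right submodule.
  pairing : Carrierᴹ → Carrierᴹ → Carrier
  pairing (a , b , c) (x , y , z) = (a ⊠ x) ⊞ ((b ⊠ y) ⊞ (c ⊠ z))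

  vector : (τ δ : F → Carrier) → PG → U → Carrierᴹ
  vector τ δ X u = let (x , y , z) = coordinates X ; (p , q , r) = place X u in τ x ⊞ δ p , τ y ⊞ δ q , τ z ⊞ δ r

-- Every element of R is τ a + δ b for its residue a, and the δ b form the radical. The class
-- of a point is its image X in PG(2,4), and u holds the δ-parts of the coordinates other than
-- the leading 1; likewise for lines, up to σ. For X on L the equation of the line in the point
-- reduces to seg X L u ≡ lin L X v, where κ is the carry of the sum of the three products.
record Coordinates (R : FiniteRing) : Set where
  open FiniteRing R using (Carrier; 0#; 1#) renaming (_+_ to _⊞_; _*_ to _⊠_)
  open Vectors R public
  field
    τ δ : F → Carrier
    σ   : F → F
    κ   : PG → PG → F

  point : PG → U → _
  point = vector τ δ

  line : PG → U → _
  line = vector τ (δ ∘ σ)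

  seg : PG → PG → U → F
  seg X L u = σ (lin X L u ⊕ κ X L)

  field
    τ-0 : τ 0F ≡ 0#
    τ-1 : τ 1F ≡ 1#
    δ-0 : δ 0F ≡ 0#
    σ-0 : σ 0F ≡ 0F
    σ-injective  : ∀ a b → σ a ≡ σ b → a ≡ b
    decompose    : ∀ x → ∃ λ a → ∃ λ b → x ≡ τ a ⊞ δ b
    unit-or-δ    : ∀ x → (∃ λ y → (x ⊠ y ≡ 1#) × (y ⊠ x ≡ 1#)) ⊎ (∃ λ b → x ≡ δ b)
    δ-ideal      : ∀ b y → ∃ λ b′ → δ b ⊠ y ≡ δ b′
    δ²           : ∀ b → δ b ⊠ δ 1F ≡ 0#
    δ-1≢0        : δ 1F ≢ 0#
    incidence    : ∀ X L → dot X L ≡ 0F → ∀ u v → seg X L u ≡ lin L X v → pairing (line L v) (point X u) ≡ 0#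

-- From positions of arc points to a distribution

module Counting (seg : PG → PG → U → F)
  (parallel : ∀ X u v → ∑[ L ← on X ] ⟦ seg X L u ≟F seg X L v ⟧ ≡ 1 + 4 * ⟦ u ≟U v ⟧)
  {k} (class : Fin k → PG) (offset : Fin k → U) where

  On : PG → U → Fin k → Set
  On L v i = dot (class i) L ≡ 0F × seg (class i) L (offset i) ≡ lin L (class i) v

  on? : ∀ L v i → Dec (On L v i)
  on? L v i = (dot (class i) L ≟F 0F) ×-dec (seg (class i) L (offset i) ≟F lin L (class i) v)

  module _ (position-injective : ∀ {i j} → class i ≡ class j → offset i ≡ offset j → i ≡ j)
    (on-line-≤7 : ∀ L v → ∑[ i ← allFin k ] ⟦ on? L v i ⟧ ≤ 7) where

    c : PG → U → ℕ
    c X u = ∑[ i ← allFin k ] (⟦ class i ≟P X ⟧ * ⟦ offset i ≟U u ⟧)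

    c≤1 : ∀ X u → c X u ≤ 1
    c≤1 X u = ≤-trans (≤-reflexive (∑-cong (allFin k) λ {i} _ → ⟦×⟧ (class i ≟P X) (offset i ≟U u)))
      (∑-indicator≤1 (λ i → (class i ≟P X) ×-dec (offset i ≟U u))
        λ (p , q) (p′ , q′) → position-injective (trans p (sym p′)) (trans q (sym q′)))

    open Counts seg c

    private
      flip-P : ∀ i X → ⟦ class i ≟P X ⟧ ≡ ⟦ X ≟P class i ⟧
      flip-P i X = ⟦⟧-⇔ (class i ≟P X) (X ≟P class i) sym sym

      flip-U : ∀ i u → ⟦ offset i ≟U u ⟧ ≡ ⟦ u ≟U offset i ⟧
      flip-U i u = ⟦⟧-⇔ (offset i ≟U u) (u ≟U offset i) sym sym

    ∑-weighted : ∀ X (f : U → ℕ) → ∑[ u ← vectors ] (f u * c X u) ≡ ∑[ i ← allFin k ] (⟦ X ≟P class i ⟧ * f (offset i))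
    ∑-weighted X f = begin
      ∑[ u ← vectors ] (f u * c X u)
        ≡⟨ ∑-cong vectors (λ {u} _ → sym (∑-*ˡ (allFin k) (f u) _)) ⟩
      ∑[ u ← vectors ] (∑[ i ← allFin k ] (f u * (⟦ class i ≟P X ⟧ * ⟦ offset i ≟U u ⟧)))
        ≡⟨ ∑-swap vectors (allFin k) _ ⟩
      ∑[ i ← allFin k ] (∑[ u ← vectors ] (f u * (⟦ class i ≟P X ⟧ * ⟦ offset i ≟U u ⟧)))
        ≡⟨ ∑-cong (allFin k) (λ {i} _ → trans (∑-cong vectors λ {u} _ → rearrange i u)
             (trans (∑-*ˡ vectors ⟦ X ≟P class i ⟧ _) (cong (⟦ X ≟P class i ⟧ *_) (Multiplicity.∑-pick₁ _≟U_ vectors f (vectors-once (offset i)))))) ⟩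
      ∑[ i ← allFin k ] (⟦ X ≟P class i ⟧ * f (offset i)) ∎
      where
      open ≡-Reasoning
      rearrange : ∀ i u → f u * (⟦ class i ≟P X ⟧ * ⟦ offset i ≟U u ⟧) ≡ ⟦ X ≟P class i ⟧ * (⟦ u ≟U offset i ⟧ * f u)
      rearrange i u = trans (*-comm (f u) _) (trans (*-assoc ⟦ class i ≟P X ⟧ _ (f u))
        (cong₂ (λ a b → a * (b * f u)) (flip-P i X) (flip-U i u)))

    total : ∑ classes n ≡ k
    total = begin
      ∑[ X ← classes ] (∑[ u ← vectors ] c X u)
        ≡⟨ ∑-cong classes (λ {X} _ → trans (∑-cong vectors λ {u} _ → sym (*-identityˡ (c X u))) (∑-weighted X (λ _ → 1))) ⟩
      ∑[ X ← classes ] (∑[ i ← allFin k ] (⟦ X ≟P class i ⟧ * 1))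
        ≡⟨ ∑-swap classes (allFin k) _ ⟩
      ∑[ i ← allFin k ] (∑[ X ← classes ] (⟦ X ≟P class i ⟧ * 1))
        ≡⟨ ∑-cong (allFin k) (λ {i} _ → Multiplicity.∑-pick₁ _≟P_ classes (λ _ → 1) (classes-once (class i))) ⟩
      ∑[ i ← allFin k ] 1
        ≡⟨ trans (∑-const (allFin k) 1) (trans (*-identityʳ _) (length-tabulate {n = k} id)) ⟩
      k ∎
      where open ≡-Reasoning

    -- After exchanging sums, an arc point contributes only at its own class, so `S L v` counts the
    -- points on one line.
    S≤7 : ∀ L v → S L v ≤ 7
    S≤7 L v = ≤-trans (≤-reflexive (begin
      ∑[ Y ← on L ] w Y L (lin L Y v)
        ≡⟨ ∑-cong (on L) (λ {Y} _ → ∑-weighted Y (λ u → ⟦ seg Y L u ≟F lin L Y v ⟧)) ⟩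
      ∑[ Y ← on L ] (∑[ i ← allFin k ] (⟦ Y ≟P class i ⟧ * ⟦ seg Y L (offset i) ≟F lin L Y v ⟧))
        ≡⟨ ∑-swap (on L) (allFin k) _ ⟩
      ∑[ i ← allFin k ] (∑[ Y ← on L ] (⟦ Y ≟P class i ⟧ * ⟦ seg Y L (offset i) ≟F lin L Y v ⟧))
        ≡⟨ ∑-cong (allFin k) (λ {i} _ → collect i) ⟩
      ∑[ i ← allFin k ] ⟦ on? L v i ⟧ ∎)) (on-line-≤7 L v)
      where
      open ≡-Reasoning
      collect : ∀ i → ∑[ Y ← on L ] (⟦ Y ≟P class i ⟧ * ⟦ seg Y L (offset i) ≟F lin L Y v ⟧) ≡ ⟦ on? L v i ⟧
      collect i = begin
        ∑[ Y ← on L ] (⟦ Y ≟P class i ⟧ * g Y)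
          ≡⟨ on-filter L _ ⟩
        ∑[ Y ← classes ] (⟦ dot Y L ≟F 0F ⟧ * (⟦ Y ≟P class i ⟧ * g Y))
          ≡⟨ ∑-cong classes (λ {Y} _ → x∙yz≈y∙xz ⟦ dot Y L ≟F 0F ⟧ ⟦ Y ≟P class i ⟧ (g Y)) ⟩
        ∑[ Y ← classes ] (⟦ Y ≟P class i ⟧ * (⟦ dot Y L ≟F 0F ⟧ * g Y))
          ≡⟨ Multiplicity.∑-pick₁ _≟P_ classes (λ Y → ⟦ dot Y L ≟F 0F ⟧ * g Y) (classes-once (class i)) ⟩
        ⟦ dot (class i) L ≟F 0F ⟧ * g (class i)
          ≡⟨ ⟦×⟧ (dot (class i) L ≟F 0F) (seg (class i) L (offset i) ≟F lin L (class i) v) ⟩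
        ⟦ on? L v i ⟧ ∎
        where
        open import Algebra.Properties.CommutativeSemigroup *-commutativeSemigroup using (x∙yz≈y∙xz)
        g : PG → ℕ
        g Y = ⟦ seg Y L (offset i) ≟F lin L Y v ⟧

    size-≤101 : k ≤ 101
    size-≤101 = ≮⇒≥ λ 102≤k → Overfull.contradictory (Local.distribution seg parallel c c≤1 S≤7)
      (≤-trans 102≤k (≤-reflexive (sym total)))

-- Lines as kernels of linear forms

module Kernel (R : FiniteRing) where
  open FiniteRing R using (Carrier; 0#; 1#; ring) renaming (_+_ to _⊞_; _*_ to _⊠_; -_ to ⊟_)
  open RightModule (R³ R) using (Carrierᴹ)
  open Vectors R
  open Span (R³ R) using (span)
  open Submodule using (Member)
  private module ℛ = Ring ring
  open Algebra.Properties.Group ℛ.+-group using (inverseˡ-unique)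
  open Algebra.Properties.Ring ring using (-‿distribˡ-*; -‿+-comm)
  open import Algebra.Properties.CommutativeSemigroup ℛ.+-commutativeSemigroup using (x∙yz≈y∙xz)

  private
    first : ∀ s t → (1# ⊠ s) ⊞ ((0# ⊠ t) ⊞ 0#) ≡ s
    first s t = trans (cong₂ _⊞_ (ℛ.*-identityˡ s) (trans (ℛ.+-identityʳ _) (ℛ.zeroˡ t))) (ℛ.+-identityʳ s)

    second : ∀ s t → (0# ⊠ s) ⊞ ((1# ⊠ t) ⊞ 0#) ≡ t
    second s t = trans (cong₂ _⊞_ (ℛ.zeroˡ s) (trans (ℛ.+-identityʳ _) (ℛ.*-identityˡ t))) (ℛ.+-identityˡ t)

    solved : ∀ {x} a y b z → x ⊞ ((a ⊠ y) ⊞ (b ⊠ z)) ≡ 0# → x ≡ ((⊟ a) ⊠ y) ⊞ (((⊟ b) ⊠ z) ⊞ 0#)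
    solved {x} a y b z eq = trans (inverseˡ-unique x _ eq) (trans (sym (-‿+-comm (a ⊠ y) (b ⊠ z)))
      (cong₂ _⊞_ (-‿distribˡ-* a y) (trans (-‿distribˡ-* b z) (sym (ℛ.+-identityʳ _)))))

  -- Coordinates describe lines by equations, `Good` by bases; this passes from the former to the
  -- latter.
  record Spanned (u : Carrierᴹ) : Set where
    field
      basis       : Vec Carrierᴹ 2
      independent : Independent (R³ R) basis
      kernel      : ∀ x → pairing u x ≡ 0# → Member (span basis) x

  -- The equation is solved for the coordinate with coefficient 1, and the other two are free
  -- parameters.
  kernel₀ : ∀ b c → Spanned (1# , b , c)
  kernel₀ b c = record
    { basis       = (⊟ b , 1# , 0#) ∷ (⊟ c , 0# , 1#) ∷ []
    ; independent = λ { (s ∷ t ∷ []) (_ , p , q) → trans (sym (first s t)) p ∷ trans (sym (second s t)) q ∷ [] }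
    ; kernel      = λ (x , y , z) eq → y ∷ z ∷ [] ,
        solved b y c z (trans (cong (_⊞ _) (sym (ℛ.*-identityˡ x))) eq) , sym (first y z) , sym (second y z)
    }

  kernel₁ : ∀ a c → Spanned (a , 1# , c)
  kernel₁ a c = record
    { basis       = (1# , ⊟ a , 0#) ∷ (0# , ⊟ c , 1#) ∷ []
    ; independent = λ { (s ∷ t ∷ []) (p , _ , q) → trans (sym (first s t)) p ∷ trans (sym (second s t)) q ∷ [] }
    ; kernel      = λ (x , y , z) eq → x ∷ z ∷ [] , sym (first x z) ,
        solved a x c z (trans (trans (cong (_⊞ _) (sym (ℛ.*-identityˡ y))) (x∙yz≈y∙xz (1# ⊠ y) (a ⊠ x) (c ⊠ z))) eq) , sym (second x z)
    }

  kernel₂ : ∀ a b → Spanned (a , b , 1#)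
  kernel₂ a b = record
    { basis       = (1# , 0# , ⊟ a) ∷ (0# , 1# , ⊟ b) ∷ []
    ; independent = λ { (s ∷ t ∷ []) (p , q , _) → trans (sym (first s t)) p ∷ trans (sym (second s t)) q ∷ [] }
    ; kernel      = λ (x , y , z) eq → x ∷ y ∷ [] , sym (first x y) , sym (second x y) ,
        solved a x b y (trans (trans (cong (_⊞ _) (sym (ℛ.*-identityˡ z))) (trans (ℛ.+-comm _ _) (ℛ.+-assoc (a ⊠ x) (b ⊠ y) (1# ⊠ z)))) eq)
    }

-- The bound for a coordinatised ring

module Bound (R : FiniteRing) (coordinatisation : Coordinates R) where
  open FiniteRing R using (Carrier; 0#; 1#; ring) renaming (_+_ to _⊞_; _*_ to _⊠_)
  open Coordinates coordinatisation
  open RightModule (R³ R) using (Carrierᴹ; _*ᵣ_; ≈ᴹ-sym)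
  open Search R using (⟨_⟩; Good; _⊑_; arc⇒good)
  open Span (R³ R) using (span; comb-member)
  open Submodule using (Member; resp; *ᵣ-closed)
  private module ℛ = Ring ring
  open Kernel R

  -- Translation by the carry and the injection `σ` preserve and reflect equality, which reduces
  -- this to `lin-parallel`.
  parallel : ∀ X u v → ∑[ L ← on X ] ⟦ seg X L u ≟F seg X L v ⟧ ≡ 1 + 4 * ⟦ u ≟U v ⟧
  parallel X u v = trans (∑-cong (on X) λ {L} _ → ⟦⟧-⇔ (seg X L u ≟F seg X L v) (lin X L u ≟F lin X L v)
    (λ eq → ⊕-cancelʳ _ _ (κ X L) (σ-injective _ _ eq)) (cong (λ t → σ (t ⊕ κ X L)))) (lin-parallel X u v)

  line-kernel : ∀ L v → Spanned (line L v)
  line-kernel [1∶ a ∶ b ] (x , y) rewrite σ-0 | δ-0 | τ-1 | ℛ.+-identityʳ 1# = kernel₀ _ _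
  line-kernel [0∶1∶ b ]   (x , y) rewrite σ-0 | δ-0 | τ-1 | ℛ.+-identityʳ 1# = kernel₁ _ _
  line-kernel [0∶0∶1]     (x , y) rewrite σ-0 | δ-0 | τ-1 | ℛ.+-identityʳ 1# = kernel₂ _ _

  record Normalised (v : Carrierᴹ) : Set where
    field
      X    : PG
      u    : U
      r r′ : Carrier
      from-point : v ≡ point X u *ᵣ r
      to-point   : point X u ≡ v *ᵣ r′

  private
    back : ∀ {x y} k → y ⊠ x ≡ 1# → k ≡ (k ⊠ y) ⊠ x
    back {x} {y} k eq = sym (trans (ℛ.*-assoc k y x) (trans (cong (k ⊠_) eq) (ℛ.*-identityʳ k)))

    triple : ∀ {a b c a′ b′ c′ : Carrier} → a ≡ a′ → b ≡ b′ → c ≡ c′ → (Carrierᴹ ∋ (a , b , c)) ≡ (a′ , b′ , c′)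
    triple refl refl refl = refl

    scaled : ∀ {v : Carrierᴹ} X u {x y} → y ⊠ x ≡ 1# → v *ᵣ y ≡ point X u → Normalised v
    scaled {v} X u {x} {y} yx eq = record
      { X = X ; u = u ; r = x ; r′ = y
      ; from-point = trans (triple (back _ yx) (back _ yx) (back _ yx)) (cong (_*ᵣ x) eq)
      ; to-point   = sym eq }

    unit-entry : 1# ≡ τ 1F ⊞ δ 0F
    unit-entry = sym (trans (cong₂ _⊞_ τ-1 δ-0) (ℛ.+-identityʳ 1#))

    δ-entry : ∀ b → δ b ≡ τ 0F ⊞ δ b
    δ-entry b = sym (trans (cong (_⊞ δ b) τ-0) (ℛ.+-identityˡ (δ b)))

  -- Scale from the right so that the first unit coordinate becomes 1. If no coordinate were a unit,
  -- all would lie in the radical, and the nonzero element `δ 1F` would annihilate `v`, against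
  -- independence.
  normalise : ∀ v → Independent (R³ R) (v ∷ []) → Normalised v
  normalise (x , y , z) ind with unit-or-δ x
  ... | inj₁ (x′ , xx′ , x′x) with decompose (y ⊠ x′) | decompose (z ⊠ x′)
  ...   | a , p , ya | b , q , zb = scaled [1∶ a ∶ b ] (p , q) x′x (triple (trans xx′ unit-entry) ya zb)
  normalise (x , y , z) ind | inj₂ (b₀ , x≡δ) with unit-or-δ y
  ... | inj₁ (y′ , yy′ , y′y) with δ-ideal b₀ y′ | decompose (z ⊠ y′)
  ...   | p , xp | b , q , zb = scaled [0∶1∶ b ] (p , q) y′y
    (triple (trans (cong (_⊠ y′) x≡δ) (trans xp (δ-entry p))) (trans yy′ unit-entry) zb)
  normalise (x , y , z) ind | inj₂ (b₀ , x≡δ) | inj₂ (b₁ , y≡δ) with unit-or-δ z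
  ... | inj₁ (z′ , zz′ , z′z) with δ-ideal b₀ z′ | δ-ideal b₁ z′
  ...   | p , xp | q , yq = scaled [0∶0∶1] (p , q) z′z
    (triple (trans (cong (_⊠ z′) x≡δ) (trans xp (δ-entry p))) (trans (cong (_⊠ z′) y≡δ) (trans yq (δ-entry q))) (trans zz′ unit-entry))
  normalise (x , y , z) ind | inj₂ (b₀ , x≡δ) | inj₂ (b₁ , y≡δ) | inj₂ (b₂ , z≡δ)
    with ind (δ 1F ∷ []) (annihilated x≡δ , annihilated y≡δ , annihilated z≡δ)
    where
    annihilated : ∀ {x b} → x ≡ δ b → (x ⊠ δ 1F) ⊞ 0# ≡ 0#
    annihilated {b = b} eq = trans (ℛ.+-identityʳ _) (trans (cong (_⊠ δ 1F) eq) (δ² b))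
  ... | δ≡0 ∷ [] = contradiction δ≡0 δ-1≢0

  ⟨⟩-⊑ : ∀ {v} (N : Submodule (R³ R)) → Member N v → ⟨ v ⟩ ⊑ N
  ⟨⟩-⊑ N p x (a ∷ [] , eq) = resp N (≈ᴹ-sym eq) (comb-member N (p ∷ []) (a ∷ []))

  generator : ∀ v → Member ⟨ v ⟩ v
  generator v with Span.span-members (R³ R) (v ∷ [])
  ... | p ∷ [] = p

  module _ {k} (vs : Vec Carrierᴹ k) (good : Good 7 vs) where

    private
      nf : ∀ i → Normalised (lookup vs i)
      nf i = normalise (lookup vs i) (proj₁ good i)

      module NF i = Normalised (nf i)

    class : Fin k → PG
    class = NF.X

    offset : Fin k → U
    offset = NF.u

    -- Both generators are right multiples of the same normalised vector, and that vector is a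
    -- multiple of each.
    position-⊑ : ∀ i j → class i ≡ class j → offset i ≡ offset j → ⟨ lookup vs i ⟩ ⊑ ⟨ lookup vs j ⟩
    position-⊑ i j eq eq′ = ⟨⟩-⊑ ⟨ lookup vs j ⟩ (subst (Member ⟨ lookup vs j ⟩)
      (sym (trans (NF.from-point i) (cong (_*ᵣ NF.r i) (trans (cong₂ point eq eq′) (NF.to-point j)))))
      (*ᵣ-closed ⟨ lookup vs j ⟩ (NF.r i) (*ᵣ-closed ⟨ lookup vs j ⟩ (NF.r′ j) (generator (lookup vs j)))))

    position-injective : ∀ {i j} → class i ≡ class j → offset i ≡ offset j → i ≡ j
    position-injective {i} {j} eq eq′ = proj₁ (proj₂ good) i j (position-⊑ i j eq eq′ , position-⊑ j i (sym eq) (sym eq′))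

    open Counting seg parallel class offset using (On; on?; size-≤101)

    on-line-≤7 : ∀ L v → ∑[ i ← allFin k ] ⟦ on? L v i ⟧ ≤ 7
    on-line-≤7 L v = ≤-trans (≤-reflexive (sym (∣tabulate∣ (on? L v))))
      (proj₂ (proj₂ good) basis independent (Vec.tabulate λ i → does (on? L v i)) λ i i∈S → contained i (∈-tabulate⁻ (on? L v) i i∈S))
      where
      open Spanned (line-kernel L v)
      contained : ∀ i → On L v i → ⟨ lookup vs i ⟩ ⊑ span basis
      contained i (d≡0 , eq) = ⟨⟩-⊑ (span basis) (subst (Member (span basis)) (sym (NF.from-point i))
        (*ᵣ-closed (span basis) {point (class i) (offset i)} (NF.r i)
          (kernel _ (incidence (class i) L d≡0 (offset i) v eq))))

    good-≤101 : k ≤ 101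
    good-≤101 = size-≤101 position-injective on-line-≤7

  m₇≤101 : m 7 R ≤ 101
  m₇≤101 with arc⇒good (proj₁ (m-isLargest 7 R))
  ... | vs , good = good-≤101 vs good

-- Verification for the three rings

module Decide (A : FiniteRawRing) (laws : FiniteRawRing.Laws A)
  (τ δ : F → FiniteRawRing.Carrier A) (σ : F → F) (κ : PG → PG → F) where
  open FiniteRawRing A using (0#; 1#; omni; _≟_; finiteRing) renaming (_+_ to _⊞_; _*_ to _⊠_)
  R = finiteRing laws
  open Vectors R

  Structure : Set
  Structure = (τ 0F ≡ 0# × τ 1F ≡ 1# × δ 0F ≡ 0# × σ 0F ≡ 0F × ¬ (δ 1F ≡ 0#)) ×
    (∀ a b → σ a ≡ σ b → a ≡ b) ×
    (∀ x → ∃ λ a → ∃ λ b → x ≡ τ a ⊞ δ b) ×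
    (∀ x → (∃ λ y → (x ⊠ y ≡ 1#) × (y ⊠ x ≡ 1#)) ⊎ (∃ λ b → x ≡ δ b)) ×
    (∀ b y → ∃ λ b′ → δ b ⊠ y ≡ δ b′) ×
    (∀ b → δ b ⊠ δ 1F ≡ 0#)

  structure? : Dec Structure
  structure? = ((_ ≟ _) ×-dec ((_ ≟ _) ×-dec ((_ ≟ _) ×-dec ((_ ≟F _) ×-dec ¬? (_ ≟ _))))) ×-dec
    (allF? (λ a → allF? λ b → (σ a ≟F σ b) →-dec (a ≟F b)) ×-dec
    (forall? omni (λ x → anyF? λ a → anyF? λ b → x ≟ (τ a ⊞ δ b)) ×-dec
    (forall? omni (λ x → omni (λ y → ((x ⊠ y) ≟ 1#) ×-dec ((y ⊠ x) ≟ 1#)) ⊎-dec anyF? λ b → x ≟ δ b) ×-dec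
    (allF? (λ b → forall? omni λ y → anyF? λ b′ → (δ b ⊠ y) ≟ δ b′) ×-dec
    allF? λ b → (δ b ⊠ δ 1F) ≟ 0#))))

  -- Products of two δ-parts vanish, so the pairing consists of the product of the residue lifts and
  -- two linear forms in `u` and `v`, which cancel under this condition.
  Incidence : Set
  Incidence = ∀ X L → dot X L ≡ 0F → ∀ u v → σ (lin X L u ⊕ κ X L) ≡ lin L X v →
              pairing (vector τ (δ ∘ σ) L v) (vector τ δ X u) ≡ 0#

  incidence? : Dec Incidence
  incidence? = allPG? λ X → allPG? λ L → (dot X L ≟F 0F) →-dec allU? λ u → allU? λ v →
    (σ (lin X L u ⊕ κ X L) ≟F lin L X v) →-dec (pairing (vector τ (δ ∘ σ) L v) (vector τ δ X u) ≟ 0#)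

  coordinates-of : Structure → Incidence → Coordinates R
  coordinates-of ((p₁ , p₂ , p₃ , p₄ , p₅) , p₆ , p₇ , p₈ , p₉ , p₁₀) inc = record
    { τ = τ ; δ = δ ; σ = σ ; κ = κ ; τ-0 = p₁ ; τ-1 = p₂ ; δ-0 = p₃ ; σ-0 = p₄ ; δ-1≢0 = p₅ ; σ-injective = p₆
    ; decompose = p₇ ; unit-or-δ = p₈ ; δ-ideal = p₉ ; δ² = p₁₀ ; incidence = inc }

code : F → 𝔽₄.Carrier
code 0F = 0F , 0F
code 1F = 1F , 0F
code 2F = 0F , 1F
code 3F = 1F , 1F

module S = Decide S₄ S₄-laws (λ a → code a , 𝔽₄.0#) (λ b → 𝔽₄.0# , code b) id (λ _ _ → 0F)

S-structure : S.Structure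
S-structure = toWitness {a? = S.structure?} _

S-incidence : S.Incidence
S-incidence = toWitness {a? = S.incidence?} _

-- As Xa = a²X, the δ-parts of a line meet squared coordinates of points. Storing square roots
-- of the δ-parts of lines turns their contribution into (lin L X v)².
square : F → F
square a = a ⊗ a

-- Squaring is an involution on the field of four elements, so the equation lin X L u = (lin L X v)²
-- is solved for `lin L X v` by squaring once more.
module T = Decide T₄ T₄-laws (λ a → code a , 𝔽₄.0#) (λ b → 𝔽₄.0# , code b) square (λ _ _ → 0F)

T-structure : T.Structure
T-structure = toWitness {a? = T.structure?} _

T-incidence : T.Incidence
T-incidence = toWitness {a? = T.incidence?} _

module G₄ = FiniteRawRing G₄

-- The representatives 0, 1, X, 1 + X are closed neither under addition nor under multiplication;
-- `carry` accounts for the discrepancy.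
lift double : F → G₄.Carrier
lift 0F = 0F , 0F
lift 1F = 1F , 0F
lift 2F = 0F , 1F
lift 3F = 1F , 1F
double 0F = 0F , 0F
double 1F = 2F , 0F
double 2F = 0F , 2F
double 3F = 2F , 2F

half : G₄.Carrier → F
half (2F , 0F) = 1F
half (0F , 2F) = 2F
half (2F , 2F) = 3F
half _         = 0F

-- Lifts of orthogonal vectors over 𝔽₄ have an even product, half of which is the carry.
carry : PG → PG → F
carry X L = half (pairing (lifted L) (lifted X))
  where
  open Vectors 𝔾₄
  lifted : PG → G₄.Carrier × G₄.Carrier × G₄.Carrier
  lifted X = let (x , y , z) = coordinates X in lift x , lift y , lift z

module G = Decide G₄ G₄-laws lift double id carry

G-structure : G.Structure
G-structure = toWitness {a? = G.structure?} _

G-incidence : G.Incidence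
G-incidence = toWitness {a? = G.incidence?} _

theorem4p18 : (R : FiniteRing) → R ≡ 𝔾₄ ⊎ R ≡ 𝕊₄ ⊎ R ≡ 𝕋₄ → m 7 R ≤ 101
theorem4p18 _ (inj₁ refl)        = Bound.m₇≤101 𝔾₄ (G.coordinates-of G-structure G-incidence)
theorem4p18 _ (inj₂ (inj₁ refl)) = Bound.m₇≤101 𝕊₄ (S.coordinates-of S-structure S-incidence)
theorem4p18 _ (inj₂ (inj₂ refl)) = Bound.m₇≤101 𝕋₄ (T.coordinates-of T-structure T-incidence)
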